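{- Let $d\ge 2$. Among $d$-dimensional cellular automata (given effectively by their finite alphabet, finite neighbourhood and local rule), each of the classes $\mathcal{E}_{qu}$, $\mathcal{S}_{ens}$ and $\mathcal{N}$ is neither recursively enumerable nor co-recursively enumerable, and any two of these three classes are recursively inseparable.
   Context: Let $\mathcal{A}$ be a finite set. The configuration space $\mathcal{A}^{\mathbb{Z}^d}$ carries the metric $d_C(x,y)=2^{ -\min\{\|i\|_\infty : x_i\neq y_i\}}$. A cellular automaton (CA) of dimension $d$ is a map $F(x)(m)=f((x(m+u))_{u\in\mathbb{U}})$ for a finite neighbourhood $\mathbb{U}\subset\mathbb{Z}^d$ and local rule $f:\mathcal{A}^{\mathbb{U}}\to\mathcal{A}$; it is described by the finite data $(\mathcal{A},\mathbb{U},f)$. A point $x$ is an equicontinuous point of $F$ if for every $\epsilon>0$ there is $\delta>0$ such that $d_C(x,y)<\delta$ implies $d_C(F^n(x),F^n(y))<\epsilon$ for all $n\in\mathbb{N}$. $F$ is sensitive to initial conditions if there is $\epsilon>0$ such that for every $\delta>0$ and every $x$ there exist $y$ and $n$ with $d_C(x,y)<\delta$ and $d_C(F^n(x),F^n(y))>\epsilon$. $\mathcal{E}_{qu}$ is the class of CA having at least one equicontinuous point, $\mathcal{S}_{ens}$ the class of CA sensitive to initial conditions, and $\mathcal{N}$ the class of CA in neither $\mathcal{E}_{qu}$ nor $\mathcal{S}_{ens}$. Two disjoint sets $A,B$ are recursively inseparable if there is no recursive set $C$ with $A\subseteq C$ and $C\cap B=\emptyset$. -}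

module Defs where

open import Data.Nat.DivMod using (m%n<n)
open import Data.Nat as ℕ using (ℕ; zero; suc; _≤_; _<_; _⊔_; _%_; _/_)
open import Data.Integer as ℤ using (ℤ; +_; -[1+_]; ∣_∣)
open import Data.Fin as Fin using (Fin; toℕ)
open import Data.Vec as Vec using (Vec; []; _∷_; zipWith; foldr)
open import Data.List as List using (List; []; _∷_; length)
open import Data.Product using (Σ; ∃; _×_; _,_; proj₁; proj₂)
open import Data.Sum using (_⊎_)
open import Data.Empty using (⊥)
open import Relation.Nullary using (¬_)
open import Relation.Binary.PropositionalEquality using (_≡_; _≢_)
open import Function.Bundles using (_⇔_)

data PR : ℕ → Set where
  zeroF : ∀ {n} → PR n
  succF : PR 1
  projF : ∀ {n} → Fin n → PR n
  compF : ∀ {m n} → PR m → Vec (PR n) m → PR n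
  precF : ∀ {n} → PR n → PR (suc (suc n)) → PR (suc n)
  muF   : ∀ {n} → PR (suc n) → PR n

mutual
  data _⟨_⟩⇓_ : ∀ {n} → PR n → Vec ℕ n → ℕ → Set where
    ev-zero : ∀ {n} {xs : Vec ℕ n} → zeroF ⟨ xs ⟩⇓ 0
    ev-succ : ∀ {x} → succF ⟨ x ∷ [] ⟩⇓ suc x
    ev-proj : ∀ {n} {i : Fin n} {xs} → projF i ⟨ xs ⟩⇓ Vec.lookup xs i
    ev-comp : ∀ {m n} {f : PR m} {gs : Vec (PR n) m} {xs ys v} →
              gs ⟨ xs ⟩⇓* ys → f ⟨ ys ⟩⇓ v → compF f gs ⟨ xs ⟩⇓ v
    ev-prec0 : ∀ {n} {f : PR n} {g} {xs v} →
               f ⟨ xs ⟩⇓ v → precF f g ⟨ 0 ∷ xs ⟩⇓ v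
    ev-precS : ∀ {n} {f : PR n} {g} {k xs r v} →
               precF f g ⟨ k ∷ xs ⟩⇓ r → g ⟨ k ∷ r ∷ xs ⟩⇓ v →
               precF f g ⟨ suc k ∷ xs ⟩⇓ v
    ev-mu : ∀ {n} {f : PR (suc n)} {xs k} →
            f ⟨ k ∷ xs ⟩⇓ 0 →
            (∀ j → j < k → ∃ λ v → f ⟨ j ∷ xs ⟩⇓ suc v) →
            muF f ⟨ xs ⟩⇓ k

  data _⟨_⟩⇓*_ : ∀ {m n} → Vec (PR n) m → Vec ℕ n → Vec ℕ m → Set where
    ev-[] : ∀ {n} {xs : Vec ℕ n} → [] ⟨ xs ⟩⇓* []
    ev-∷  : ∀ {m n} {g : PR n} {gs : Vec (PR n) m} {xs y ys} →
            g ⟨ xs ⟩⇓ y → gs ⟨ xs ⟩⇓* ys → (g ∷ gs) ⟨ xs ⟩⇓* (y ∷ ys)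

Recursive : (ℕ → Set) → Set
Recursive S = Σ (PR 1) λ e → ∀ x →
  (S x × e ⟨ x ∷ [] ⟩⇓ 1) ⊎ (¬ S x × e ⟨ x ∷ [] ⟩⇓ 0)

RecEnum : (ℕ → Set) → Set
RecEnum S = Σ (PR 1) λ e → ∀ x → S x ⇔ (∃ λ v → e ⟨ x ∷ [] ⟩⇓ v)

CoRecEnum : (ℕ → Set) → Set
CoRecEnum S = RecEnum (λ x → ¬ S x)

RecInseparable : (ℕ → Set) → (ℕ → Set) → Set₁
RecInseparable A B =
  ¬ (Σ (ℕ → Set) λ C → Recursive C × (∀ x → A x → C x) × (∀ x → C x → B x → ⊥))

Cell : ℕ → Set
Cell d = Vec ℤ d

Config : ℕ → ℕ → Set
Config d a = Cell d → Fin (suc a)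

‖_‖∞ : ∀ {d} → Cell d → ℕ
‖ i ‖∞ = foldr _ (λ z acc → ∣ z ∣ ⊔ acc) 0 i

_⊕_ : ∀ {d} → Cell d → Cell d → Cell d
_⊕_ = zipWith ℤ._+_

-- Finite description of a d-dimensional CA:
-- alphabet Fin (suc alph), neighbourhood U (a finite list of vectors),
-- local rule given by its table: a pattern p : Fin (length U) → Fin (suc alph)
-- has rank Σ_j toℕ (p j) (suc alph)^j and is mapped to (table[rank] mod (suc alph))
-- (0 when the table is too short).  Every local rule arises this way.
record CADesc (d : ℕ) : Set where
  constructor mkCA
  field
    alph  : ℕ
    nbhd  : List (Cell d)
    table : List ℕ

open CADesc public

rank : ∀ (q : ℕ) {m} → (Fin m → Fin q) → ℕ
rank q {zero}  p = 0
rank q {suc m} p = toℕ (p Fin.zero) ℕ.+ q ℕ.* rank q (λ j → p (Fin.suc j))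

nth : List ℕ → ℕ → ℕ
nth []       _       = 0
nth (x ∷ xs) zero    = x
nth (x ∷ xs) (suc k) = nth xs k

localRule : ∀ {d} (c : CADesc d) → (Fin (length (nbhd c)) → Fin (suc (alph c))) → Fin (suc (alph c))
localRule c p = Fin.fromℕ< (m%n<n (nth (table c) (rank (suc (alph c)) p)) (suc (alph c)))

global : ∀ {d} (c : CADesc d) → Config d (alph c) → Config d (alph c)
global c x m = localRule c (λ j → x (m ⊕ List.lookup (nbhd c) j))

iter : ∀ {A : Set} → (A → A) → ℕ → A → A
iter F zero    x = x
iter F (suc n) x = F (iter F n x)

-- d_C(x,y) < 2^{-r}  ⇔  x and y agree on every cell i with ‖i‖∞ ≤ r
Close : ∀ {d a} → ℕ → Config d a → Config d a → Set
Close r x y = ∀ i → ‖ i ‖∞ ≤ r → x i ≡ y i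

-- d_C(x,y) > 2^{-r}  ⇔  x and y differ at some cell i with ‖i‖∞ < r
Far : ∀ {d a} → ℕ → Config d a → Config d a → Set
Far r x y = ∃ λ i → ‖ i ‖∞ < r × x i ≢ y i

-- equicontinuous point (ε = 2^{-r}, δ = 2^{-s})
EquPoint : ∀ {d a} → (Config d a → Config d a) → Config d a → Set
EquPoint F x = ∀ r → ∃ λ s → ∀ y → Close s x y → ∀ n → Close r (iter F n x) (iter F n y)

HasEquPoint : ∀ {d a} → (Config d a → Config d a) → Set
HasEquPoint {d} {a} F = Σ (Config d a) λ x → EquPoint F x

Sensitive : ∀ {d a} → (Config d a → Config d a) → Set
Sensitive {d} {a} F = ∃ λ r → ∀ s → ∀ (x : Config d a) →
  ∃ λ y → ∃ λ n → Close s x y × Far r (iter F n x) (iter F n y)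

-- inverse of the Cantor pairing (enumerating ℕ×ℕ diagonal by diagonal)
unpair : ℕ → ℕ × ℕ
unpair zero    = 0 , 0
unpair (suc n) with unpair n
... | x , zero    = 0 , suc x
... | x , suc y   = suc x , y

decodeListF : ℕ → ℕ → List ℕ
decodeListF zero     _       = []
decodeListF (suc f)  zero    = []
decodeListF (suc f)  (suc m) = proj₁ (unpair m) ∷ decodeListF f (proj₂ (unpair m))

decodeList : ℕ → List ℕ
decodeList n = decodeListF n n

decodeℤ : ℕ → ℤ
decodeℤ n with n % 2
... | zero  = + (n / 2)
... | suc _ = -[1+ n / 2 ]

decodeCell : ∀ d → List ℕ → Cell d
decodeCell zero    _        = []
decodeCell (suc d) []       = + 0 ∷ decodeCell d []
decodeCell (suc d) (k ∷ ks) = decodeℤ k ∷ decodeCell d ks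

decodeCA : ∀ d → ℕ → CADesc d
decodeCA d n =
  mkCA (proj₁ (unpair n))
       (List.map (λ k → decodeCell d (decodeList k)) (decodeList (proj₁ (unpair (proj₂ (unpair n))))))
       (decodeList (proj₂ (unpair (proj₂ (unpair n)))))

Equ : ℕ → ℕ → Set
Equ d n = HasEquPoint (global (decodeCA d n))

Sens : ℕ → ℕ → Set
Sens d n = Sensitive (global (decodeCA d n))

NeitherEquSens : ℕ → ℕ → Set
NeitherEquSens d n = ¬ Equ d n × ¬ Sens d n

NotRENotCoRE : (ℕ → Set) → Set
NotRENotCoRE S = ¬ RecEnum S × ¬ CoRecEnum S

{-# OPTIONS --safe #-}

-- A counter machine M is turned into a planar automaton whose tiles, as long as they pass local checks,
-- form space-time diagrams of M growing from a centre.  A tile only depends on tiles nearer to the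
-- centre, so ideal diagrams are robust under perturbations far away, whereas in a configuration with
-- finitely many tiles all faulty ones are erased and the remaining ones are genuine computations.  Besides,
-- every cell carries a bit.  Bits are wiped out in the cores (blocks of blocking tiles) and elsewhere move
-- southwards, passing around the cores; hence a cell outside the cores is eventually reached by the bits
-- surrounding a finite region.  Whether large cores exist is governed by M: depending on the choice of
-- the blocking tiles, halting and looping give Equ / Sens, Sens / Neither or Neither / Equ.
--
-- The inputs of M are read off two neighbourhood offsets, which affect neither the alphabet nor the table.
-- Taking the alphabet size and the table code as offsets, M can compute the code of its own automaton and
-- run on it any alleged decision procedure, doing the opposite of what is predicted.
module Submission where

open import Defs
open import Data.Bool as Bool using (Bool; true; false; if_then_else_; not)
open import Data.Empty using (⊥; ⊥-elim)
open import Data.Fin as Fin using (Fin; toℕ; fromℕ<; combine; remQuot; join; splitAt) renaming (zero to fz; suc to fs)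
open import Data.Fin.Properties using (all?; fromℕ<-cong; fromℕ<-toℕ; remQuot-combine; splitAt-join; toℕ-fromℕ<; toℕ-injective; toℕ<n)
open import Data.Integer as ℤ using (ℤ; +_; -[1+_]; ∣_∣)
import Data.Integer.Properties as ℤₚ
open import Data.List as List using (List; []; _∷_)
open import Data.List.Properties using (map-cong; map-tabulate; map-∘; tabulate-lookup)
open import Data.Maybe as Maybe using (Maybe; just; nothing; maybe)
open import Data.Maybe.Properties using (just-injective)
open import Data.Maybe.Relation.Unary.Any as Any using (Any) renaming (just to some)
open import Data.Nat using (ℕ; zero; suc; pred; _+_; _*_; _^_; _∸_; _/_; _%_; _⊔_; _≤_; _<_; _<ᵇ_; _≟_; z≤n; s≤s; s≤s⁻¹)
open import Data.Nat.DivMod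
open import Data.Nat.Divisibility using (divides)
open import Data.Nat.Properties
open import Data.Product using (∃; _×_; _,_; proj₁; proj₂)
open import Data.Sum using (_⊎_; inj₁; inj₂; map₂)
open import Data.Unit using (⊤; tt)
open import Data.Vec as Vec using (Vec; []; _∷_; lookup; replicate; tabulate)
open import Data.Vec.Properties using (lookup-map; lookup-replicate; lookup∘tabulate; tabulate-cong; tabulate∘lookup)
open import Data.Vec.Relation.Unary.All as VAll using ([]; _∷_) renaming (All to AllV)
open import Function using (_∘_)
open import Function.Bundles using (Equivalence)
open import Relation.Binary.Definitions using (tri<; tri≈; tri>)
open import Relation.Binary.PropositionalEquality
open import Relation.Nullary using (¬_; Dec; yes; no; does; contradiction)
open import Relation.Nullary.Decidable using (_×-dec_; _→-dec_; dec-false; dec-true; map′)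

-- Three conflicting demands shape the construction. Self-reference asks for an input independent of
-- alphabet and table, so tiles receive numbers as lengths: a cell that far west of a centre sees it
-- through the offset. Sensitivity must hold around every configuration, however full of stray
-- tiles; so configurations are first cut to finite ones. Robustness must resist infinite
-- perturbations, so the checks of a tile stay in a diamond about its centre. The classes are told
-- apart by protected windows. One point with windows of every size around it gives Equ; windows of
-- every size at different points merely refute Sens. Blocking strictly above the base row only, or
-- everywhere except in halted rows, leaves large protected windows off the centre but none
-- containing the centre and its vicinity, which is Neither. The families form a cycle: each class
-- occurs once on the halting side, refuting co-enumerability, and once on the looping side,
-- refuting enumerability.

-- Determinism of recursive evaluation

mutual
  ⇓-det : ∀ {n} {f : PR n} {xs v w} → f ⟨ xs ⟩⇓ v → f ⟨ xs ⟩⇓ w → v ≡ w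
  ⇓-det ev-zero ev-zero = refl
  ⇓-det ev-succ ev-succ = refl
  ⇓-det ev-proj ev-proj = refl
  ⇓-det (ev-comp gs f) (ev-comp gs′ f′) with refl ← ⇓*-det gs gs′ = ⇓-det f f′
  ⇓-det (ev-prec0 d) (ev-prec0 d′) = ⇓-det d d′
  ⇓-det (ev-precS r d) (ev-precS r′ d′) with refl ← ⇓-det r r′ = ⇓-det d d′
  ⇓-det (ev-mu {k = k} d h) (ev-mu {k = k′} d′ h′) with <-cmp k k′
  ... | tri< k<k′ _ _ with _ , e ← h′ k k<k′ with () ← ⇓-det d e
  ... | tri≈ _ eq _ = eq
  ... | tri> _ _ k′<k with _ , e ← h k′ k′<k with () ← ⇓-det d′ e

  ⇓*-det : ∀ {m n} {gs : Vec (PR n) m} {xs vs ws} → gs ⟨ xs ⟩⇓* vs → gs ⟨ xs ⟩⇓* ws → vs ≡ ws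
  ⇓*-det ev-[] ev-[] = refl
  ⇓*-det (ev-∷ d ds) (ev-∷ e es) = cong₂ _∷_ (⇓-det d e) (⇓*-det ds es)

-- While programs

Store : Set
Store = ℕ → ℕ

data Expr (R : Set) : Set where
  zeroE : Expr R
  copyE sucE predE : R → Expr R

evalE : {R : Set} → (R → ℕ) → Expr R → ℕ
evalE σ zeroE     = 0
evalE σ (copyE r) = σ r
evalE σ (sucE r) = suc (σ r)
evalE σ (predE r) = pred (σ r)

opaque
  upd : Store → ℕ → ℕ → Store
  upd σ r v x with x ≟ r
  ... | yes _ = v
  ... | no _  = σ x

  upd-same : ∀ σ r v → upd σ r v r ≡ v
  upd-same σ r v with r ≟ r
  ... | yes _ = refl
  ... | no ne = contradiction refl ne

  upd-other : ∀ σ {r} v {x} → x ≢ r → upd σ r v x ≡ σ x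
  upd-other σ {r} v {x} ne with x ≟ r
  ... | yes e = contradiction e ne
  ... | no _  = refl

infixr 5 _⨾_
data Prog : Set where
  set   : ℕ → Expr ℕ → Prog
  _⨾_   : Prog → Prog → Prog
  while : ℕ → Prog → Prog

data _⊢_⇓_ : Prog → Store → Store → Set where
  b-set  : ∀ {r ex σ} → set r ex ⊢ σ ⇓ upd σ r (evalE σ ex)
  b-seq  : ∀ {p q σ σ₁ σ₂} → p ⊢ σ ⇓ σ₁ → q ⊢ σ₁ ⇓ σ₂ → (p ⨾ q) ⊢ σ ⇓ σ₂
  b-end  : ∀ {r p σ} → σ r ≡ 0 → while r p ⊢ σ ⇓ σ
  b-loop : ∀ {r p σ σ₁ σ₂} → σ r ≢ 0 → p ⊢ σ ⇓ σ₁ → while r p ⊢ σ₁ ⇓ σ₂ → while r p ⊢ σ ⇓ σ₂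

regs : ℕ → (m : ℕ) → Vec ℕ m
regs b zero    = []
regs b (suc m) = b ∷ regs (suc b) m

-- Register layout of the recursion loop: `b` counts the rounds left, `1 + b` is the index, `2 + b`
-- the value reached so far, and `3 + b` is where `p` leaves the next value.
precBody : ℕ → Prog → Prog
precBody b p = p ⨾ set (2 + b) (copyE (3 + b)) ⨾ set (1 + b) (sucE (1 + b)) ⨾ set b (predE b)

muBody : ℕ → Prog → Prog
muBody b p = set b (sucE b) ⨾ p

-- The value is left in register b; only registers ≥ b are written.
mutual
  compile : ∀ {n} → PR n → Vec ℕ n → ℕ → Prog
  compile zeroF              xs       b = set b zeroE
  compile succF              (x ∷ []) b = set b (sucE x)
  compile (projF i)          xs       b = set b (copyE (lookup xs i))
  compile (compF {m = m} f gs) xs     b = compile* gs xs b ⨾ compile f (regs b m) (m + b) ⨾ set b (copyE (m + b))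
  compile (precF f g)        (x ∷ xs) b =
    compile f xs (2 + b) ⨾ set b (copyE x) ⨾ set (1 + b) zeroE ⨾
    while b (precBody b (compile g (1 + b ∷ 2 + b ∷ xs) (3 + b))) ⨾ set b (copyE (2 + b))
  compile (muF f)            xs       b =
    set b zeroE ⨾ compile f (b ∷ xs) (1 + b) ⨾ while (1 + b) (muBody b (compile f (b ∷ xs) (1 + b)))

  compile* : ∀ {m n} → Vec (PR n) m → Vec ℕ n → ℕ → Prog
  -- `Prog` has no empty program; by now `b` lies past the registers holding the values, so clearing
  -- it is harmless.
  compile* []       xs b = set b zeroE
  compile* (g ∷ gs) xs b = compile g xs b ⨾ compile* gs xs (suc b)

-- Correctness of the compiler

Below : ℕ → Store → Store → Set
Below b σ τ = ∀ r → r < b → τ r ≡ σ r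

below-upd : ∀ {b σ τ r v} → b ≤ r → Below b σ τ → Below b σ (upd τ r v)
below-upd b≤r h x x<b = trans (upd-other _ _ (<⇒≢ (<-≤-trans x<b b≤r))) (h x x<b)

below-mono : ∀ {a b σ τ} → a ≤ b → Below b σ τ → Below a σ τ
below-mono a≤b h r r<a = h r (<-≤-trans r<a a≤b)

below-trans : ∀ {b σ τ υ} → Below b σ τ → Below b τ υ → Below b σ υ
below-trans h k r r<b = trans (k r r<b) (h r r<b)

below-map : ∀ {b σ τ n} {xs : Vec ℕ n} → AllV (_< b) xs → Below b σ τ → Vec.map τ xs ≡ Vec.map σ xs
below-map []       h = refl
below-map (p ∷ ps) h = cong₂ _∷_ (h _ p) (below-map ps h)

lt-weaken : ∀ {n a b} {xs : Vec ℕ n} → a ≤ b → AllV (_< a) xs → AllV (_< b) xs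
lt-weaken a≤b = VAll.map (λ p → <-≤-trans p a≤b)

Post : ℕ → Store → Store → ℕ → Set
Post b σ τ v = Below b σ τ × τ b ≡ v

regs-lt : ∀ b m → AllV (_< m + b) (regs b m)
regs-lt b zero    = []
regs-lt b (suc m) = s≤s (m≤n+m b m) ∷ subst (λ c → AllV (_< c) (regs (suc b) m)) (+-suc m b) (regs-lt (suc b) m)

-- The store after the three assignments that close `precBody`, spelled out so that a chain of
-- `b-set` ends in it definitionally.
shift : ℕ → Store → Store
shift b υ = let υ₁ = upd υ (2 + b) (υ (3 + b)) ; υ₂ = upd υ₁ (1 + b) (suc (υ₁ (1 + b))) in upd υ₂ b (pred (υ₂ b))

2+n≢n : ∀ {n} → suc (suc n) ≢ n
2+n≢n q = <⇒≢ (m≤n+m _ 1) (sym q)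

module _ {b : ℕ} {σ υ : Store} where
  shift-below : Below b σ υ → Below b σ (shift b υ)
  shift-below h = below-upd ≤-refl (below-upd (n≤1+n b) (below-upd (m≤n+m b 2) h))

  shift-0 : shift b υ b ≡ pred (υ b)
  shift-0 = trans (upd-same _ b _) (cong pred (trans (upd-other _ _ (λ q → 1+n≢n (sym q))) (upd-other υ _ (λ q → 2+n≢n (sym q)))))

  shift-1 : shift b υ (1 + b) ≡ suc (υ (1 + b))
  shift-1 = trans (upd-other _ _ 1+n≢n) (trans (upd-same _ (1 + b) _) (cong suc (upd-other υ _ (λ q → 1+n≢n (sym q)))))

  shift-2 : shift b υ (2 + b) ≡ υ (3 + b)
  shift-2 = trans (upd-other _ _ 2+n≢n) (trans (upd-other _ _ 1+n≢n) (upd-same υ (2 + b) _))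

PrecInv : ℕ → Store → ℕ → ℕ → ℕ → Store → Set
PrecInv b σ c k r τ = Below b σ τ × τ b ≡ c × τ (1 + b) ≡ k × τ (2 + b) ≡ r

inv-shift : ∀ {b σ c k r τ υ v} → PrecInv b σ (suc c) k r τ → Post (3 + b) τ υ v → PrecInv b σ c (suc k) v (shift b υ)
inv-shift {b} {σ} {υ = υ} (bel , ec , ek , _) (pb , pv) =
  shift-below {b} {σ} {υ} (below-trans bel (below-mono (m≤n+m b 3) pb)) ,
  trans (shift-0 {b} {σ} {υ}) (cong pred (trans (pb b (s≤s (m≤n+m b 2))) ec)) ,
  trans (shift-1 {b} {σ} {υ}) (cong suc (trans (pb (1 + b) (s≤s (s≤s (m≤n+m b 1)))) ek)) ,
  trans (shift-2 {b} {σ} {υ}) pv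

module PrecLoop {n} (f : PR n) (g : PR (2 + n)) (b : ℕ) (xs : Vec ℕ n) (σ : Store) (body : Prog) where
  ys : Vec ℕ n
  ys = Vec.map σ xs

  -- An evaluation of `precF` unfolds from `k` down to 0 while the loop climbs from 0. So the
  -- statement takes what the loop does after reaching `k` as a continuation and returns what it
  -- does from the start.
  fwdPrec : (∀ τ {c k r v} → PrecInv b σ c k r τ → g ⟨ k ∷ r ∷ ys ⟩⇓ v → ∃ λ υ → body ⊢ τ ⇓ υ × Post (3 + b) τ υ v) →
    ∀ {k r} → precF f g ⟨ k ∷ ys ⟩⇓ r → ∀ c {P : Store → Set} →
    (∀ τ → PrecInv b σ c k r τ → ∃ λ υ → while b (precBody b body) ⊢ τ ⇓ υ × P υ) →
    ∃ λ r₀ → f ⟨ ys ⟩⇓ r₀ × (∀ τ → PrecInv b σ (k + c) 0 r₀ τ → ∃ λ υ → while b (precBody b body) ⊢ τ ⇓ υ × P υ)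
  fwdPrec H (ev-prec0 d) c K = _ , d , K
  fwdPrec H (ev-precS {k = k} {r = r} d e) c {P} K with fwdPrec H d (suc c) {P} step
    where
    step : ∀ τ → PrecInv b σ (suc c) k r τ → ∃ λ υ → while b (precBody b body) ⊢ τ ⇓ υ × P υ
    step τ inv with H τ inv e
    ... | υ , run , post with K (shift b υ) (inv-shift inv post)
    ... | ω , run′ , Pω = ω , b-loop (λ z → 1+n≢0 (trans (sym (proj₁ (proj₂ inv))) z)) (b-seq run (b-seq b-set (b-seq b-set b-set))) run′ , Pω
  ... | r₀ , f⇓ , R = r₀ , f⇓ , λ τ (bel , ec , rest) → R τ (bel , trans ec (sym (+-suc k c)) , rest)

  bwdPrec : (∀ τ υ {c k r} → PrecInv b σ c k r τ → body ⊢ τ ⇓ υ → ∃ λ v → g ⟨ k ∷ r ∷ ys ⟩⇓ v × Post (3 + b) τ υ v) →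
    ∀ {τ ω c k r} → while b (precBody b body) ⊢ τ ⇓ ω → PrecInv b σ c k r τ → precF f g ⟨ k ∷ ys ⟩⇓ r →
    ∃ λ v → precF f g ⟨ k + c ∷ ys ⟩⇓ v × Below b σ ω × ω (2 + b) ≡ v
  bwdPrec H {k = k} (b-end z) (bel , ec , ek , er) d =
    _ , subst (λ l → precF f g ⟨ l ∷ ys ⟩⇓ _) (trans (sym (+-identityʳ k)) (cong (λ c → k + c) (trans (sym z) ec))) d , bel , er
  bwdPrec H {c = zero} (b-loop nz _ _) (bel , ec , _) d = contradiction ec nz
  bwdPrec H {c = suc c} {k} (b-loop nz (b-seq run (b-seq b-set (b-seq b-set b-set))) run′) inv d with H _ _ inv run
  ... | v , e , post with bwdPrec H run′ (inv-shift inv post) (ev-precS d e)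
  ... | w , d′ , rest = w , subst (λ l → precF f g ⟨ l ∷ ys ⟩⇓ w) (sym (+-suc k c)) d′ , rest

MuInv : ℕ → Store → ℕ → ℕ → Store → Set
MuInv b σ k w τ = Below b σ τ × τ b ≡ k × τ (1 + b) ≡ w

mu-val : ∀ {n} {f : PR (suc n)} {k ys} → f ⟨ k ∷ ys ⟩⇓ 0 → (∀ j → j < k → ∃ λ v → f ⟨ j ∷ ys ⟩⇓ suc v) →
         ∀ {j} → j ≤ k → ∃ λ v → f ⟨ j ∷ ys ⟩⇓ v
mu-val d h {j} j≤k with m≤n⇒m<n∨m≡n j≤k
... | inj₁ j<k  = let v , e = h j j<k in suc v , e
... | inj₂ refl = 0 , d

module MuLoop {n} (f : PR (suc n)) (b : ℕ) (xs : Vec ℕ n) (σ : Store) (body : Prog) where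
  ys : Vec ℕ n
  ys = Vec.map σ xs

  inv-next : ∀ {k w τ υ v} → MuInv b σ k w τ → Post (1 + b) (upd τ b (suc (τ b))) υ v → MuInv b σ (suc k) v υ
  inv-next {τ = τ} (bel , ek , _) (pb , pv) =
    below-trans (below-upd ≤-refl bel) (below-mono (n≤1+n b) pb) , trans (pb b ≤-refl) (trans (upd-same τ b _) (cong suc ek)) , pv

  -- `i` counts the candidates left before the least zero. Determinism excludes an earlier stop,
  -- since every smaller candidate has a successor as its value.
  fwdMu : (∀ τ {k v} → Below b σ τ → τ b ≡ k → f ⟨ k ∷ ys ⟩⇓ v → ∃ λ υ → body ⊢ τ ⇓ υ × Post (1 + b) τ υ v) →
    ∀ {k} → f ⟨ k ∷ ys ⟩⇓ 0 → (∀ j → j < k → ∃ λ v → f ⟨ j ∷ ys ⟩⇓ suc v) →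
    ∀ i {j} → i + j ≡ k → ∀ {τ w} → MuInv b σ j w τ → f ⟨ j ∷ ys ⟩⇓ w →
    ∃ λ υ → while (1 + b) (muBody b body) ⊢ τ ⇓ υ × Below b σ υ × υ b ≡ k
  fwdMu H d h zero refl {τ} (bel , ek , ew) e = τ , b-end (trans ew (⇓-det e d)) , bel , ek
  fwdMu H {k} d h (suc i) {j} eq {τ} {w} inv@(bel , ek , ew) e
    with next ← subst (suc j ≤_) eq (s≤s (m≤n+m j i))
    with v , e₁ ← h j next
    with v′ , e₂ ← mu-val d h next
    with υ , run , post ← H (upd τ b (suc (τ b))) (below-upd ≤-refl bel) (trans (upd-same τ b _) (cong suc ek)) e₂
    with ω , run′ , rest ← fwdMu H d h i (trans (+-suc i j) eq) (inv-next inv post) e₂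
    = ω , b-loop (λ z → 1+n≢0 (trans (⇓-det e₁ e) (trans (sym ew) z))) (b-seq b-set run) run′ , rest

  bwdMu : (∀ τ υ {k} → Below b σ τ → τ b ≡ k → body ⊢ τ ⇓ υ → ∃ λ v → f ⟨ k ∷ ys ⟩⇓ v × Post (1 + b) τ υ v) →
    ∀ {τ ω k w} → while (1 + b) (muBody b body) ⊢ τ ⇓ ω → MuInv b σ k w τ → f ⟨ k ∷ ys ⟩⇓ w →
    (∀ j → j < k → ∃ λ v → f ⟨ j ∷ ys ⟩⇓ suc v) →
    ∃ λ v → muF f ⟨ ys ⟩⇓ v × Below b σ ω × ω b ≡ v
  bwdMu H (b-end z) (bel , ek , ew) e h = _ , ev-mu (subst (λ l → f ⟨ _ ∷ ys ⟩⇓ l) (trans (sym ew) z) e) h , bel , ek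
  bwdMu H {k = k} {zero} (b-loop nz _ _) (_ , _ , ew) e h = contradiction ew nz
  bwdMu H {τ} {k = k} {suc w} (b-loop nz (b-seq b-set run) run′) inv@(bel , ek , _) e h
    with v , e₁ , post ← H _ _ (below-upd ≤-refl bel) (trans (upd-same τ b _) (cong suc ek)) run
    = bwdMu H run′ (inv-next inv post) e₁ h′
    where
    h′ : ∀ j → j < suc k → ∃ λ v → f ⟨ j ∷ ys ⟩⇓ suc v
    h′ j (s≤s j≤k) with j ≟ k
    ... | yes refl = w , e
    ... | no ne    = h j (≤∧≢⇒< j≤k ne)

prec-args : ∀ {n b σ c k r τ} {xs : Vec ℕ n} → AllV (_< b) xs → PrecInv b σ c k r τ →
            Vec.map τ (1 + b ∷ 2 + b ∷ xs) ≡ k ∷ r ∷ Vec.map σ xs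
prec-args lt (bel , _ , ek , er) = cong₂ _∷_ ek (cong₂ _∷_ er (below-map lt bel))

prec-lt : ∀ {n b} {xs : Vec ℕ n} → AllV (_< b) xs → AllV (_< 3 + b) (1 + b ∷ 2 + b ∷ xs)
prec-lt {b = b} lt = s≤s (s≤s (n≤1+n b)) ∷ ≤-refl ∷ lt-weaken (m≤n+m b 3) lt

mu-lt : ∀ {n b} {xs : Vec ℕ n} → AllV (_< b) xs → AllV (_< 1 + b) (b ∷ xs)
mu-lt {b = b} lt = ≤-refl ∷ lt-weaken (n≤1+n b) lt

precInit : ∀ {b σ υ v x} → x < b → Post (2 + b) σ υ v →
  PrecInv b σ (σ x) 0 v (upd (upd υ b (υ x)) (1 + b) 0)
precInit {b} {υ = υ} x<b (pb , pv) =
  below-upd (n≤1+n b) (below-upd ≤-refl (below-mono (m≤n+m b 2) pb)) ,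
  trans (upd-other _ 0 (λ q → 1+n≢n (sym q))) (trans (upd-same υ b _) (pb _ (<-≤-trans x<b (m≤n+m b 2)))) ,
  upd-same _ (1 + b) 0 ,
  trans (upd-other _ 0 1+n≢n) (trans (upd-other υ _ 2+n≢n) pv)

RegsPost : ∀ {m} → ℕ → Store → Store → Vec ℕ m → Set
RegsPost {m} b σ τ vs = Below b σ τ × Vec.map τ (regs b m) ≡ vs

mutual
  -- Definedness forces termination. The converse `backward` matters just as much, because looping
  -- of the machine is as meaningful as halting.
  forward : ∀ {n} (e : PR n) {xs b σ v} → AllV (_< b) xs → e ⟨ Vec.map σ xs ⟩⇓ v →
            ∃ λ τ → compile e xs b ⊢ σ ⇓ τ × Post b σ τ v
  forward zeroF {b = b} {σ} lt ev-zero = _ , b-set , below-upd ≤-refl (λ _ _ → refl) , upd-same σ b _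
  forward succF {x ∷ []} {b} {σ} lt ev-succ = _ , b-set , below-upd ≤-refl (λ _ _ → refl) , upd-same σ b _
  forward (projF i) {xs} {b} {σ} lt ev-proj =
    _ , b-set , below-upd ≤-refl (λ _ _ → refl) , trans (upd-same σ b _) (sym (lookup-map i σ xs))
  forward (compF {m = m} f gs) {b = b} {σ} lt (ev-comp {ys = ys} ds d)
    with τ , run , bel , eq ← forward* gs lt ds
    with υ , run′ , pb , pv ← forward f {regs b m} {m + b} {τ} (regs-lt b m) (subst (λ zs → f ⟨ zs ⟩⇓ _) (sym eq) d)
    = _ , b-seq run (b-seq run′ b-set) , below-upd ≤-refl (below-trans bel (below-mono (m≤n+m b m) pb)) , trans (upd-same υ b _) pv
  forward (precF f g) {x ∷ xs} {b} {σ} (l ∷ lt) d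
    with r₀ , d₀ , loop ← PrecLoop.fwdPrec f g b xs σ (compile g (1 + b ∷ 2 + b ∷ xs) (3 + b)) (λ τ {v = v} inv e → forward g (prec-lt lt) (subst (λ zs → g ⟨ zs ⟩⇓ v) (sym (prec-args lt inv)) e)) d 0
                            {λ υ → Below b σ υ × υ (2 + b) ≡ _} (λ { τ (bel , ec , ek , er) → τ , b-end ec , bel , er })
    with τ , run , post ← forward f (lt-weaken (m≤n+m b 2) lt) d₀
    with υ , run′ , bel , er ← loop _ (subst (λ c → PrecInv b σ c 0 r₀ _) (sym (+-identityʳ (σ x))) (precInit l post))
    = _ , b-seq run (b-seq b-set (b-seq b-set (b-seq run′ b-set))) , below-upd ≤-refl bel , trans (upd-same υ b _) er
  forward (muF f) {xs} {b} {σ} lt (ev-mu {k = k} d h)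
    with v , e ← mu-val d h z≤n
    with τ , run , pb , pv ← forward f {b ∷ xs} {1 + b} {upd σ b 0} (mu-lt lt)
                 (subst (λ zs → f ⟨ zs ⟩⇓ v) (sym (cong₂ _∷_ (upd-same σ b 0) (below-map lt (below-upd ≤-refl (λ _ _ → refl))))) e)
    with υ , run′ , rest ← MuLoop.fwdMu f b xs σ (compile f (b ∷ xs) (1 + b)) (λ τ {v = v} bel ek e → forward f (mu-lt lt) (subst (λ zs → f ⟨ zs ⟩⇓ v) (sym (cong₂ _∷_ ek (below-map lt bel))) e))
                 d h k (+-identityʳ k) {τ}
                 (below-trans (below-upd ≤-refl (λ _ _ → refl)) (below-mono (n≤1+n b) pb) , trans (pb b ≤-refl) (upd-same σ b 0) , pv) e
    = υ , b-seq b-set (b-seq run run′) , rest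

  forward* : ∀ {m n} (gs : Vec (PR n) m) {xs b σ vs} → AllV (_< b) xs → gs ⟨ Vec.map σ xs ⟩⇓* vs →
             ∃ λ τ → compile* gs xs b ⊢ σ ⇓ τ × RegsPost b σ τ vs
  forward* [] lt ev-[] = _ , b-set , below-upd ≤-refl (λ _ _ → refl) , refl
  forward* (g ∷ gs) {b = b} lt (ev-∷ d ds)
    with τ , run , pb , pv ← forward g lt d
    with υ , run′ , bel , eq ← forward* gs (lt-weaken (n≤1+n b) lt) (subst (λ zs → gs ⟨ zs ⟩⇓* _) (sym (below-map lt pb)) ds)
    = υ , b-seq run run′ , below-trans pb (below-mono (n≤1+n b) bel) , cong₂ _∷_ (trans (bel b ≤-refl) pv) eq

mutual
  -- A value can be read off any terminating run, so an undefined expression compiles to a looping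
  -- program. The induction follows the expression; only the loops recurse on the run.
  backward : ∀ {n} (e : PR n) {xs b σ τ} → AllV (_< b) xs → compile e xs b ⊢ σ ⇓ τ →
             ∃ λ v → e ⟨ Vec.map σ xs ⟩⇓ v × Post b σ τ v
  backward zeroF {b = b} {σ} lt b-set = _ , ev-zero , below-upd ≤-refl (λ _ _ → refl) , upd-same σ b _
  backward succF {x ∷ []} {b} {σ} lt b-set = _ , ev-succ , below-upd ≤-refl (λ _ _ → refl) , upd-same σ b _
  backward (projF i) {xs} {b} {σ} lt b-set =
    _ , ev-proj , below-upd ≤-refl (λ _ _ → refl) , trans (upd-same σ b _) (sym (lookup-map i σ xs))
  backward (compF {m = m} f gs) {b = b} {σ} lt (b-seq run (b-seq run′ b-set))
    with vs , ds , bel , eq ← backward* gs lt run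
    with v , d , pb , pv ← backward f (regs-lt b m) run′
    = v , ev-comp ds (subst (λ zs → f ⟨ zs ⟩⇓ v) eq d) , below-upd ≤-refl (below-trans bel (below-mono (m≤n+m b m) pb)) , trans (upd-same _ b _) pv
  backward (precF f g) {x ∷ xs} {b} {σ} (l ∷ lt) (b-seq run (b-seq b-set (b-seq b-set (b-seq run′ b-set))))
    with r₀ , d₀ , post ← backward f (lt-weaken (m≤n+m b 2) lt) run
    with v , d , bel , er ← PrecLoop.bwdPrec f g b xs σ (compile g (1 + b ∷ 2 + b ∷ xs) (3 + b)) (λ τ υ inv r → let v , e , p = backward g (prec-lt lt) r in v , subst (λ zs → g ⟨ zs ⟩⇓ v) (prec-args lt inv) e , p)
                               run′ (precInit l post) (ev-prec0 d₀)
    = v , d , below-upd ≤-refl bel , trans (upd-same _ b _) er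
  backward (muF f) {xs} {b} {σ} lt (b-seq b-set (b-seq run run′))
    with v , e , pb , pv ← backward f (mu-lt lt) run
    = MuLoop.bwdMu f b xs σ (compile f (b ∷ xs) (1 + b)) (λ τ υ bel ek r → let v , e , p = backward f (mu-lt lt) r in v , subst (λ zs → f ⟨ zs ⟩⇓ v) (cong₂ _∷_ ek (below-map lt bel)) e , p)
        run′ (below-trans (below-upd ≤-refl (λ _ _ → refl)) (below-mono (n≤1+n b) pb) , trans (pb b ≤-refl) (upd-same σ b 0) , pv)
        (subst (λ zs → f ⟨ zs ⟩⇓ v) (cong₂ _∷_ (upd-same σ b 0) (below-map lt (below-upd ≤-refl (λ _ _ → refl)))) e) (λ _ ())

  backward* : ∀ {m n} (gs : Vec (PR n) m) {xs b σ τ} → AllV (_< b) xs → compile* gs xs b ⊢ σ ⇓ τ →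
              ∃ λ vs → gs ⟨ Vec.map σ xs ⟩⇓* vs × RegsPost b σ τ vs
  backward* [] lt b-set = _ , ev-[] , below-upd ≤-refl (λ _ _ → refl) , refl
  backward* (g ∷ gs) {b = b} lt (b-seq run run′)
    with v , d , pb , pv ← backward g lt run
    with vs , ds , bel , eq ← backward* gs (lt-weaken (n≤1+n b) lt) run′
    = v ∷ vs , ev-∷ d (subst (λ zs → gs ⟨ zs ⟩⇓* vs) (below-map lt pb) ds) , below-trans pb (below-mono (n≤1+n b) bel) , cong₂ _∷_ (trans (bel b ≤-refl) pv) eq

-- Finite sets

-- A retract of `Fin` rather than a bijection: less has to be carried through products, sums and
-- vectors. Symbols outside the image of `enc` may then occur in a configuration; one step of the
-- automaton removes them.
record Enum (A : Set) : Set where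
  field
    size    : ℕ
    enc     : A → Fin (suc size)
    dec     : Fin (suc size) → A
    dec-enc : ∀ x → dec (enc x) ≡ x

  enc-injective : ∀ {x y} → enc x ≡ enc y → x ≡ y
  enc-injective {x} {y} eq = trans (sym (dec-enc x)) (trans (cong dec eq) (dec-enc y))

  _≟ᴱ_ : (x y : A) → Dec (x ≡ y)
  x ≟ᴱ y with enc x Fin.≟ enc y
  ... | yes eq = yes (enc-injective eq)
  ... | no ne  = no (λ eq → ne (cong enc eq))

⊤-enum : Enum ⊤
⊤-enum = record { size = 0 ; enc = λ _ → fz ; dec = λ _ → tt ; dec-enc = λ _ → refl }

×-enum : ∀ {A B} → Enum A → Enum B → Enum (A × B)
×-enum {A} {B} EA EB = record
  { size = _
  ; enc = λ (x , y) → combine (A.enc x) (B.enc y)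
  ; dec = λ i → let j , k = remQuot {suc A.size} (suc B.size) i in A.dec j , B.dec k
  ; dec-enc = λ (x , y) → trans (cong (λ (j , k) → A.dec j , B.dec k) (remQuot-combine (A.enc x) (B.enc y)))
                                (cong₂ _,_ (A.dec-enc x) (B.dec-enc y)) }
  where module A = Enum EA
        module B = Enum EB

⊎-enum : ∀ {A B} → Enum A → Enum B → Enum (A ⊎ B)
⊎-enum {A} {B} EA EB = record
  { size = _
  ; enc = λ x → join (suc A.size) (suc B.size) (to x)
  ; dec = λ i → from (splitAt (suc A.size) i)
  ; dec-enc = λ x → trans (cong from (splitAt-join (suc A.size) (suc B.size) (to x))) (from-to x) }
  where
  module A = Enum EA
  module B = Enum EB
  to : A ⊎ B → Fin (suc A.size) ⊎ Fin (suc B.size)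
  to (inj₁ x) = inj₁ (A.enc x)
  to (inj₂ y) = inj₂ (B.enc y)
  from : Fin (suc A.size) ⊎ Fin (suc B.size) → A ⊎ B
  from (inj₁ x) = inj₁ (A.dec x)
  from (inj₂ y) = inj₂ (B.dec y)
  from-to : ∀ x → from (to x) ≡ x
  from-to (inj₁ x) = cong inj₁ (A.dec-enc x)
  from-to (inj₂ y) = cong inj₂ (B.dec-enc y)

retract-enum : ∀ {A B : Set} (f : A → B) (g : B → A) → (∀ x → g (f x) ≡ x) → Enum B → Enum A
retract-enum f g gf EB = record
  { size = B.size ; enc = λ x → B.enc (f x) ; dec = λ i → g (B.dec i)
  ; dec-enc = λ x → trans (cong g (B.dec-enc (f x))) (gf x) }
  where module B = Enum EB

Maybe-enum : ∀ {A} → Enum A → Enum (Maybe A)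
Maybe-enum {A} EA = retract-enum (maybe inj₁ (inj₂ tt)) back (λ { (just x) → refl ; nothing → refl }) (⊎-enum EA ⊤-enum)
  where
  back : A ⊎ ⊤ → Maybe A
  back (inj₁ x) = just x
  back (inj₂ _) = nothing

Bool-enum : Enum Bool
Bool-enum = retract-enum to from (λ { true → refl ; false → refl }) (⊎-enum ⊤-enum ⊤-enum)
  where
  to : Bool → ⊤ ⊎ ⊤
  to true  = inj₁ tt
  to false = inj₂ tt
  from : ⊤ ⊎ ⊤ → Bool
  from (inj₁ _) = true
  from (inj₂ _) = false

Vec-enum : ∀ {A} n → Enum A → Enum (Vec A n)
Vec-enum zero    EA = retract-enum (λ _ → tt) (λ _ → []) (λ { [] → refl }) ⊤-enum
Vec-enum (suc n) EA = retract-enum (λ { (x ∷ xs) → x , xs }) (λ (x , xs) → x ∷ xs) (λ { (x ∷ xs) → refl }) (×-enum EA (Vec-enum n EA))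

-- Small-step runs of while programs

-- In a loop, `nothing` is the test and `just` marks a position of the body.
Pos : Prog → Set
Pos (set _ _)   = ⊤
Pos (p ⨾ q)     = Pos p ⊎ Pos q
Pos (while _ p) = Maybe (Pos p)

Pos-enum : ∀ p → Enum (Pos p)
Pos-enum (set _ _)   = ⊤-enum
Pos-enum (p ⨾ q)     = ⊎-enum (Pos-enum p) (Pos-enum q)
Pos-enum (while _ p) = Maybe-enum (Pos-enum p)

start : ∀ p → Pos p
start (set _ _)   = tt
start (p ⨾ q)     = inj₁ (start p)
start (while _ _) = nothing

-- nothing is the exit position; the flags tell which registers are nonzero.
nxt : ∀ p → Pos p → (ℕ → Bool) → Maybe (Pos p)
nxt (set _ _)   _        z = nothing
nxt (p ⨾ q)     (inj₁ x) z = just (maybe inj₁ (inj₂ (start q)) (nxt p x z))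
nxt (p ⨾ q)     (inj₂ y) z = Maybe.map inj₂ (nxt q y z)
nxt (while r p) nothing  z = if z r then just (just (start p)) else nothing
-- The exit `nothing` of the body is at the same time the test position of the loop.
nxt (while r p) (just x) z = just (nxt p x z)

instr : ∀ p → Pos p → Maybe (ℕ × Expr ℕ)
instr (set r ex)  _        = just (r , ex)
instr (p ⨾ q)     (inj₁ x) = instr p x
instr (p ⨾ q)     (inj₂ y) = instr q y
instr (while r p) nothing  = nothing
instr (while r p) (just x) = instr p x

exec : Maybe (ℕ × Expr ℕ) → Store → Store
exec nothing         σ = σ
exec (just (r , ex)) σ = upd σ r (evalE σ ex)

nz : Store → ℕ → Bool
nz σ r = 0 <ᵇ σ r

data Run (p : Prog) : ℕ → Maybe (Pos p) → Store → Store → Set where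
  rdone : ∀ {σ} → Run p 0 nothing σ σ
  rstep : ∀ {n x σ τ} → Run p n (nxt p x (nz σ)) (exec (instr p x) σ) τ → Run p (suc n) (just x) σ τ

module _ {p q : Prog} where
  lift₁ : ∀ {n k m σ σ₁ τ} → Run p n m σ σ₁ → Run (p ⨾ q) k (just (inj₂ (start q))) σ₁ τ →
          Run (p ⨾ q) (n + k) (just (maybe inj₁ (inj₂ (start q)) m)) σ τ
  lift₁ rdone     s = s
  lift₁ (rstep r) s = rstep (lift₁ r s)

  lift₂ : ∀ {n m σ τ} → Run q n m σ τ → Run (p ⨾ q) n (Maybe.map inj₂ m) σ τ
  lift₂ rdone     = rdone
  lift₂ (rstep r) = rstep (lift₂ r)

  split₁ : ∀ {n} m {σ τ} → Run (p ⨾ q) n (just (maybe inj₁ (inj₂ (start q)) m)) σ τ →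
           ∃ λ a → ∃ λ k → ∃ λ σ₁ → Run p a m σ σ₁ × Run (p ⨾ q) k (just (inj₂ (start q))) σ₁ τ
  split₁ nothing  r         = _ , _ , _ , rdone , r
  split₁ (just x) (rstep r) = let a , k , σ₁ , r₁ , r₂ = split₁ (nxt p x _) r in suc a , k , σ₁ , rstep r₁ , r₂

  unlift₂ : ∀ {n} m {σ τ} → Run (p ⨾ q) n (Maybe.map inj₂ m) σ τ → Run q n m σ τ
  unlift₂ nothing  rdone     = rdone
  unlift₂ (just y) (rstep r) = rstep (unlift₂ (nxt q y _) r)

module _ {r₀ : ℕ} {p : Prog} where
  liftW : ∀ {n k m σ σ₁ τ} → Run p n m σ σ₁ → Run (while r₀ p) k (just nothing) σ₁ τ → Run (while r₀ p) (n + k) (just m) σ τ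
  liftW rdone     s = s
  liftW (rstep r) s = rstep (liftW r s)

  splitW : ∀ {n} m {σ τ} → Run (while r₀ p) n (just m) σ τ →
           ∃ λ a → ∃ λ k → ∃ λ σ₁ → Run p a m σ σ₁ × Run (while r₀ p) k (just nothing) σ₁ τ × k ≤ n
  splitW nothing  r         = _ , _ , _ , rdone , r , ≤-refl
  splitW (just x) (rstep r) = let a , k , σ₁ , r₁ , r₂ , le = splitW (nxt p x _) r in suc a , k , σ₁ , rstep r₁ , r₂ , m≤n⇒m≤1+n le

nz-true : ∀ {m} → m ≢ 0 → (0 <ᵇ m) ≡ true
nz-true {zero}  ne = contradiction refl ne
nz-true {suc _} ne = refl

big⇒run : ∀ {p σ τ} → p ⊢ σ ⇓ τ → ∃ λ n → Run p n (just (start p)) σ τ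
big⇒run b-set = 1 , rstep rdone
big⇒run (b-seq d e) = let _ , r = big⇒run d ; _ , s = big⇒run e in _ , lift₁ r (lift₂ s)
big⇒run {while r p} {σ} (b-end z) = 1 , rstep (subst (λ m → Run (while r p) 0 m σ σ)
  (sym (cong (λ v → if 0 <ᵇ v then just (just (start p)) else nothing) z)) rdone)
big⇒run {while r p} {σ} {τ} (b-loop ne d e) =
  let n , s = big⇒run d ; k , t = big⇒run e in
  suc (n + k) , rstep (subst (λ b → Run (while r p) (n + k) (if b then just (just (start p)) else nothing) σ τ) (sym (nz-true ne)) (liftW s t))

run⇒big : ∀ p {n σ τ} → Run p n (just (start p)) σ τ → p ⊢ σ ⇓ τ
run⇒big (set _ _) (rstep rdone) = b-set
run⇒big (p ⨾ q) r =
  let _ , _ , _ , s , t = split₁ (just (start p)) r in b-seq (run⇒big p s) (run⇒big q (unlift₂ (just (start q)) t))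
run⇒big (while r p) s = loop _ s ≤-refl
  where
  -- `f` bounds the length of the run: the remainder returned by `splitW` is not a subterm, it is
  -- only known to be no longer.
  loop : ∀ f {n σ τ} → Run (while r p) n (just nothing) σ τ → n ≤ f → while r p ⊢ σ ⇓ τ
  loop (suc f) {σ = σ} (rstep s) (s≤s le) with σ r in eq
  loop (suc f) (rstep rdone) (s≤s le) | zero = b-end eq
  ... | suc v = let _ , _ , _ , s₁ , s₂ , le′ = splitW (just (start p)) s in
    b-loop (λ z → 1+n≢0 (trans (sym eq) z)) (run⇒big p s₁) (loop f s₂ (≤-trans le′ le))

-- Counter machines

-- The shape is dictated by the tiles. `op` depends on the state alone, which every tile of a row
-- carries, so each tile can update its own bits; `δ` needs only zero tests, which are the bits on
-- the axis. `2 + K′` makes room for two inputs, and `absorb` makes the halted rows upward closed.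
record Machine : Set₁ where
  field
    Q      : Set
    Q-enum : Enum Q
    K′     : ℕ

  K : ℕ
  K = 2 + K′

  field
    δ      : Q → Vec Bool K → Q
    op     : Q → Fin K → Expr (Fin K)
    q₀     : Q
    halted : Q → Bool
    absorb : ∀ {q} → halted q ≡ true → ∀ z → halted (δ q z) ≡ true

  Conf : Set
  Conf = Q × (Fin K → ℕ)

  flags : (Fin K → ℕ) → Vec Bool K
  flags c = tabulate (λ k → 0 <ᵇ c k)

  step : Conf → Conf
  step (q , c) = δ q (flags c) , λ k → evalE c (op q k)

  conf : ℕ → Conf → Conf
  conf zero    s = s
  conf (suc n) s = step (conf n s)

  Halts : (Fin K → ℕ) → Set
  Halts ι = ∃ λ n → halted (proj₁ (conf n (q₀ , ι))) ≡ true

  conf-step : ∀ n s → conf n (step s) ≡ conf (suc n) s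
  conf-step zero    s = refl
  conf-step (suc n) s = cong step (conf-step n s)

  halted-later : ∀ {s m n} → m ≤ n → halted (proj₁ (conf m s)) ≡ true → halted (proj₁ (conf n s)) ≡ true
  halted-later {n = zero}  z≤n h = h
  halted-later {m = m} {n = suc n} le h with m ≟ suc n
  ... | yes refl = h
  ... | no ne    = absorb (halted-later (s≤s⁻¹ (≤∧≢⇒< le ne)) h) _

-- From while programs to counter machines

inputs : ∀ {k} → ℕ → ℕ → Fin (2 + k) → ℕ
inputs a b fz          = a
inputs a b (fs fz)     = b
inputs a b (fs (fs _)) = 0

mxE : Expr ℕ → ℕ
mxE zeroE     = 0
mxE (copyE r) = r
mxE (sucE r) = r
mxE (predE r) = r

mx : Prog → ℕ
mx (set r ex)  = r ⊔ mxE ex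
mx (p ⨾ q)     = mx p ⊔ mx q
mx (while r p) = r ⊔ mx p

clamp : ∀ n → ℕ → Fin (suc n)
clamp zero    _       = fz
clamp (suc n) zero    = fz
clamp (suc n) (suc r) = fs (clamp n r)

toℕ-clamp : ∀ {n r} → r ≤ n → toℕ (clamp n r) ≡ r
toℕ-clamp {zero}  z≤n = refl
toℕ-clamp {suc n} {zero}  _ = refl
toℕ-clamp {suc n} {suc r} (s≤s le) = cong suc (toℕ-clamp le)

mapE : {R S : Set} → (R → S) → Expr R → Expr S
mapE f zeroE     = zeroE
mapE f (copyE r) = copyE (f r)
mapE f (sucE r) = sucE (f r)
mapE f (predE r) = predE (f r)

module _ (p : Prog) where
  private
    N : ℕ
    N = suc (mx p)

  flagAt : Vec Bool (suc N) → ℕ → Bool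
  flagAt z r = lookup z (clamp N r)

  stepState : Maybe (Pos p) → Vec Bool (suc N) → Maybe (Pos p)
  stepState nothing  z = nothing
  stepState (just x) z = nxt p x (flagAt z)

  assign : Maybe (ℕ × Expr ℕ) → Fin (suc N) → Expr (Fin (suc N))
  assign nothing         k = copyE k
  assign (just (r , ex)) k with toℕ k ≟ r
  ... | yes _ = mapE (clamp N) ex
  ... | no _  = copyE k

  isNothing : Maybe (Pos p) → Bool
  isNothing nothing  = true
  isNothing (just _) = false

  opState : Maybe (Pos p) → Fin (suc N) → Expr (Fin (suc N))
  opState nothing  k = copyE k
  opState (just x) k = assign (instr p x) k

  machine : Machine
  machine = record
    { Q = Maybe (Pos p) ; Q-enum = Maybe-enum (Pos-enum p) ; K′ = mx p
    ; δ = stepState ; op = opState ; q₀ = just (start p) ; halted = isNothing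
    ; absorb = λ { {nothing} _ _ → refl } }

  open Machine machine using (conf; step; Halts; flags; conf-step; Conf)

  Sim : (Fin (suc N) → ℕ) → Store → Set
  Sim c σ = ∀ k → c k ≡ σ (toℕ k)

  sim-reg : ∀ {c σ r} → Sim c σ → r ≤ N → c (clamp N r) ≡ σ r
  sim-reg {σ = σ} s le = trans (s _) (cong σ (toℕ-clamp le))

  sim-expr : ∀ {c σ} ex → Sim c σ → mxE ex ≤ N → evalE c (mapE (clamp N) ex) ≡ evalE σ ex
  sim-expr zeroE     s le = refl
  sim-expr (copyE r) s le = sim-reg s le
  sim-expr (sucE r) s le = cong suc (sim-reg s le)
  sim-expr {σ = σ} (predE r) s le = cong pred (sim-reg {σ = σ} s le)

  mxI : Maybe (ℕ × Expr ℕ) → ℕ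
  mxI nothing         = 0
  mxI (just (_ , ex)) = mxE ex

  sim-assign : ∀ {c σ} i → Sim c σ → mxI i ≤ N → Sim (λ k → evalE c (assign i k)) (exec i σ)
  sim-assign nothing s le k = s k
  sim-assign {σ = σ} (just (r , ex)) s le k with toℕ k ≟ r
  ... | yes refl = trans (sim-expr ex s le) (sym (upd-same σ r _))
  ... | no ne    = trans (s k) (sym (upd-other σ _ ne))

mxI-instr : ∀ p (P : Prog) x → mxI P (instr p x) ≤ mx p
mxI-instr (set r ex)  P x        = m≤n⊔m r (mxE ex)
mxI-instr (p ⨾ q)     P (inj₁ x) = ≤-trans (mxI-instr p P x) (m≤m⊔n (mx p) (mx q))
mxI-instr (p ⨾ q)     P (inj₂ y) = ≤-trans (mxI-instr q P y) (m≤n⊔m (mx p) (mx q))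
mxI-instr (while r p) P nothing  = z≤n
mxI-instr (while r p) P (just x) = ≤-trans (mxI-instr p P x) (m≤n⊔m r (mx p))

nxt-cong : ∀ p x {z z′} → (∀ r → r ≤ mx p → z r ≡ z′ r) → nxt p x z ≡ nxt p x z′
nxt-cong (set _ _)   x        h = refl
nxt-cong (p ⨾ q)     (inj₁ x) h = cong (λ m → just (maybe inj₁ (inj₂ (start q)) m)) (nxt-cong p x (λ r le → h r (≤-trans le (m≤m⊔n (mx p) (mx q)))))
nxt-cong (p ⨾ q)     (inj₂ y) h = cong (Maybe.map inj₂) (nxt-cong q y (λ r le → h r (≤-trans le (m≤n⊔m (mx p) (mx q)))))
nxt-cong (while r p) nothing  h = cong (λ b → if b then just (just (start p)) else nothing) (h r (m≤m⊔n r (mx p)))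
nxt-cong (while r p) (just x) h = cong just (nxt-cong p x (λ r′ le → h r′ (≤-trans le (m≤n⊔m r (mx p)))))

module _ (p : Prog) where
  open Machine (machine p) using (conf; step; Halts; flags; conf-step; halted)

  sim-nxt : ∀ {c σ} x → Sim p c σ → stepState p (just x) (flags c) ≡ nxt p x (nz σ)
  sim-nxt {c} {σ} x s = nxt-cong p x (λ r le →
    trans (lookup∘tabulate (λ k → 0 <ᵇ c k) (clamp (suc (mx p)) r)) (cong (0 <ᵇ_) (sim-reg p {c} {σ} s (m≤n⇒m≤1+n le))))

  sim-exec : ∀ {c σ} x → Sim p c σ → Sim p (proj₂ (step (just x , c))) (exec (instr p x) σ)
  sim-exec x s = sim-assign p (instr p x) s (m≤n⇒m≤1+n (mxI-instr p p x))

  run⇒halted : ∀ {n m σ τ c} → Run p n m σ τ → Sim p c σ → halted (proj₁ (conf n (m , c))) ≡ true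
  run⇒halted rdone s = refl
  run⇒halted {suc n} {just x} {σ = σ} {c = c} (rstep r) s =
    trans (cong (λ t → halted (proj₁ t)) (sym (conf-step n (just x , c))))
      (trans (cong (λ q → halted (proj₁ (conf n (q , proj₂ (step (just x , c)))))) (sim-nxt {c} {σ} x s)) (run⇒halted r (sim-exec {c} {σ} x s)))

  halted⇒run : ∀ n {m σ c} → Sim p c σ → halted (proj₁ (conf n (m , c))) ≡ true → ∃ λ k → ∃ λ τ → Run p k m σ τ
  halted⇒run n       {nothing} s h = _ , _ , rdone
  halted⇒run (suc n) {just x} {σ} {c} s h =
    let k , τ , r = halted⇒run n (sim-exec {c} {σ} x s)
          (trans (cong (λ q → halted (proj₁ (conf n (q , proj₂ (step (just x , c)))))) (sym (sim-nxt {c} {σ} x s)))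
            (trans (cong (λ t → halted (proj₁ t)) (conf-step n (just x , c))) h))
    in suc k , τ , rstep r

opaque
  machineOf : PR 2 → Machine
  machineOf g = machine (compile g (0 ∷ 1 ∷ []) 2)

inputStore : ℕ → ℕ → Store
inputStore a b zero          = a
inputStore a b (suc zero)    = b
inputStore a b (suc (suc _)) = 0

sim-inputs : ∀ p a b → Sim p (inputs a b) (inputStore a b)
sim-inputs p a b fz          = refl
sim-inputs p a b (fs fz)     = refl
sim-inputs p a b (fs (fs _)) = refl

opaque
  unfolding machineOf

  eval⇒halts : ∀ g a b {v} → g ⟨ a ∷ b ∷ [] ⟩⇓ v → Machine.Halts (machineOf g) (inputs a b)
  eval⇒halts g a b d =
    let p = compile g (0 ∷ 1 ∷ []) 2
        _ , big , _ = forward g {0 ∷ 1 ∷ []} {2} {inputStore a b} (s≤s z≤n ∷ ≤-refl ∷ []) d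
        n , r = big⇒run big
    in n , run⇒halted p r (sim-inputs p a b)

  halts⇒eval : ∀ g a b → Machine.Halts (machineOf g) (inputs a b) → ∃ λ v → g ⟨ a ∷ b ∷ [] ⟩⇓ v
  halts⇒eval g a b (n , h) =
    let p = compile g (0 ∷ 1 ∷ []) 2
        _ , _ , r = halted⇒run p n (sim-inputs p a b) h
        v , d , _ = backward g {0 ∷ 1 ∷ []} {2} {inputStore a b} (s≤s z≤n ∷ ≤-refl ∷ []) (run⇒big p r)
    in v , d

-- Codes of automata

tri : ℕ → ℕ
tri zero    = 0
tri (suc w) = suc w + tri w

tri-≥ : ∀ w → w ≤ tri w
tri-≥ zero    = z≤n
tri-≥ (suc w) = m≤m+n (suc w) (tri w)

-- Opaque because the codes of neighbourhoods are astronomically large numerals.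
opaque
  pair : ℕ → ℕ → ℕ
  pair x y = tri (x + y) + x

  pair-suc : ∀ x y → pair (suc x) y ≡ suc (pair x (suc y))
  pair-suc x y rewrite +-suc x y = +-suc (tri (suc (x + y))) x

  pair-zero : ∀ y → pair 0 (suc y) ≡ suc (pair y 0)
  pair-zero y rewrite +-identityʳ y | +-identityʳ (y + tri y) = cong suc (+-comm y (tri y))

  unpair-sucʳ : ∀ m {x y} → unpair m ≡ (x , suc y) → unpair (suc m) ≡ (suc x , y)
  unpair-sucʳ m eq with unpair m
  unpair-sucʳ m refl | _ , suc _ = refl

  unpair-sucˡ : ∀ m {x} → unpair m ≡ (x , 0) → unpair (suc m) ≡ (0 , suc x)
  unpair-sucˡ m eq with unpair m
  unpair-sucˡ m refl | _ , zero = refl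

  -- Within a diagonal `x` grows by one per step, and `(0 , suc y)` follows `(y , 0)`: induction on
  -- the diagonal, then on `x`.
  unpair-pair : ∀ x y → unpair (pair x y) ≡ (x , y)
  unpair-pair x y = diag (x + y) x y refl
    where
    diag : ∀ s x y → x + y ≡ s → unpair (pair x y) ≡ (x , y)
    diag s       (suc x) y       eq = trans (cong unpair (pair-suc x y)) (unpair-sucʳ (pair x (suc y)) (diag s x (suc y) (trans (+-suc x y) eq)))
    diag zero    zero    zero    eq = refl
    diag (suc s) zero    (suc y) eq = trans (cong unpair (pair-zero y)) (unpair-sucˡ (pair y 0) (diag s y 0 (trans (+-identityʳ y) (suc-injective eq))))

  fst-pair : ∀ x y → proj₁ (unpair (pair x y)) ≡ x
  fst-pair x y = cong proj₁ (unpair-pair x y)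

  snd-pair : ∀ x y → proj₂ (unpair (pair x y)) ≡ y
  snd-pair x y = cong proj₂ (unpair-pair x y)

  pair-≥ : ∀ x y → y ≤ pair x y
  pair-≥ x y = ≤-trans (m≤n+m y x) (≤-trans (tri-≥ (x + y)) (m≤m+n _ x))

encList : List ℕ → ℕ
encList []       = 0
encList (x ∷ xs) = suc (pair x (encList xs))

decodeListF-enc : ∀ xs f → encList xs ≤ f → decodeListF f (encList xs) ≡ xs
decodeListF-enc []       zero    _ = refl
decodeListF-enc []       (suc f) _ = refl
decodeListF-enc (x ∷ xs) (suc f) (s≤s le) rewrite unpair-pair x (encList xs) =
  cong (x ∷_) (decodeListF-enc xs f (≤-trans (pair-≥ x (encList xs)) le))

decodeList-enc : ∀ xs → decodeList (encList xs) ≡ xs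
decodeList-enc xs = decodeListF-enc xs (encList xs) ≤-refl

encℤ : ℤ → ℕ
encℤ (+ n)    = n * 2
encℤ -[1+ n ] = 1 + n * 2

half : ∀ n → (1 + n * 2) / 2 ≡ n
half n = trans (+-distrib-/-∣ʳ 1 {n * 2} (divides n refl)) (m*n/n≡m n 2)

decodeℤ-even : ∀ m → m % 2 ≡ 0 → decodeℤ m ≡ + (m / 2)
decodeℤ-even m eq with m % 2
decodeℤ-even m refl | zero = refl

decodeℤ-odd : ∀ m → m % 2 ≡ 1 → decodeℤ m ≡ -[1+ m / 2 ]
decodeℤ-odd m eq with m % 2
decodeℤ-odd m refl | suc _ = refl

decodeℤ-enc : ∀ z → decodeℤ (encℤ z) ≡ z
decodeℤ-enc (+ n)    = trans (decodeℤ-even (n * 2) (m*n%n≡0 n 2)) (cong +_ (m*n/n≡m n 2))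
decodeℤ-enc -[1+ n ] = trans (decodeℤ-odd (1 + n * 2) ([m+kn]%n≡m%n 1 n 2)) (cong -[1+_] (half n))

cellOf : ∀ d → ℤ × ℤ → Cell (2 + d)
cellOf d (x , y) = x ∷ y ∷ Vec.replicate d (+ 0)

cellCode : ℤ × ℤ → ℕ
cellCode (x , y) = encList (encℤ x ∷ encℤ y ∷ [])

decodeCell-[] : ∀ d → decodeCell d [] ≡ Vec.replicate d (+ 0)
decodeCell-[] zero    = refl
decodeCell-[] (suc d) = cong (+ 0 ∷_) (decodeCell-[] d)

decodeCell-code : ∀ d o → decodeCell (2 + d) (decodeList (cellCode o)) ≡ cellOf d o
decodeCell-code d (x , y) = trans (cong (decodeCell (2 + d)) (decodeList-enc (encℤ x ∷ encℤ y ∷ [])))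
  (cong₂ _∷_ (decodeℤ-enc x) (cong₂ _∷_ (decodeℤ-enc y) (decodeCell-[] d)))

module _ (a : ℕ) where
  unrank : ℕ → ℕ → List (Fin (suc a))
  unrank zero    r = []
  unrank (suc m) r = (r mod suc a) ∷ unrank m (r / suc a)

  mod-digit : ∀ (t : Fin (suc a)) R → (toℕ t + suc a * R) mod suc a ≡ t
  mod-digit t R = toℕ-injective (begin
    toℕ ((toℕ t + suc a * R) mod suc a) ≡⟨ toℕ-fromℕ< _ ⟩
    (toℕ t + suc a * R) % suc a         ≡⟨ cong (λ z → (toℕ t + z) % suc a) (*-comm (suc a) R) ⟩
    (toℕ t + R * suc a) % suc a         ≡⟨ [m+kn]%n≡m%n (toℕ t) R (suc a) ⟩
    toℕ t % suc a                       ≡⟨ m<n⇒m%n≡m (toℕ<n t) ⟩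
    toℕ t                               ∎)
    where open ≡-Reasoning

  div-digit : ∀ (t : Fin (suc a)) R → (toℕ t + suc a * R) / suc a ≡ R
  div-digit t R = begin
    (toℕ t + suc a * R) / suc a         ≡⟨ cong (λ z → (toℕ t + z) / suc a) (*-comm (suc a) R) ⟩
    (toℕ t + R * suc a) / suc a         ≡⟨ +-distrib-/-∣ʳ (toℕ t) (divides R refl) ⟩
    toℕ t / suc a + R * suc a / suc a   ≡⟨ cong₂ _+_ (m<n⇒m/n≡0 (toℕ<n t)) (m*n/n≡m R (suc a)) ⟩
    R                                   ∎
    where open ≡-Reasoning

  unrank-rank : ∀ {m} (p : Fin m → Fin (suc a)) → unrank m (rank (suc a) p) ≡ List.tabulate p
  unrank-rank {zero}  p = refl
  unrank-rank {suc m} p = cong₂ _∷_ (mod-digit (p fz) _)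
    (trans (cong (unrank m) (div-digit (p fz) _)) (unrank-rank (p ∘ fs)))

  rank-< : ∀ {m} (p : Fin m → Fin (suc a)) → rank (suc a) p < suc a ^ m
  rank-< {zero}  p = s≤s z≤n
  rank-< {suc m} p = begin-strict
    toℕ (p fz) + suc a * R      <⟨ +-monoˡ-< _ (toℕ<n (p fz)) ⟩
    suc a + suc a * R           ≡⟨ *-suc (suc a) R ⟨
    suc a * suc R               ≤⟨ *-monoʳ-≤ (suc a) (rank-< (p ∘ fs)) ⟩
    suc a * suc a ^ m           ∎
    where open ≤-Reasoning
          R = rank (suc a) (p ∘ fs)

  nth-applyUpTo : ∀ (g : ℕ → ℕ) {N r} → r < N → nth (List.applyUpTo g N) r ≡ g r
  nth-applyUpTo g {suc N} {zero}  _        = refl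
  nth-applyUpTo g {suc N} {suc r} (s≤s lt) = nth-applyUpTo (g ∘ suc) lt

  opaque
    tableOf : (List (Fin (suc a)) → Fin (suc a)) → ℕ → List ℕ
    tableOf f m = List.applyUpTo (λ r → toℕ (f (unrank m r))) (suc a ^ m)

    -- A map on lists of symbols is tabulated in the order of `rank`; the reduction modulo the
    -- alphabet size in `localRule` does nothing, as the entries are symbols already.
    global-table : ∀ {d} (L : List (Cell d)) f x m →
      global (mkCA a L (tableOf f (List.length L))) x m ≡ f (List.map (λ u → x (m ⊕ u)) L)
    global-table L f x m = begin
      fromℕ< (m%n<n (nth (tableOf f (List.length L)) (rank (suc a) p)) (suc a))
        ≡⟨ fromℕ<-cong _ _ (trans (cong (_% suc a) entry) (m<n⇒m%n≡m (toℕ<n v))) _ (toℕ<n v) ⟩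
      fromℕ< (toℕ<n v)
        ≡⟨ fromℕ<-toℕ v (toℕ<n v) ⟩
      v
        ≡⟨ cong f (trans (unrank-rank p) (trans (sym (map-tabulate (List.lookup L) (λ u → x (m ⊕ u))))
                                                      (cong (List.map _) (tabulate-lookup L)))) ⟩
      f (List.map (λ u → x (m ⊕ u)) L) ∎
      where
      open ≡-Reasoning
      p : Fin (List.length L) → Fin (suc a)
      p j = x (m ⊕ List.lookup L j)
      v : Fin (suc a)
      v = f (unrank (List.length L) (rank (suc a) p))
      entry : nth (tableOf f (List.length L)) (rank (suc a) p) ≡ toℕ v
      entry = nth-applyUpTo _ (rank-< p)

-- Coordinates from -1 to 2, because a bit consults the 3 × 3 blocks centred at its own cell and at
-- the northern and eastern neighbours.
offsets₁₆ : List (ℤ × ℤ)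
offsets₁₆ = List.cartesianProduct line line
  where
  line : List ℤ
  line = -[1+ 0 ] ∷ + 0 ∷ + 1 ∷ + 2 ∷ []

offsets : ℕ → ℕ → List (ℤ × ℤ)
offsets k l = (+ k , + 0) ∷ (+ l , + 0) ∷ offsets₁₆

module _ (a : ℕ) (f : List (Fin (suc a)) → Fin (suc a)) where
  tableCode : ℕ
  -- Two movable offsets and sixteen fixed ones; their number, not their values, enters the table.
  tableCode = encList (tableOf a f 18)

  caCode : List (ℤ × ℤ) → ℕ
  caCode os = pair a (pair (encList (List.map cellCode os)) tableCode)

  decode-caCode : ∀ d os → decodeCA (2 + d) (caCode os) ≡ mkCA a (List.map (cellOf d) os) (tableOf a f 18)
  decode-caCode d os = cong₂ (λ x (y , z) → mkCA x y z) (fst-pair a rest) (cong₂ _,_ nb tb)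
    where
    L : List ℕ
    L = List.map cellCode os
    rest : ℕ
    rest = pair (encList L) tableCode
    nb : List.map (λ i → decodeCell (2 + d) (decodeList i)) (decodeList (proj₁ (unpair (proj₂ (unpair (pair a rest)))))) ≡ List.map (cellOf d) os
    nb = begin
      List.map dc (decodeList (proj₁ (unpair (proj₂ (unpair (pair a rest)))))) ≡⟨ cong (λ z → List.map dc (decodeList (proj₁ (unpair z)))) (snd-pair a rest) ⟩
      List.map dc (decodeList (proj₁ (unpair rest)))                          ≡⟨ cong (λ z → List.map dc (decodeList z)) (fst-pair (encList L) tableCode) ⟩
      List.map dc (decodeList (encList L))                                    ≡⟨ cong (List.map dc) (decodeList-enc L) ⟩
      List.map dc (List.map cellCode os)                           ≡⟨ map-∘ {g = dc} {f = cellCode} os ⟨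
      List.map (dc ∘ cellCode) os                                  ≡⟨ map-cong (decodeCell-code d) os ⟩
      List.map (cellOf d) os ∎
      where
      open ≡-Reasoning
      dc : ℕ → Cell (2 + d)
      dc i = decodeCell (2 + d) (decodeList i)
    tb : decodeList (proj₂ (unpair (proj₂ (unpair (pair a rest))))) ≡ tableOf a f 18
    tb = begin
      decodeList (proj₂ (unpair (proj₂ (unpair (pair a rest))))) ≡⟨ cong (λ z → decodeList (proj₂ (unpair z))) (snd-pair a rest) ⟩
      decodeList (proj₂ (unpair rest))                          ≡⟨ cong decodeList (snd-pair (encList L) tableCode) ⟩
      decodeList tableCode                                      ≡⟨ decodeList-enc (tableOf a f 18) ⟩
      tableOf a f 18 ∎
      where open ≡-Reasoning

-- Computing the code of the automaton

constP : ∀ {n} → ℕ → PR n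
constP zero    = zeroF
constP (suc c) = compF succF (constP c ∷ [])

const-ev : ∀ {n} c {xs : Vec ℕ n} → constP c ⟨ xs ⟩⇓ c
const-ev zero    = ev-zero
const-ev (suc c) = ev-comp (ev-∷ (const-ev c) ev-[]) ev-succ

_$₁_ : ∀ {n} → PR 1 → PR n → PR n
f $₁ g = compF f (g ∷ [])

_$₂_,_ : ∀ {n} → PR 2 → PR n → PR n → PR n
f $₂ g , h = compF f (g ∷ h ∷ [])

ev₁ : ∀ {n} {f : PR 1} {g : PR n} {xs x v} → g ⟨ xs ⟩⇓ x → f ⟨ x ∷ [] ⟩⇓ v → (f $₁ g) ⟨ xs ⟩⇓ v
ev₁ d = ev-comp (ev-∷ d ev-[])

ev₂ : ∀ {n} {f : PR 2} {g h : PR n} {xs x y v} → g ⟨ xs ⟩⇓ x → h ⟨ xs ⟩⇓ y → f ⟨ x ∷ y ∷ [] ⟩⇓ v → (f $₂ g , h) ⟨ xs ⟩⇓ v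
ev₂ d e = ev-comp (ev-∷ d (ev-∷ e ev-[]))

addP : PR 2
addP = precF (projF fz) (succF $₁ projF (fs fz))

add-ev : ∀ x y → addP ⟨ x ∷ y ∷ [] ⟩⇓ (x + y)
add-ev zero    y = ev-prec0 ev-proj
add-ev (suc x) y = ev-precS (add-ev x y) (ev₁ ev-proj ev-succ)

triP : PR 1
triP = precF zeroF (addP $₂ (succF $₁ projF fz) , projF (fs fz))

tri-ev : ∀ w → triP ⟨ w ∷ [] ⟩⇓ tri w
tri-ev zero    = ev-prec0 ev-zero
tri-ev (suc w) = ev-precS (tri-ev w) (ev₂ (ev₁ ev-proj ev-succ) ev-proj (add-ev (suc w) (tri w)))

pairP : PR 2
pairP = addP $₂ (triP $₁ (addP $₂ projF fz , projF (fs fz))) , projF fz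

opaque
  unfolding pair

  pair-ev : ∀ x y → pairP ⟨ x ∷ y ∷ [] ⟩⇓ pair x y
  pair-ev x y = ev₂ (ev₁ (ev₂ ev-proj ev-proj (add-ev x y)) (tri-ev (x + y))) ev-proj (add-ev (tri (x + y)) x)

-- The offset `(k , 0)` is coded by the list of `k + k` and 0, because nonnegative integers have
-- even codes.
cellP : PR 1
cellP = succF $₁ (pairP $₂ (addP $₂ projF fz , projF fz) , constP (encList (0 ∷ [])))

cell-ev : ∀ k → cellP ⟨ k ∷ [] ⟩⇓ cellCode (+ k , + 0)
cell-ev k = ev₁ (ev₂ (ev₂ ev-proj ev-proj (subst (λ z → addP ⟨ k ∷ k ∷ [] ⟩⇓ z) (sym (dbl k)) (add-ev k k))) (const-ev (encList (0 ∷ []))) (pair-ev (k * 2) (encList (0 ∷ [])))) ev-succ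
  where
  dbl : ∀ k → k * 2 ≡ k + k
  dbl k = trans (*-comm k 2) (cong (λ z → k + z) (+-identityʳ k))

-- The two variable offsets of the automaton are its own alphabet size and table code, so its code is
-- a recursive function of them.
opaque
  codeP : PR 2
  codeP = pairP $₂ projF fz , (pairP $₂ (cons (projF fz) (cons (projF (fs fz)) (constP (encList (List.map cellCode offsets₁₆))))) , projF (fs fz))
    where
    cons : PR 2 → PR 2 → PR 2
    cons g h = succF $₁ (pairP $₂ (cellP $₁ g) , h)

  code-ev : ∀ a f → codeP ⟨ a ∷ tableCode a f ∷ [] ⟩⇓ caCode a f (offsets a (tableCode a f))
  code-ev a f = ev₂ ev-proj (ev₂
      (ev₁ (ev₂ (ev₁ ev-proj (cell-ev a)) (ev₁ (ev₂ (ev₁ ev-proj (cell-ev t)) (const-ev c) (pair-ev (cellCode (+ t , + 0)) c)) ev-succ)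
         (pair-ev (cellCode (+ a , + 0)) _)) ev-succ)
      ev-proj (pair-ev _ t)) (pair-ev a _)
    where
    t c : ℕ
    t = tableCode a f
    c = encList (List.map cellCode offsets₁₆)

-- Tiles and structures

-- Signs of the coordinates of a cell relative to the centre of the structure it belongs to.
data Sg : Set where
  neg nul pos : Sg

Sg-enum : Enum Sg
Sg-enum = retract-enum to from (λ { neg → refl ; nul → refl ; pos → refl }) (Maybe-enum Bool-enum)
  where
  to : Sg → Maybe Bool
  to neg = just false
  to nul = nothing
  to pos = just true
  from : Maybe Bool → Sg
  from (just false) = neg
  from nothing      = nul
  from (just true)  = pos

_≟ˢ_ : (a b : Sg) → Dec (a ≡ b)
_≟ˢ_ = Enum._≟ᴱ_ Sg-enum

pos≢neg : pos ≢ neg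
pos≢neg ()

neg≢pos : neg ≢ pos
neg≢pos ()

nul≢neg : nul ≢ neg
nul≢neg ()

nul≢pos : nul ≢ pos
nul≢pos ()

true≢false : true ≢ false
true≢false ()

-- The signs that two consecutive integers can have.
data Link : Sg → Sg → Set where
  neg-neg : Link neg neg
  neg-nul : Link neg nul
  nul-pos : Link nul pos
  pos-pos : Link pos pos

link? : ∀ a b → Dec (Link a b)
link? neg neg = yes neg-neg
link? neg nul = yes neg-nul
link? neg pos = no λ ()
link? nul neg = no λ ()
link? nul nul = no λ ()
link? nul pos = yes nul-pos
link? pos neg = no λ ()
link? pos nul = no λ ()
link? pos pos = yes pos-pos

any-elim : ∀ {A : Set} {P : A → Set} {m : Maybe A} → Any P m → ∃ λ x → m ≡ just x × P x
any-elim (some p) = _ , refl , p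

any-intro : ∀ {A : Set} {P : A → Set} {m : Maybe A} {x} → m ≡ just x → P x → Any P m
any-intro refl p = some p

same : ∀ {A : Set} {m : Maybe A} {x y} → m ≡ just x → m ≡ just y → x ≡ y
same p q = just-injective (trans (sym p) q)

module Tiles (M : Machine) where
  open Machine M

  record Tile : Set where
    constructor tile
    field
      sx sy : Sg
      st    : Q
      bits  : Vec Bool K

  open Tile public

  Tile-enum : Enum Tile
  Tile-enum = retract-enum (λ t → (sx t , sy t) , st t , bits t) (λ ((a , b) , q , v) → tile a b q v) (λ _ → refl)
    (×-enum (×-enum Sg-enum Sg-enum) (×-enum Q-enum (Vec-enum K Bool-enum)))

  -- a is immediately to the left of b, respectively immediately below b, in a common structure
  HL VL : Tile → Tile → Set
  HL a b = Link (sx a) (sx b) × sy a ≡ sy b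
  VL a b = Link (sy a) (sy b) × sx a ≡ sx b

  hl? : ∀ a b → Dec (HL a b)
  hl? a b = link? (sx a) (sx b) ×-dec (sy a ≟ˢ sy b)

  vl? : ∀ a b → Dec (VL a b)
  vl? a b = link? (sy a) (sy b) ×-dec (sx a ≟ˢ sx b)

  Centre : Tile → Set
  Centre t = sx t ≡ nul × sy t ≡ nul

  -- Counters are stored in unary in the rows of the quadrant sx ≤ 0, sy ≥ 0: at distance n from the axis
  -- the bit of a counter tells whether n is smaller than its value.  I, U and O are the bits at
  -- distances n - 1, n and n + 1 in the previous row.
  newBit : Expr (Fin K) → (I U O : Vec Bool K) → Bool
  newBit zeroE     I U O = false
  newBit (copyE k) I U O = lookup U k
  newBit (sucE k)  I U O = lookup I k
  newBit (predE k) I U O = lookup O k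

  newBits : (Fin K → Expr (Fin K)) → (I U O : Vec Bool K) → Vec Bool K
  newBits o I U O = tabulate (λ k → newBit (o k) I U O)

  -- On the axis a fictitious column with all bits true replaces the inner neighbour, as every
  -- counter value exceeds the distance -1. Incrementing then yields the correct bit at distance 0.
  inner : Sg → Maybe Tile → Maybe (Vec Bool K)
  inner nul _ = just (replicate K true)
  inner neg m = Maybe.map bits m
  inner pos _ = nothing

  module Checks (t : Tile) (sw s se w e n : Maybe Tile) (off : Fin K → Maybe Tile) where
    OkX : Sg → Set
    OkX pos = Any (λ u → HL u t × st u ≡ st t) w
    OkX neg = Any (λ u → HL t u × st u ≡ st t) e
    OkX nul = ⊤

    OkY : Sg → Set
    OkY pos = Any (λ u → VL u t) s
    OkY neg = Any (λ u → VL t u) n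
    OkY nul = ⊤

    -- The bits of the bottom row are pinned down by the offset cell, which must be the centre exactly
    -- where the bit changes; an arm with bit true must go on, so that it cannot be cut.
    Row₀ : Vec Bool K → Set
    Row₀ I = ∀ k → (lookup (bits t) k ≡ true → lookup I k ≡ true × Any (λ v → HL v t) w)
                 × (lookup (bits t) k ≡ false → lookup I k ≡ true → Any Centre (off k))

    -- `u` lies at the same distance in the previous row and `v` one step farther out. Going down
    -- one row pays for going out one column, so the check never leaves the diamond of the tile.
    -- Only axis tiles compute the state; the others copy it sideways by `OkX`.
    Above : Tile → Set
    Above u = Any (λ v → HL v u × Any (λ I → bits t ≡ newBits (op (st u)) I (bits u) (bits v)) (inner (sx t) se)) sw
            × (sx t ≡ nul → st t ≡ δ (st u) (bits u))

    OkC′ : Sg → Set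
    OkC′ neg = ⊤
    OkC′ nul = Any Row₀ (inner (sx t) e) × (sx t ≡ nul → st t ≡ q₀)
    OkC′ pos = Any Above s

    OkC : Sg → Set
    OkC pos = ⊤
    OkC nul = OkC′ (sy t)
    OkC neg = OkC′ (sy t)

    Ok : Set
    Ok = OkX (sx t) × OkY (sy t) × OkC (sx t)

    _≟ᵠ_ : (p q : Q) → Dec (p ≡ q)
    _≟ᵠ_ = Enum._≟ᴱ_ Q-enum

    _≟ᵛ_ : (p q : Vec Bool K) → Dec (p ≡ q)
    _≟ᵛ_ = Enum._≟ᴱ_ (Vec-enum K Bool-enum)

    okX? : ∀ a → Dec (OkX a)
    okX? pos = Any.dec (λ u → hl? u t ×-dec (st u ≟ᵠ st t)) w
    okX? neg = Any.dec (λ u → hl? t u ×-dec (st u ≟ᵠ st t)) e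
    okX? nul = yes tt

    okY? : ∀ a → Dec (OkY a)
    okY? pos = Any.dec (λ u → vl? u t) s
    okY? neg = Any.dec (λ u → vl? t u) n
    okY? nul = yes tt

    row₀? : ∀ I → Dec (Row₀ I)
    row₀? I = all? λ k →
      ((lookup (bits t) k Bool.≟ true) →-dec ((lookup I k Bool.≟ true) ×-dec Any.dec (λ v → hl? v t) w))
      ×-dec ((lookup (bits t) k Bool.≟ false) →-dec ((lookup I k Bool.≟ true) →-dec Any.dec (λ u → (sx u ≟ˢ nul) ×-dec (sy u ≟ˢ nul)) (off k)))

    above? : ∀ u → Dec (Above u)
    above? u = Any.dec (λ v → hl? v u ×-dec Any.dec (λ I → bits t ≟ᵛ newBits (op (st u)) I (bits u) (bits v)) (inner (sx t) se)) sw
               ×-dec ((sx t ≟ˢ nul) →-dec (st t ≟ᵠ δ (st u) (bits u)))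

    okC′? : ∀ a → Dec (OkC′ a)
    okC′? neg = yes tt
    okC′? nul = Any.dec row₀? (inner (sx t) e) ×-dec ((sx t ≟ˢ nul) →-dec (st t ≟ᵠ q₀))
    okC′? pos = Any.dec above? s

    okC? : ∀ a → Dec (OkC a)
    okC? pos = yes tt
    okC? nul = okC′? (sy t)
    okC? neg = okC′? (sy t)

    ok? : Dec Ok
    ok? = okX? (sx t) ×-dec (okY? (sy t) ×-dec okC? (sx t))

  Grid : Set
  Grid = ℕ → ℕ → Maybe Tile

  -- The other counters start at 0: with the tile itself as offset cell, their arm must end at the
  -- centre, without a separate rule.
  offs : (k l self : Maybe Tile) → Fin K → Maybe Tile
  offs k l self fz          = k
  offs k l self (fs fz)     = l
  offs k l self (fs (fs _)) = self

  -- The check of the cell (1 + i , 1 + j), so that all neighbours are reached by successors.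
  module CheckAt (κ₁ κ₂ : ℕ) (A : Grid) (i j : ℕ) (t : Tile) =
    Checks t (A i j) (A (1 + i) j) (A (2 + i) j) (A i (1 + j)) (A (2 + i) (1 + j)) (A (1 + i) (2 + j))
           (offs (A (κ₁ + suc i) (1 + j)) (A (κ₂ + suc i) (1 + j)) (just t))

  offs-at : ∀ κ₁ κ₂ (A : Grid) i j {t} → A i j ≡ just t → ∀ k →
            offs (A (κ₁ + i) j) (A (κ₂ + i) j) (just t) k ≡ A (inputs κ₁ κ₂ k + i) j
  offs-at κ₁ κ₂ A i j p fz          = refl
  offs-at κ₁ κ₂ A i j p (fs fz)     = refl
  offs-at κ₁ κ₂ A i j p (fs (fs _)) = sym p

  row : ℕ → (Fin K → ℕ) → Vec Bool K
  row n c = tabulate (λ k → n <ᵇ c k)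

  innerRow : ℕ → (Fin K → ℕ) → Vec Bool K
  innerRow zero    c = replicate K true
  innerRow (suc n) c = row n c

  newBits-row : ∀ q n c → newBits (op q) (innerRow n c) (row n c) (row (suc n) c) ≡ row n (λ k → evalE c (op q k))
  newBits-row q n c = tabulate-cong (λ k → bit (op q k) n)
    where
    bit : ∀ ex n → newBit ex (innerRow n c) (row n c) (row (suc n) c) ≡ (n <ᵇ evalE c ex)
    bit zeroE     n = refl
    bit (copyE k) n = lookup∘tabulate (λ k → n <ᵇ c k) k
    bit (sucE k)  zero    = lookup-replicate k true
    bit (sucE k)  (suc n) = lookup∘tabulate (λ k → n <ᵇ c k) k
    bit (predE k) n = trans (lookup∘tabulate (λ k → suc n <ᵇ c k) k) (shift< (c k))
      where
      shift< : ∀ c → (suc n <ᵇ c) ≡ (n <ᵇ pred c)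
      shift< zero    = refl
      shift< (suc c) = refl

  -- What survives in a finite grid

  -- A finite grid that loses no more tiles. As column 0 and row 0 are empty, every tile has the
  -- predecessor indices that its check reads.
  record Stable (κ₁ κ₂ : ℕ) (A : Grid) (w : ℕ) : Set where
    field
      west  : ∀ j → A 0 j ≡ nothing
      south : ∀ i → A i 0 ≡ nothing
      east  : ∀ i j → w < i → A i j ≡ nothing
      north : ∀ i j → w < j → A i j ≡ nothing
      ok    : ∀ {i j t} → A (suc i) (suc j) ≡ just t → CheckAt.Ok κ₁ κ₂ A i j t

  module Structure {κ₁ κ₂ : ℕ} {A : Grid} {w : ℕ} (S : Stable κ₁ κ₂ A w) where
    open Stable S
    open ≡-Reasoning

    ι : Fin K → ℕ
    ι = inputs κ₁ κ₂

    dead : ∀ {i j t} {X : Set} → A i j ≡ nothing → A i j ≡ just t → X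
    dead p q with () ← trans (sym p) q

    east-nbr : ∀ {i j t} → A i j ≡ just t → sx t ≡ neg → ∃ λ u → A (suc i) j ≡ just u × HL t u × st u ≡ st t
    east-nbr {zero}          p _ = dead (west _) p
    east-nbr {suc i} {zero}  p _ = dead (south _) p
    east-nbr {suc i} {suc j} {tile neg _ _ _} p refl = any-elim (proj₁ (ok p))

    west-nbr : ∀ {i j t} → A (suc i) j ≡ just t → sx t ≡ pos → ∃ λ u → A i j ≡ just u × HL u t × st u ≡ st t
    west-nbr {i} {zero}  p _ = dead (south _) p
    west-nbr {i} {suc j} {tile pos _ _ _} p refl = any-elim (proj₁ (ok p))

    south-nbr : ∀ {i j t} → A i (suc j) ≡ just t → sy t ≡ pos → ∃ λ u → A i j ≡ just u × VL u t
    south-nbr {zero}  p _ = dead (west _) p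
    south-nbr {suc i} {t = tile _ pos _ _} p refl = any-elim (proj₁ (proj₂ (ok p)))

    north-nbr : ∀ {i j t} → A i j ≡ just t → sy t ≡ neg → ∃ λ u → A i (suc j) ≡ just u × VL t u
    north-nbr {zero}          p _ = dead (west _) p
    north-nbr {suc i} {zero}  p _ = dead (south _) p
    north-nbr {suc i} {suc j} {tile _ neg _ _} p refl = any-elim (proj₁ (proj₂ (ok p)))

    -- Pth n i j: n steps eastwards lead from (i , j) to an axis tile; Col k i j: k steps southwards
    -- lead to a tile of the bottom row.
    Pth : ℕ → ℕ → ℕ → Set
    Pth zero    i j = ∃ λ t → A i j ≡ just t × sx t ≡ nul
    Pth (suc n) i j = (∃ λ t → A i j ≡ just t × sx t ≡ neg) × Pth n (suc i) j

    Col : ℕ → ℕ → ℕ → Set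
    Col zero    i j       = ∃ λ t → A i j ≡ just t × sy t ≡ nul
    Col (suc k) i zero    = ⊥
    Col (suc k) i (suc j) = (∃ λ t → A i (suc j) ≡ just t × sy t ≡ pos) × Col k i j

    -- Neighbours in a row share `sy` and neighbours in a column share `sx`, so a whole column down
    -- to the base row is copied to the adjacent one.
    col-W : ∀ k {i j t} → A i j ≡ just t → sx t ≡ neg → Col k (suc i) j → Col k i j
    col-W zero {t = t} p n (u , q , e) with v , q′ , (_ , y) , _ ← east-nbr p n with refl ← same q q′ = t , p , trans y e
    col-W (suc k) {j = suc j} {t} p n ((u , q , e) , c)
      with v , q′ , (_ , y) , _ ← east-nbr p n with refl ← same q q′
      with t′ , p′ , _ , x ← south-nbr p (trans y e) = (t , p , trans y e) , col-W k p′ (trans x n) c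

    col-E : ∀ k {i j t} → A i j ≡ just t → sx t ≡ neg → Col k i j → Col k (suc i) j
    col-E zero p n (u , q , e) with refl ← same p q with v , q′ , (_ , y) , _ ← east-nbr p n = v , q′ , trans (sym y) e
    col-E (suc k) {j = suc j} p n ((u , q , e) , c)
      with refl ← same p q
      with v , q′ , (_ , y) , _ ← east-nbr p n
      with t′ , p′ , _ , x ← south-nbr p e = (v , q′ , trans (sym y) e) , col-E k p′ (trans x n) c

    col-pos : ∀ k {i j t} → A (suc i) j ≡ just t → sx t ≡ pos → Col k (suc i) j → Col k i j
    col-pos zero p n (u , q , e) with refl ← same p q with v , q′ , (_ , y) , _ ← west-nbr p n = v , q′ , trans y e
    col-pos (suc k) {j = suc j} p n ((u , q , e) , c)
      with refl ← same p q
      with v , q′ , (_ , y) , _ ← west-nbr p n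
      with t′ , p′ , _ , x ← south-nbr p e = (v , q′ , trans y e) , col-pos k p′ (trans x n) c

    pth-S : ∀ n k {i j} → Pth n i (suc j) → Col (suc k) i (suc j) → Pth n i j
    pth-S zero    k (t , p , z) ((u , q , e) , _) with refl ← same p q with v , q′ , _ , x ← south-nbr p e = v , q′ , trans x z
    pth-S (suc n) k ((t , p , z) , P) C@((u , q , e) , _)
      with refl ← same p q
      with v , q′ , _ , x ← south-nbr p e = (v , q′ , trans x z) , pth-S n k P (col-E (suc k) p z C)

    pth-det : ∀ n m {i j} → Pth n i j → Pth m i j → n ≡ m
    pth-det zero    zero    _ _ = refl
    pth-det zero    (suc m) (t , p , z) ((u , q , z′) , _) with refl ← same p q with () ← trans (sym z) z′
    pth-det (suc n) zero    ((u , q , z′) , _) (t , p , z) with refl ← same p q with () ← trans (sym z) z′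
    pth-det (suc n) (suc m) (_ , P) (_ , P′) = cong suc (pth-det n m P P′)

    CentreAt : ℕ → ℕ → Set
    CentreAt i j = ∃ λ t → A i j ≡ just t × Centre t

    pth-end : ∀ n {i j} → Pth n i j → Col 0 i j → CentreAt (i + n) j
    pth-end zero {i} {j} (t , p , z) (u , q , e) with refl ← same p q = subst (λ a → CentreAt a j) (sym (+-identityʳ i)) (t , p , z , e)
    pth-end (suc n) {i} {j} ((t , p , z) , P) C = subst (λ a → CentreAt a j) (sym (+-suc i n)) (pth-end n P (col-E 0 p z C))

    pth-centre : ∀ c l {i j} → Pth l i j → CentreAt (c + i) j → c ≤ l → c ≡ l
    pth-centre zero    zero    _ _ _ = refl
    pth-centre zero    (suc l) ((t , p , z) , _) (u , q , z′ , _) _ with refl ← same p q with () ← trans (sym z) z′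
    pth-centre (suc c) (suc l) {i} {j} (_ , P) C (s≤s le) = cong suc (pth-centre c l P (subst (λ a → CentreAt a j) (sym (+-suc c i)) C) le)

    alive-pos : ∀ {i j t} → A i j ≡ just t → ∃ λ i′ → ∃ λ j′ → i ≡ suc i′ × j ≡ suc j′
    alive-pos {zero}          p = dead (west _) p
    alive-pos {suc i} {zero}  p = dead (south _) p
    alive-pos {suc i} {suc j} p = i , j , refl , refl

    West : ℕ → ℕ → Tile → Set
    West i j t = ∃ λ i′ → i ≡ suc i′ × ∃ λ v → A i′ j ≡ just v × HL v t

    row₀-nul : ∀ {i j t} → A i j ≡ just t → sx t ≡ nul → sy t ≡ nul →
      (∀ m → (lookup (bits t) m ≡ true → West i j t) × (lookup (bits t) m ≡ false → CentreAt (ι m + i) j)) × st t ≡ q₀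
    row₀-nul {i} {j} {tile nul nul q bs} p refl refl with _ , _ , refl , refl ← alive-pos p with ok p
    ... | _ , _ , some r , s = (λ m → (λ b → _ , refl , any-elim (proj₂ (proj₁ (r m) b))) ,
                                     (λ b → subst (λ x → ∃ λ u → x ≡ just u × Centre u) (offs-at κ₁ κ₂ A _ _ p m) (any-elim (proj₂ (r m) b (lookup-replicate m true))))) , s refl

    row₀-neg : ∀ {i j t u} → A i j ≡ just t → sx t ≡ neg → sy t ≡ nul → A (suc i) j ≡ just u →
      ∀ m → (lookup (bits t) m ≡ true → lookup (bits u) m ≡ true × West i j t) ×
            (lookup (bits t) m ≡ false → lookup (bits u) m ≡ true → CentreAt (ι m + i) j)
    row₀-neg {i} {j} {tile neg nul q bs} p refl refl p′ m with _ , _ , refl , refl ← alive-pos p with proj₁ (proj₂ (proj₂ (ok p)))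
    ... | r rewrite p′ with some r′ ← r =
      (λ b → proj₁ (proj₁ (r′ m) b) , _ , refl , any-elim (proj₂ (proj₁ (r′ m) b))) , (λ b b′ → subst (λ x → ∃ λ u → x ≡ just u × Centre u) (offs-at κ₁ κ₂ A _ _ p m) (any-elim (proj₂ (r′ m) b b′)))

    link-W : ∀ {a b} → Link a b → b ≢ pos → a ≡ neg
    link-W neg-neg _ = refl
    link-W neg-nul _ = refl
    link-W nul-pos n = contradiction refl n
    link-W pos-pos n = contradiction refl n

    bool-cases : ∀ b → b ≡ true ⊎ b ≡ false
    bool-cases true  = inj₁ refl
    bool-cases false = inj₂ refl

    pth-sx : ∀ n {i j t} → Pth n i j → A i j ≡ just t → sx t ≢ pos
    pth-sx zero    (u , q , z)       p e with refl ← same p q with () ← trans (sym z) e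
    pth-sx (suc n) ((u , q , z) , _) p e with refl ← same p q with () ← trans (sym z) e

    pth-alive : ∀ n {i j} → Pth n i j → ∃ λ t → A i j ≡ just t
    pth-alive zero    (t , p , _)       = t , p
    pth-alive (suc n) ((t , p , _) , _) = t , p

    col₀-sy : ∀ {i j t} → Col 0 i j → A i j ≡ just t → sy t ≡ nul
    col₀-sy (u , q , e) p with refl ← same p q = e

    -- The arm of a centre ends where the offset cell is a centre; by induction from the east that one can
    -- only be the centre of the arm itself, so the arm has the right length.
    module Input (m : Fin K) where
      κ : ℕ
      κ = ι m

      BitAt : Bool → ℕ → ℕ → Set
      BitAt b i j = ∃ λ t → A i j ≡ just t × lookup (bits t) m ≡ b

      bit-det : ∀ {i j} → BitAt true i j → BitAt false i j → ⊥
      bit-det (t , p , b) (u , q , c) with refl ← same p q with () ← trans (sym b) c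

      InnerTrue : ℕ → ℕ → ℕ → Set
      InnerTrue zero    i j = ⊤
      InnerTrue (suc n) i j = BitAt true (suc i) j

      bit-false : ∀ n {i j} → Pth n i j → Col 0 i j → InnerTrue n i j → BitAt false i j → CentreAt (κ + i) j
      bit-false zero (v , p , z) C I (t , p′ , b) with refl ← same p p′ = proj₂ (proj₁ (row₀-nul p z (col₀-sy C p)) m) b
      bit-false (suc n) ((v , p , z) , _) C (u , q , b′) (t , p′ , b) with refl ← same p p′ =
        proj₂ (row₀-neg p z (col₀-sy C p) q m) b b′

      bit-true : ∀ n {i j} → Pth n i j → Col 0 i j → BitAt true i j → ∃ λ i′ → i ≡ suc i′ × Pth (suc n) i′ j × Col 0 i′ j
      bit-true n {i} {j} P C (t , p , b) = conclude (go n P)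
        where
        go : ∀ n → Pth n i j → West i j t
        go zero (v , p′ , z) with refl ← same p p′ = proj₁ (proj₁ (row₀-nul p z (col₀-sy C p)) m) b
        go (suc n) ((v , p′ , z) , P′) with refl ← same p p′ =
          proj₂ (proj₁ (row₀-neg p z (col₀-sy C p) (proj₂ (pth-alive n P′)) m) b)
        conclude : West i j t → ∃ λ i′ → i ≡ suc i′ × Pth (suc n) i′ j × Col 0 i′ j
        conclude (i′ , refl , v , q , l , y) = i′ , refl , ((v , q , link-W l (pth-sx n P p)) , P) , v , q , trans y (col₀-sy C p)

      bit-mono : ∀ n {i j} → Pth (suc n) i j → Col 0 i j → BitAt true i j → BitAt true (suc i) j
      bit-mono n ((v , p , z) , P) C (t , p′ , b) with refl ← same p p′ =
        let u , q = pth-alive n P in u , q , proj₁ (proj₁ (row₀-neg p z (col₀-sy C p) q m) b)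

      bit-mono* : ∀ d n {i j} → Pth (d + n) i j → Col 0 i j → BitAt true i j → BitAt true (d + i) j
      bit-mono* zero    n P C b = b
      bit-mono* (suc d) n {i} {j} P@((v , p , z) , P′) C b =
        subst (λ x → BitAt true x j) (+-suc d i) (bit-mono* d n P′ (col-E 0 p z C) (bit-mono (d + n) P C b))

      Arm : ℕ → ℕ → ℕ → Set
      Arm n i j = Pth n i j × Col 0 i j × InnerTrue n i j × BitAt false i j

      -- As long as the bit is true the arm goes on westwards, and the empty column 0 forces it to
      -- stop somewhere.
      walk : ∀ n i {j} → Pth n i j → Col 0 i j → InnerTrue n i j → ∃ λ l → ∃ λ i′ → l + i′ ≡ n + i × Arm l i′ j
      walk n i P C I with t , p ← pth-alive n P with bool-cases (lookup (bits t) m)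
      walk n i P C I | inj₂ b = n , i , refl , P , C , I , t , p , b
      walk n zero P C I | inj₁ b = dead (west _) p
      walk n (suc i) P C I | inj₁ b with _ , refl , P′ , C′ ← bit-true n P C (t , p , b) =
        let l , i′ , eq , arm = walk (suc n) i P′ C′ (t , p , b) in l , i′ , trans eq (sym (+-suc n i)) , arm

      arm-length : ∀ f {a j} → w < a + f → CentreAt a j → ∃ λ i → κ + i ≡ a × Arm κ i j
      arm-length zero {a} {j} lt (t , p , _) = dead (east a j (subst (w <_) (+-identityʳ a) lt)) p
      arm-length (suc f) {a} {j} lt (t , p , cx , cy) with walk 0 a (t , p , cx) (t , p , cy) tt
      ... | l , i , eq , arm@(P , C , I , b) with c ← bit-false l P C I b with κ ≤? l
      ...   | yes le with refl ← pth-centre κ l P c le = i , eq , arm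
      -- The offset cell would be a centre east of `a`. Its own arm has length `κ` by induction and
      -- ends at the same `i`, so `i` would be both `κ` and `l` steps from its axis.
      ...   | no ¬le with k , e , P′ , _ ← arm-length f (<-≤-trans lt (subst (_≤ κ + i + f) (sym (+-suc a f)) (+-monoˡ-≤ f (subst (_< κ + i) eq (+-monoˡ-< i (≰⇒> ¬le)))))) c
        with refl ← +-cancelˡ-≡ κ k i e with refl ← pth-det l κ P P′ = contradiction ≤-refl ¬le

      -- A true bit forces the next bit towards the axis to be true. Hence the change at distance
      -- `κ` found by `arm-length` fixes the whole row, also beyond the end of the arm.
      bit-row : ∀ n {i j t} → Pth n i j → Col 0 i j → A i j ≡ just t → lookup (bits t) m ≡ (n <ᵇ κ)
      bit-row n {i} {j} {t} P C p with arm-length (suc w) (m≤n+m (suc w) (i + n)) (pth-end n P C)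
      ... | i₀ , eq , P₀ , C₀ , I₀ , b₀ with n <? κ
      bit-row n {i} {j} {t} P C p | i₀ , eq , P₀ , C₀ , I₀ , b₀ | yes lt = trans (go κ refl lt P₀ C₀ I₀) (sym (<ᵇ-true lt))
        where
        <ᵇ-true : ∀ {a b} → a < b → (a <ᵇ b) ≡ true
        <ᵇ-true {zero}  (s≤s _)  = refl
        <ᵇ-true {suc a} (s≤s lt) = <ᵇ-true lt
        go : ∀ κ′ → κ′ ≡ κ → n < κ′ → Pth κ′ i₀ j → Col 0 i₀ j → InnerTrue κ′ i₀ j → lookup (bits t) m ≡ true
        go (suc κ′) e (s≤s le) ((u , q , z) , P₁) C₁ I₁
          with v , p′ , b ← bit-mono* (κ′ ∸ n) n (subst (λ x → Pth x (suc i₀) j) (sym (m∸n+n≡m le)) P₁) (col-E 0 q z C₁) I₁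
          with refl ← +-cancelʳ-≡ n (κ′ ∸ n + suc i₀) i (begin
            κ′ ∸ n + suc i₀ + n   ≡⟨ +-assoc (κ′ ∸ n) (suc i₀) n ⟩
            κ′ ∸ n + (suc i₀ + n) ≡⟨ cong (λ z → κ′ ∸ n + z) (+-comm (suc i₀) n) ⟩
            κ′ ∸ n + (n + suc i₀) ≡⟨ +-assoc (κ′ ∸ n) n (suc i₀) ⟨
            κ′ ∸ n + n + suc i₀   ≡⟨ cong (_+ suc i₀) (m∸n+n≡m le) ⟩
            κ′ + suc i₀           ≡⟨ +-suc κ′ i₀ ⟩
            suc κ′ + i₀           ≡⟨ cong (_+ i₀) e ⟩
            κ + i₀                ≡⟨ eq ⟩
            i + n                 ∎)
          with refl ← same p p′ = b
      bit-row n {i} {j} {t} P C p | i₀ , eq , P₀ , C₀ , I₀ , b₀ | no ¬lt with bool-cases (lookup (bits t) m)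
      ... | inj₂ b = trans b (sym (<ᵇ-false (≮⇒≥ ¬lt)))
        where
        <ᵇ-false : ∀ {a b} → b ≤ a → (a <ᵇ b) ≡ false
        <ᵇ-false {a} {zero} _ = refl
        <ᵇ-false {suc a} {suc b} (s≤s le) = <ᵇ-false le
      ... | inj₁ b = contradiction b₀ (bit-det (subst (λ x → BitAt true x j) loc
              (bit-mono* (n ∸ κ) κ (subst (λ x → Pth x i j) (sym (m∸n+n≡m (≮⇒≥ ¬lt))) P) C (t , p , b))))
        where
        loc : n ∸ κ + i ≡ i₀
        loc = +-cancelˡ-≡ κ (n ∸ κ + i) i₀ (begin
          κ + (n ∸ κ + i) ≡⟨ +-assoc κ (n ∸ κ) i ⟨
          κ + (n ∸ κ) + i ≡⟨ cong (_+ i) (m+[n∸m]≡n (≮⇒≥ ¬lt)) ⟩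
          n + i           ≡⟨ +-comm n i ⟩
          i + n           ≡⟨ eq ⟨
          κ + i₀          ∎)

    start-conf : Conf
    start-conf = q₀ , ι

    stateAt : ℕ → Q
    stateAt k = proj₁ (conf k start-conf)

    countAt : ℕ → Fin K → ℕ
    countAt k = proj₂ (conf k start-conf)

    Good : ℕ → ℕ → ℕ → ℕ → Set
    Good k n i j = ∃ λ t → A i j ≡ just t × st t ≡ stateAt k × bits t ≡ row n (countAt k)

    ext-row : ∀ {v : Vec Bool K} {n c} → (∀ m → lookup v m ≡ (n <ᵇ c m)) → v ≡ row n c
    ext-row {v} h = trans (sym (tabulate∘lookup v)) (tabulate-cong h)

    above : ∀ {i j t u} → A i (suc j) ≡ just t → sx t ≢ pos → sy t ≡ pos → A i j ≡ just u →
      ∃ λ i′ → i ≡ suc i′ × (∃ λ v → A i′ j ≡ just v × HL v u ×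
        (∃ λ I → inner (sx t) (A (suc i) j) ≡ just I × bits t ≡ newBits (op (st u)) I (bits u) (bits v))) ×
        (sx t ≡ nul → st t ≡ δ (st u) (bits u))
    above {i} {j} {t} p nx refl q with _ , _ , refl , refl ← alive-pos p with proj₂ (proj₂ (ok p))
    above {t = tile pos _ _ _} p nx refl q | r = contradiction refl nx
    above {t = tile nul pos _ _} p nx refl q | r rewrite q with some (r₁ , r₂) ← r with v , e , h , a ← any-elim r₁ = _ , refl , (v , e , h , any-elim a) , r₂
    above {t = tile neg pos _ _} p nx refl q | r rewrite q with some (r₁ , r₂) ← r with v , e , h , a ← any-elim r₁ = _ , refl , (v , e , h , any-elim a) , r₂

    module Step (k : ℕ) (IH : ∀ n {i j} → Pth n i j → Col k i j → Good k n i j) where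
      step-state : ∀ n {i j t} → Pth n i (suc j) → Col (suc k) i (suc j) → A i (suc j) ≡ just t → st t ≡ stateAt (suc k)
      step-state zero P@(t , p , z) C@((_ , p″ , y) , C′) p′
        with refl ← same p p′ with refl ← same p p″
        with u , q , su , bu ← IH zero (pth-S zero k P C) C′
        with _ , _ , _ , d ← above p (pth-sx zero P p) y q = trans (d z) (cong₂ δ su bu)
      step-state (suc n) ((t , p , z) , P′) C p′
        with refl ← same p p′
        with x , px , _ , e ← east-nbr p z = trans (sym e) (step-state n P′ (col-E (suc k) p z C) px)

      -- The check itself demands the tile at distance `suc n` in the previous row, so the induction
      -- hypothesis is available one column farther out than the tile considered.
      step-bits : ∀ n {i j t} → Pth n i (suc j) → Col (suc k) i (suc j) → A i (suc j) ≡ just t → bits t ≡ row n (countAt (suc k))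
      step-bits n {i} {j} {t} P C@((t′ , p′ , y) , C′) p
        with refl ← same p p′
        with u , q , su , bu ← IH n (pth-S n k P C) C′
        with i′ , refl , (v , qv , hv , I , eI , b) , _ ← above p (pth-sx n P p) y q
        with zv ← link-W (proj₁ hv) (pth-sx n (pth-S n k P C) q)
        with v′ , qv′ , _ , bv ← IH (suc n) {i′} ((v , qv , zv) , pth-S n k P C) (col-W k qv zv C′)
        with refl ← same qv qv′ = begin
          bits t                                                              ≡⟨ b ⟩
          newBits (op (st u)) I (bits u) (bits v)                             ≡⟨ cong₂ (newBits (op (st u)) I) bu bv ⟩
          newBits (op (st u)) I (row n (countAt k)) (row (suc n) (countAt k)) ≡⟨ cong₂ (λ s I → newBits (op s) I (row n (countAt k)) (row (suc n) (countAt k))) su (inn n P (pth-S n k P C)) ⟩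
          newBits (op (stateAt k)) (innerRow n (countAt k)) (row n (countAt k)) (row (suc n) (countAt k)) ≡⟨ newBits-row (stateAt k) n (countAt k) ⟩
          row n (countAt (suc k))                                             ∎
        where
        inn : ∀ n → Pth n (suc i′) (suc j) → Pth n (suc i′) j → I ≡ innerRow n (countAt k)
        inn zero (_ , p′ , z) _ with refl ← same p p′ = same eI (cong (λ a → inner a (A (suc (suc i′)) j)) z)
        inn (suc n) ((_ , p′ , z) , P′) ((_ , q′ , z′) , P″)
          with refl ← same p p′
          with x , px , _ , bx ← IH n P″ (col-E k q′ z′ C′)
          = trans (same eI (trans (cong (λ a → inner a (A (suc (suc i′)) j)) z) (cong (Maybe.map bits) px))) bx

    content₀ : ∀ n {i j} → Pth n i j → Col 0 i j → Good 0 n i j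
    content₀ zero P@(t , p , z) C = t , p , proj₂ (row₀-nul p z (col₀-sy C p)) , ext-row {n = 0} {ι} (λ m → Input.bit-row m 0 P C p)
    content₀ (suc n) P@((t , p , z) , P′) C
      with u , q , _ , e ← east-nbr p z
      with u′ , q′ , s , _ ← content₀ n P′ (col-E 0 p z C)
      with refl ← same q q′ = t , p , trans (sym e) s , ext-row {n = suc n} {ι} (λ m → Input.bit-row m (suc n) P C p)

    content : ∀ k n {i j} → Pth n i j → Col k i j → Good k n i j
    content zero    n P C = content₀ n P C
    content (suc k) n {i} {suc j} P C@((t , p , _) , _) = t , p , step-state n P C p , step-bits n P C p
      where open Step k (content k)

    axis : ∀ {i j t} → A i j ≡ just t → ∃ λ a → ∃ λ u → A a j ≡ just u × sx u ≡ nul × st u ≡ st t × (∀ k → Col k i j → Col k a j)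
    axis {i} {j} {t} p = go (sx t) refl
      where
      link-E : ∀ {a b} → Link a b → a ≡ neg → b ≡ neg ⊎ b ≡ nul
      link-E neg-neg _ = inj₁ refl
      link-E neg-nul _ = inj₂ refl
      link-E nul-pos ()
      link-E pos-pos ()

      link-P : ∀ {a b} → Link a b → b ≡ pos → a ≡ pos ⊎ a ≡ nul
      link-P neg-neg ()
      link-P neg-nul ()
      link-P nul-pos _ = inj₂ refl
      link-P pos-pos _ = inj₁ refl

      Res : ℕ → Tile → Set
      Res i t = ∃ λ a → ∃ λ u → A a j ≡ just u × sx u ≡ nul × st u ≡ st t × (∀ k → Col k i j → Col k a j)

      goE : ∀ f i {t} → w < i + f → A i j ≡ just t → sx t ≡ neg → Res i t
      goE zero    i lt p z = dead (east i j (subst (w <_) (+-identityʳ i) lt)) p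
      goE (suc f) i lt p z with u , q , (l , _) , e ← east-nbr p z with link-E l z
      ... | inj₂ n = suc i , u , q , n , e , λ k → col-E k p z
      ... | inj₁ n = let a , v , r , x , e′ , c = goE f (suc i) (subst (w <_) (+-suc i f) lt) q n
                     in a , v , r , x , trans e′ e , λ k C → c k (col-E k p z C)

      goP : ∀ i {t} → A i j ≡ just t → sx t ≡ pos → Res i t
      goP zero    p z = dead (west j) p
      goP (suc i) p z with u , q , (l , _) , e ← west-nbr p z with link-P l z
      ... | inj₂ n = i , u , q , n , e , λ k → col-pos k p z
      ... | inj₁ n = let a , v , r , x , e′ , c = goP i q n in a , v , r , x , trans e′ e , λ k C → c k (col-pos k p z C)

      go : ∀ s → sx t ≡ s → Res i t
      go neg z = goE (suc w) i (m≤n+m (suc w) i) p z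
      go nul z = i , t , p , z , refl , λ _ C → C
      go pos z = goP i p z

    -- Bits are controlled only on and west of the axis, but the state is constant along a row, so
    -- the eastern tiles carry the true state of their row too.
    tile-state : ∀ k {i j t} → A i j ≡ just t → Col k i j → st t ≡ stateAt k
    tile-state k p C
      with a , u , q , z , e , c ← axis p
      with v , q′ , s , _ ← content k 0 (u , q , z) (c k C)
      with refl ← same q q′ = trans (sym e) s

    link-down : ∀ {a b} → Link a b → a ≢ neg ⊎ b ≡ pos → a ≢ neg
    link-down neg-neg (inj₁ n)  = n
    link-down neg-neg (inj₂ ())
    link-down neg-nul (inj₁ n)  = n
    link-down neg-nul (inj₂ ())
    link-down nul-pos _ ()
    link-down pos-pos _ ()

    column : ∀ j {i t} → A i j ≡ just t → sy t ≢ neg → ∃ λ k → Col k i j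
    column zero    {i} p n = dead (south i) p
    column (suc j) {i} {t@(tile _ neg _ _)} p n = contradiction refl n
    column (suc j) {i} {t@(tile _ nul _ _)} p n = 0 , t , p , refl
    column (suc j) {i} {t@(tile _ pos _ _)} p n with u , q , (l , _) ← south-nbr p refl =
      let k , C = column j q (link-down l (inj₂ refl)) in suc k , (t , p , refl) , C

    col-base : ∀ k {i j t} → A i j ≡ just t → sx t ≡ nul → Col k i j → ∃ λ b → CentreAt i b
    col-base zero    {j = j} p z (u , q , e) with refl ← same p q = j , u , q , z , e
    col-base (suc k) {j = suc j} p z ((u , q , e) , C) with refl ← same p q with v , q′ , _ , x ← south-nbr p e = col-base k q′ (trans x z) C

    upper : ∀ f {i j t} → w < j + f → A i j ≡ just t → ∃ λ j′ → ∃ λ u → A i j′ ≡ just u × sy u ≢ neg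
    upper zero    {i} {j} lt p = dead (north i j (subst (w <_) (+-identityʳ j) lt)) p
    upper (suc f) {i} {j} {t@(tile _ nul _ _)} lt p = j , t , p , λ ()
    upper (suc f) {i} {j} {t@(tile _ pos _ _)} lt p = j , t , p , λ ()
    upper (suc f) {i} {j} {t@(tile _ neg _ _)} lt p with u , q , _ ← north-nbr p refl = upper f (subst (w <_) (+-suc j f) lt) q

    -- A surviving tile leads to a centre: north out of the lower half, then sideways to the axis at
    -- constant height, then down to the base row.
    centre : ∀ {i j t} → A i j ≡ just t → ∃ λ a → ∃ λ b → CentreAt a b
    centre {j = j} p
      with j′ , u , q , n ← upper (suc w) (m≤n+m (suc w) j) p
      with k , C ← column j′ q n
      with a , v , r , z , _ , c ← axis q = a , col-base k r z (c k C)

-- Cores and bits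

sum< : ℕ → (ℕ → ℕ) → ℕ
sum< zero    f = 0
sum< (suc w) f = f w + sum< w f

-- Applied to the number of tiles, for columns and within each column: either nothing at all is
-- erased or the total drops.
sum-step : ∀ {P : ℕ → Set} {f g : ℕ → ℕ} → (∀ i → (P i × f i ≡ g i) ⊎ f i < g i) →
           ∀ w → ((∀ i → i < w → P i) × sum< w f ≡ sum< w g) ⊎ sum< w f < sum< w g
sum-step h zero = inj₁ ((λ _ ()) , refl)
sum-step {P} {f} {g} h (suc w) with h w | sum-step {P} h w
... | inj₁ (p , e) | inj₁ (ps , e′) = inj₁ (all , cong₂ _+_ e e′)
  where
  all : ∀ i → i < suc w → P i
  all i (s≤s le) with m≤n⇒m<n∨m≡n le
  ... | inj₁ lt   = ps i lt
  ... | inj₂ refl = p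
... | inj₁ (_ , e) | inj₂ lt       = inj₂ (+-mono-≤-< (≤-reflexive e) lt)
... | inj₂ lt      | inj₁ (_ , e′) = inj₂ (+-mono-<-≤ lt (≤-reflexive e′))
... | inj₂ lt      | inj₂ lt′      = inj₂ (+-mono-< lt lt′)

module Automaton (M : Machine) (β : Sg → Machine.Q M → Bool) (flag : Bool) where
  open Machine M
  open Tiles M public

  HLm VLm : Maybe Tile → Maybe Tile → Set
  HLm a b = Any (λ u → Any (HL u) b) a
  VLm a b = Any (λ u → Any (VL u) b) a

  -- `sy` and `st` are constant along a row of a structure, hence so is blocking; this is what lets
  -- cores be extended towards the axis in `Outward`.
  Blocking : Tile → Set
  Blocking t = β (sy t) (st t) ≡ true

  Bm : Maybe Tile → Set
  Bm = Any Blocking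

  -- A core: a 3 × 3 block (columns from the left, each from the bottom) of blocking tiles of one structure.
  record Core (a b c d e f g h k : Maybe Tile) : Set where
    constructor core
    field
      h₁ : HLm a d
      h₂ : HLm b e
      h₃ : HLm c f
      h₄ : HLm d g
      h₅ : HLm e h
      h₆ : HLm f k
      v₁ : VLm a b
      v₂ : VLm b c
      v₃ : VLm d e
      v₄ : VLm e f
      v₅ : VLm g h
      v₆ : VLm h k
      b₁ : Bm a
      b₂ : Bm b
      b₃ : Bm c
      b₄ : Bm d
      b₅ : Bm e
      b₆ : Bm f
      b₇ : Bm g
      b₈ : Bm h
      b₉ : Bm k

  core? : ∀ a b c d e f g h k → Dec (Core a b c d e f g h k)
  core? a b c d e f g h k = map′
    (λ ((h₁ , h₂ , h₃ , h₄ , h₅ , h₆) , (v₁ , v₂ , v₃ , v₄ , v₅ , v₆) , (b₁ , b₂ , b₃) , (b₄ , b₅ , b₆) , b₇ , b₈ , b₉) →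
      core h₁ h₂ h₃ h₄ h₅ h₆ v₁ v₂ v₃ v₄ v₅ v₆ b₁ b₂ b₃ b₄ b₅ b₆ b₇ b₈ b₉)
    (λ (core h₁ h₂ h₃ h₄ h₅ h₆ v₁ v₂ v₃ v₄ v₅ v₆ b₁ b₂ b₃ b₄ b₅ b₆ b₇ b₈ b₉) →
      (h₁ , h₂ , h₃ , h₄ , h₅ , h₆) , (v₁ , v₂ , v₃ , v₄ , v₅ , v₆) , (b₁ , b₂ , b₃) , (b₄ , b₅ , b₆) , b₇ , b₈ , b₉)
    ((hl a d ×-dec (hl b e ×-dec (hl c f ×-dec (hl d g ×-dec (hl e h ×-dec hl f k))))) ×-dec
     ((vl a b ×-dec (vl b c ×-dec (vl d e ×-dec (vl e f ×-dec (vl g h ×-dec vl h k))))) ×-dec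
      ((bl a ×-dec (bl b ×-dec bl c)) ×-dec ((bl d ×-dec (bl e ×-dec bl f)) ×-dec (bl g ×-dec (bl h ×-dec bl k))))))
    where
    hl : ∀ a b → Dec (HLm a b)
    hl a b = Any.dec (λ u → Any.dec (hl? u) b) a
    vl : ∀ a b → Dec (VLm a b)
    vl a b = Any.dec (λ u → Any.dec (vl? u) b) a
    bl : ∀ a → Dec (Bm a)
    bl = Any.dec (λ t → β (sy t) (st t) Bool.≟ true)

  -- The core centred at (1 + i , 1 + j)
  CoreAt : Grid → ℕ → ℕ → Set
  CoreAt A i j = Core (A i j) (A i (1 + j)) (A i (2 + j)) (A (1 + i) j) (A (1 + i) (1 + j)) (A (1 + i) (2 + j))
                      (A (2 + i) j) (A (2 + i) (1 + j)) (A (2 + i) (2 + j))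

  coreAt? : ∀ A i j → Dec (CoreAt A i j)
  coreAt? A i j = core? _ _ _ _ _ _ _ _ _

  opaque
    isCore₉ : (a b c d e f g h k : Maybe Tile) → Bool
    isCore₉ a b c d e f g h k = does (core? a b c d e f g h k)

  isCore : Grid → ℕ → ℕ → Bool
  isCore A i j = isCore₉ (A i j) (A i (1 + j)) (A i (2 + j)) (A (1 + i) j) (A (1 + i) (1 + j)) (A (1 + i) (2 + j))
                         (A (2 + i) j) (A (2 + i) (1 + j)) (A (2 + i) (2 + j))

  opaque
    unfolding isCore₉

    isCore-true : ∀ A i j → CoreAt A i j → isCore A i j ≡ true
    isCore-true A i j = dec-true (coreAt? A i j)

    isCore-false : ∀ A i j → ¬ CoreAt A i j → isCore A i j ≡ false
    isCore-false A i j = dec-false (coreAt? A i j)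

  next : (c sw s se w e n k l : Maybe Tile) → Maybe Tile
  next nothing  sw s se w e n k l = nothing
  next (just t) sw s se w e n k l =
    if does (Checks.ok? t sw s se w e n (offs k l (just t))) then just t else nothing

  next-kept : ∀ c {sw s se w e n k l t} → next c sw s se w e n k l ≡ just t → c ≡ just t × Checks.Ok t sw s se w e n (offs k l (just t))
  next-kept (just u) {sw} {s} {se} {w} {e} {n} {k} {l} eq = if-kept (Checks.ok? u sw s se w e n (offs k l (just u))) eq
    where
    if-kept : ∀ {P : Tile → Set} {t} (d : Dec (P u)) → (if does d then just u else nothing) ≡ just t → just u ≡ just t × P t
    if-kept (yes o) refl = refl , o

  -- On the axis both directions lead outward; the east is taken unless a core lies there.
  side : Maybe Tile → (coreE bitE bitW : Bool) → Bool
  side nothing  cE bE bW = false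
  side (just t) cE bE bW with sx t
  ... | pos = bE
  ... | neg = bW
  ... | nul = if cE then bW else bE

  -- Just below a core a bit is taken from the side away from the axis, so that bits can pass around it.
  nextBit : Maybe Tile → (core coreN coreE bitN bitE bitW : Bool) → Bool
  nextBit t c cN cE bN bE bW =
    if c then false else if not cN then bN else if flag then side t cE bE bW else false

  module _ (κ₁ κ₂ : ℕ) where
    nextAt : Grid → ℕ → ℕ → Maybe Tile
    nextAt A i j = next (A (1 + i) (1 + j)) (A i j) (A (1 + i) j) (A (2 + i) j) (A i (1 + j)) (A (2 + i) (1 + j)) (A (1 + i) (2 + j))
                        (A (κ₁ + suc i) (1 + j)) (A (κ₂ + suc i) (1 + j))

    nextBitAt : Grid → (ℕ → ℕ → Bool) → ℕ → ℕ → Bool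
    nextBitAt A B i j = nextBit (A (1 + i) (1 + j)) (isCore A i j) (isCore A i (1 + j)) (isCore A (1 + i) j)
                                (B (1 + i) (2 + j)) (B (2 + i) (1 + j)) (B i (1 + j))

    -- All offsets vanish beyond the first two coordinates, so each plane evolves by itself; this is
    -- such a plane with natural indices counted from a corner. On the border, whose outer
    -- neighbours are out of sight, only `dies` is known.
    record Trajectory : Set where
      field
        A     : ℕ → Grid
        B     : ℕ → ℕ → ℕ → Bool
        stepA : ∀ n i j → A (suc n) (suc i) (suc j) ≡ nextAt (A n) i j
        stepB : ∀ n i j → B (suc n) (suc i) (suc j) ≡ nextBitAt (A n) (B n) i j
        dies  : ∀ n i j → A n i j ≡ nothing → A (suc n) i j ≡ nothing

    nextAt-cong : ∀ {A A′ : Grid} → (∀ i j → A i j ≡ A′ i j) → ∀ i j → nextAt A i j ≡ nextAt A′ i j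
    nextAt-cong h i j
      rewrite h (1 + i) (1 + j) | h i j | h (1 + i) j | h (2 + i) j | h i (1 + j) | h (2 + i) (1 + j) | h (1 + i) (2 + j)
            | h (κ₁ + suc i) (1 + j) | h (κ₂ + suc i) (1 + j) = refl

    nextAt-keeps : ∀ {A : Grid} {i j t} → A (1 + i) (1 + j) ≡ just t → CheckAt.Ok κ₁ κ₂ A i j t → nextAt A i j ≡ just t
    nextAt-keeps {A} {i} {j} {t} p o rewrite p = cong (λ b → if b then just t else nothing) (dec-true (CheckAt.ok? κ₁ κ₂ A i j t) o)

    nextAt-kept : ∀ {A : Grid} {i j t} → nextAt A i j ≡ just t → A (1 + i) (1 + j) ≡ just t × CheckAt.Ok κ₁ κ₂ A i j t
    nextAt-kept {A} {i} {j} eq = next-kept (A (1 + i) (1 + j)) eq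

  coreAt-cong : ∀ {A A′ : Grid} → (∀ i j → A i j ≡ A′ i j) → ∀ {i j} → CoreAt A i j → CoreAt A′ i j
  coreAt-cong {A} {A′} h {i} {j} c
    rewrite h i j | h i (1 + j) | h i (2 + j) | h (1 + i) j | h (1 + i) (1 + j) | h (1 + i) (2 + j)
          | h (2 + i) j | h (2 + i) (1 + j) | h (2 + i) (2 + j) = c

  -- Why the detour of the bits around a core cannot get stuck: a cell outside the cores whose northern
  -- neighbour is a core has no core on the side away from the axis.
  module Outward {κ₁ κ₂ A w} (S : Stable κ₁ κ₂ A w) where
    open Structure S

    hl-elim : ∀ {i j i′ j′ u} → HLm (A i j) (A i′ j′) → A i j ≡ just u → ∃ λ v → A i′ j′ ≡ just v × HL u v
    hl-elim h p rewrite p with some h′ ← h = any-elim h′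

    hl-elim′ : ∀ {i j i′ j′ v} → HLm (A i j) (A i′ j′) → A i′ j′ ≡ just v → ∃ λ u → A i j ≡ just u × HL u v
    hl-elim′ h p with u , q , h′ ← any-elim h with v , p′ , l ← any-elim h′ with refl ← same p p′ = u , q , l

    vl-elim′ : ∀ {i j i′ j′ v} → VLm (A i j) (A i′ j′) → A i′ j′ ≡ just v → ∃ λ u → A i j ≡ just u × VL u v
    vl-elim′ h p with u , q , h′ ← any-elim h with v , p′ , l ← any-elim h′ with refl ← same p p′ = u , q , l

    bm-elim : ∀ {i j u} → Bm (A i j) → A i j ≡ just u → Blocking u
    bm-elim b p with u , q , x ← any-elim b with refl ← same p q = x

    hlm : ∀ {i j i′ j′ u v} → A i j ≡ just u → A i′ j′ ≡ just v → HL u v → HLm (A i j) (A i′ j′)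
    hlm p q l = any-intro p (any-intro q l)

    vlm : ∀ {i j i′ j′ u v} → A i j ≡ just u → A i′ j′ ≡ just v → VL u v → VLm (A i j) (A i′ j′)
    vlm p q l = any-intro p (any-intro q l)

    -- u and t are adjacent in a column, v is next to u on the inner side and b next to t.
    corner-VL : ∀ {x j u t v b} → VL u t → sy v ≡ sy u → sy b ≡ sy t → A x j ≡ just v → A x (suc j) ≡ just b → VL v b
    corner-VL {x} {j} {u} {t} {v} {b} (l , _) yv yb pv pb = go l yv yb
      where
      from-S : sy b ≡ pos → VL v b
      from-S e with v′ , pv′ , vl ← south-nbr pb e with refl ← same pv pv′ = vl
      from-N : sy v ≡ neg → VL v b
      from-N e with b′ , pb′ , vl ← north-nbr pv e with refl ← same pb pb′ = vl
      go : ∀ {a c} → Link a c → sy v ≡ a → sy b ≡ c → VL v b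
      go neg-neg e _ = from-N e
      go neg-nul e _ = from-N e
      go nul-pos _ e = from-S e
      go pos-pos _ e = from-S e

    blocking-cong : ∀ {u v} → sy v ≡ sy u → st v ≡ st u → Blocking u → Blocking v
    blocking-cong y s b = trans (cong₂ β y s) b

    -- The blocks of the northern and the eastern core cover the block of the cell except for its
    -- south-west corner. That corner is the inner neighbour of a tile of the eastern block, so the
    -- check of this tile guarantees it, in the same row and therefore blocking.
    outward-E : ∀ {i j t} → A (1 + i) (1 + j) ≡ just t → sx t ≡ pos → CoreAt A i (1 + j) → CoreAt A (1 + i) j → CoreAt A i j
    outward-E {i} {j} {t} p z cN cE
      with u , pu , vut ← vl-elim′ (Core.v₁ cE) p
      with v , pv , hvu , sv ← west-nbr pu (trans (proj₂ vut) z)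
      with b , pb , hbt ← hl-elim′ (Core.h₁ cN) p
      with vb ← corner-VL {u = u} {t} vut (proj₂ hvu) (proj₂ hbt) pv pb
      = core (hlm pv pu hvu) (Core.h₁ cN) (Core.h₂ cN) (Core.h₁ cE) (Core.h₂ cE) (Core.h₃ cE)
             (vlm pv pb vb) (Core.v₁ cN) (Core.v₁ cE) (Core.v₂ cE) (Core.v₃ cE) (Core.v₄ cE)
             (any-intro pv (blocking-cong {u} {v} (proj₂ hvu) sv (bm-elim (Core.b₁ cE) pu))) (Core.b₁ cN) (Core.b₂ cN)
             (Core.b₁ cE) (Core.b₂ cE) (Core.b₃ cE) (Core.b₄ cE) (Core.b₅ cE) (Core.b₆ cE)

    outward-W : ∀ {i j t} → A (2 + i) (1 + j) ≡ just t → sx t ≡ neg → CoreAt A (1 + i) (1 + j) → CoreAt A i j → CoreAt A (1 + i) j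
    outward-W {i} {j} {t} p z cN cW
      with u , pu , vut ← vl-elim′ (Core.v₅ cW) p
      with v , pv , huv , sv ← east-nbr pu (trans (proj₂ vut) z)
      with b , pb , htb ← hl-elim (Core.h₄ cN) p
      with vb ← corner-VL {u = u} {t} vut (sym (proj₂ huv)) (sym (proj₂ htb)) pv pb
      = core (Core.h₄ cW) (Core.h₅ cW) (Core.h₆ cW) (hlm pu pv huv) (Core.h₄ cN) (Core.h₅ cN)
             (Core.v₃ cW) (Core.v₄ cW) (Core.v₅ cW) (Core.v₆ cW) (vlm pv pb vb) (Core.v₅ cN)
             (Core.b₄ cW) (Core.b₅ cW) (Core.b₆ cW) (Core.b₇ cW) (Core.b₈ cW) (Core.b₉ cW)
             (any-intro pv (blocking-cong {u} {v} (sym (proj₂ huv)) sv (bm-elim (Core.b₇ cW) pu))) (Core.b₇ cN) (Core.b₈ cN)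

    -- Here the two lateral blocks already cover the block between them.
    outward-0 : ∀ {i j} → CoreAt A i j → CoreAt A (2 + i) j → CoreAt A (1 + i) j
    outward-0 cW cE = core (Core.h₄ cW) (Core.h₅ cW) (Core.h₆ cW) (Core.h₁ cE) (Core.h₂ cE) (Core.h₃ cE)
      (Core.v₃ cW) (Core.v₄ cW) (Core.v₅ cW) (Core.v₆ cW) (Core.v₃ cE) (Core.v₄ cE)
      (Core.b₄ cW) (Core.b₅ cW) (Core.b₆ cW) (Core.b₇ cW) (Core.b₈ cW) (Core.b₉ cW) (Core.b₄ cE) (Core.b₅ cE) (Core.b₆ cE)

  record Confined {κ₁ κ₂} (T : Trajectory κ₁ κ₂) (w : ℕ) : Set where
    open Trajectory T
    field
      west  : ∀ j → A 0 0 j ≡ nothing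
      south : ∀ i → A 0 i 0 ≡ nothing
      east  : ∀ i j → w < i → A 0 i j ≡ nothing
      north : ∀ i j → w < j → A 0 i j ≡ nothing

  -- Freezing of finite configurations and the escape of bits

  module Finite {κ₁ κ₂ w} (T : Trajectory κ₁ κ₂) (F : Confined T w) where
    open Trajectory T
    open Confined F

    dead-at : ∀ n {i j} → A 0 i j ≡ nothing → A n i j ≡ nothing
    dead-at zero    d = d
    dead-at (suc n) d = dies n _ _ (dead-at n d)

    ind : Maybe Tile → ℕ
    ind nothing  = 0
    ind (just _) = 1

    count : Grid → ℕ
    count G = sum< w (λ i → sum< w (λ j → ind (G (suc i) (suc j))))

    cell-step : ∀ n i j → (A (suc n) (suc i) (suc j) ≡ A n (suc i) (suc j) × ind (A (suc n) (suc i) (suc j)) ≡ ind (A n (suc i) (suc j)))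
                        ⊎ ind (A (suc n) (suc i) (suc j)) < ind (A n (suc i) (suc j))
    cell-step n i j with A (suc n) (suc i) (suc j) in eq | A n (suc i) (suc j) in eq′
    ... | nothing | nothing = inj₁ (refl , refl)
    ... | nothing | just _  = inj₂ (s≤s z≤n)
    ... | just t  | m with proj₁ (nextAt-kept κ₁ κ₂ {A n} {i} {j} (trans (sym (stepA n i j)) eq))
    ... | e with refl ← trans (sym eq′) e = inj₁ (refl , refl)

    count-step : ∀ n → (∀ i → i < w → ∀ j → j < w → A (suc n) (suc i) (suc j) ≡ A n (suc i) (suc j)) ⊎ count (A (suc n)) < count (A n)
    count-step n with sum-step (λ i → sum-step (cell-step n i) w) w
    ... | inj₁ (h , _) = inj₁ h
    ... | inj₂ lt      = inj₂ lt

    opaque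
      -- Tiles are never created, so their number drops only finitely often. A step erasing nothing
      -- in the box is repeated forever, see `frozen+`.
      freeze : ∃ λ n → ∀ i → i < w → ∀ j → j < w → A (suc n) (suc i) (suc j) ≡ A n (suc i) (suc j)
      freeze = go (suc (count (A 0))) 0 ≤-refl
        where
        go : ∀ f n → count (A n) < f → ∃ λ n → ∀ i → i < w → ∀ j → j < w → A (suc n) (suc i) (suc j) ≡ A n (suc i) (suc j)
        go (suc f) n (s≤s le) with count-step n
        ... | inj₁ h  = n , h
        ... | inj₂ lt = go f (suc n) (<-≤-trans lt le)

    T₀ : ℕ
    T₀ = proj₁ freeze

    G : Grid
    G = A T₀

    stable : Stable κ₁ κ₂ G w
    stable = record
      { west = λ j → dead-at T₀ (west j) ; south = λ i → dead-at T₀ (south i)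
      ; east = λ i j lt → dead-at T₀ (east i j lt) ; north = λ i j lt → dead-at T₀ (north i j lt)
      ; ok = ok }
      where
      ok : ∀ {i j t} → G (suc i) (suc j) ≡ just t → CheckAt.Ok κ₁ κ₂ G i j t
      ok {i} {j} p with i <? w | j <? w
      ... | yes i<w | yes j<w = proj₂ (nextAt-kept κ₁ κ₂ {G} (trans (sym (stepA T₀ i j)) (trans (proj₂ freeze i i<w j j<w) p)))
      ... | no i≮w | _ with () ← trans (sym p) (dead-at T₀ (east (suc i) (suc j) (s≤s (≮⇒≥ i≮w))))
      ... | yes _ | no j≮w with () ← trans (sym p) (dead-at T₀ (north (suc i) (suc j) (s≤s (≮⇒≥ j≮w))))

    frozen+ : ∀ k i j → A (k + T₀) i j ≡ G i j
    frozen+ zero    i j = refl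
    frozen+ (suc k) zero    j       = trans (dead-at (suc k + T₀) (west j)) (sym (dead-at T₀ (west j)))
    frozen+ (suc k) (suc i) zero    = trans (dead-at (suc k + T₀) (south (suc i))) (sym (dead-at T₀ (south (suc i))))
    frozen+ (suc k) (suc i) (suc j) = trans (stepA (k + T₀) i j) (trans (nextAt-cong κ₁ κ₂ (frozen+ k) i j) keep)
      where
      keep′ : ∀ m → G (suc i) (suc j) ≡ m → nextAt κ₁ κ₂ G i j ≡ m
      keep′ nothing  eq rewrite eq = refl
      keep′ (just t) eq = nextAt-keeps κ₁ κ₂ {G} eq (Stable.ok stable eq)
      keep : nextAt κ₁ κ₂ G i j ≡ G (suc i) (suc j)
      keep = keep′ _ refl

    frozen : ∀ {n} → T₀ ≤ n → ∀ i j → A n i j ≡ G i j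
    frozen {n} le i j = subst (λ m → A m i j ≡ G i j) (m∸n+n≡m le) (frozen+ (n ∸ T₀) i j)

    core-frozen : ∀ {n} → T₀ ≤ n → ∀ {i j} → CoreAt (A n) i j → CoreAt G i j
    core-frozen le = coreAt-cong (frozen le)

    frozen-core : ∀ {n} → T₀ ≤ n → ∀ {i j} → CoreAt G i j → CoreAt (A n) i j
    frozen-core le = coreAt-cong (λ i j → sym (frozen le i j))

    older : ∀ n {i j t} → A (suc n) i j ≡ just t → A n i j ≡ just t
    older n {zero}  {j}     p with () ← trans (sym p) (dead-at (suc n) (west j))
    older n {suc i} {zero}  p with () ← trans (sym p) (dead-at (suc n) (south (suc i)))
    older n {suc i} {suc j} p = proj₁ (nextAt-kept κ₁ κ₂ {A n} (trans (sym (stepA n i j)) p))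

    original : ∀ n {i j t} → A n i j ≡ just t → A 0 i j ≡ just t
    original zero    p = p
    original (suc n) p = original n (older n p)

    module Escape (b : Bool) (around : ∀ i j → w < j → B 0 i j ≡ b) where
      open Outward stable
      open Structure stable using (link-W)

      Eventually : ℕ → ℕ → Set
      Eventually i j = ∃ λ m → ∀ n → m ≤ n → B n (suc i) (suc j) ≡ b

      core-alive : ∀ {A : Grid} {i j} → CoreAt A i j → ∃ λ t → A (1 + i) (1 + j) ≡ just t
      core-alive c with t , p , _ ← any-elim (Core.b₅ c) = t , p

      above-not-core : ∀ n {i j} → w ≤ j → ¬ CoreAt (A n) i j
      above-not-core n {i} {j} le c with t , p ← core-alive {A n} {i} {j} c with () ← trans (sym p) (dead-at n (north (suc i) (suc j) (s≤s le)))

      ev-above : ∀ {i j} → w ≤ j → ∀ n → B n (suc i) (suc j) ≡ b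
      ev-above {i} {j} le zero    = around (suc i) (suc j) (s≤s le)
      ev-above {i} {j} le (suc n) = trans (stepB n i j) (trans
        (cong₂ (λ c cN → nextBit (A n (1 + i) (1 + j)) c cN (isCore (A n) (1 + i) j) (B n (1 + i) (2 + j)) (B n (2 + i) (1 + j)) (B n i (1 + j)))
          (isCore-false (A n) i j (above-not-core n le))
          (isCore-false (A n) i (1 + j) (above-not-core n (m≤n⇒m≤1+n le))))
        (ev-above (m≤n⇒m≤1+n le) n))

      delay : ∀ {i j i′ j′} → (∀ n → T₀ ≤ n → B (suc n) (suc i) (suc j) ≡ B n (suc i′) (suc j′)) → Eventually i′ j′ → Eventually i j
      delay {i} {j} h (m , e) = suc (m ⊔ T₀) , go
        where
        go : ∀ n → suc (m ⊔ T₀) ≤ n → B n (suc i) (suc j) ≡ b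
        go (suc n) (s≤s le) = trans (h n (≤-trans (m≤n⊔m m T₀) le)) (e n (≤-trans (m≤m⊔n m T₀) le))

      bit-N : ∀ {i j} → ¬ CoreAt G i j → ¬ CoreAt G i (1 + j) → ∀ n → T₀ ≤ n → B (suc n) (suc i) (suc j) ≡ B n (suc i) (2 + j)
      bit-N {i} {j} c cN n le = trans (stepB n i j)
        (cong₂ (λ c cN → nextBit (A n (1 + i) (1 + j)) c cN (isCore (A n) (1 + i) j) (B n (1 + i) (2 + j)) (B n (2 + i) (1 + j)) (B n i (1 + j)))
          (isCore-false (A n) i j (λ d → c (core-frozen le d)))
          (isCore-false (A n) i (1 + j) (λ d → cN (core-frozen le d))))

      bit-side : flag ≡ true → ∀ {i j t} → ¬ CoreAt G i j → CoreAt G i (1 + j) → G (1 + i) (1 + j) ≡ just t → ∀ n → T₀ ≤ n →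
        B (suc n) (suc i) (suc j) ≡ side (just t) (isCore (A n) (1 + i) j) (B n (2 + i) (1 + j)) (B n i (1 + j))
      bit-side f {i} {j} {t} c cN p n le = trans (stepB n i j) (trans
        (cong₂ (λ c cN → nextBit (A n (1 + i) (1 + j)) c cN (isCore (A n) (1 + i) j) (B n (1 + i) (2 + j)) (B n (2 + i) (1 + j)) (B n i (1 + j)))
          (isCore-false (A n) i j (λ d → c (core-frozen le d)))
          (isCore-true (A n) i (1 + j) (frozen-core le cN)))
        (cong₂ (λ f t → if f then side t (isCore (A n) (1 + i) j) (B n (2 + i) (1 + j)) (B n i (1 + j)) else false)
          f (trans (frozen le (1 + i) (1 + j)) p)))

      side-pos : ∀ {t cE bE bW} → sx t ≡ pos → side (just t) cE bE bW ≡ bE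
      side-pos {tile pos _ _ _} refl = refl

      side-neg : ∀ {t cE bE bW} → sx t ≡ neg → side (just t) cE bE bW ≡ bW
      side-neg {tile neg _ _ _} refl = refl

      side-nul : ∀ {t cE bE bW} → sx t ≡ nul → side (just t) cE bE bW ≡ (if cE then bW else bE)
      side-nul {tile nul _ _ _} refl = refl

      link-after-pos : ∀ {a c} → Link a c → a ≢ neg → c ≡ pos
      link-after-pos neg-neg n = contradiction refl n
      link-after-pos neg-nul n = contradiction refl n
      link-after-pos nul-pos _ = refl
      link-after-pos pos-pos _ = refl

      -- `f` bounds the rows left below the top of the box. A cell whose northern neighbour is no
      -- core copies it. Under a core the bit comes from the outward neighbour, which by `Outward`
      -- is again outside the cores; as the box is finite, this walk reaches a cell from which the
      -- way north is free.
      escape : flag ≡ true ⊎ (∀ i j → ¬ CoreAt G i j) → ∀ f {i j} → w ≤ j + f → ¬ CoreAt G i j → Eventually i j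
      escape _    zero    {i} {j} le c = 0 , λ n _ → ev-above (subst (w ≤_) (+-identityʳ j) le) n
      escape mode (suc f) {i} {j} le c with coreAt? G i (1 + j)
      ... | no cN = delay (bit-N c cN) (escape mode f (subst (w ≤_) (+-suc j f) le) cN)
      ... | yes cN with mode
      ...   | inj₂ none = contradiction cN (none i (1 + j))
      ...   | inj₁ fl = dispatch cN
        where
        up : ∀ {i} → ¬ CoreAt G i (1 + j) → Eventually i (1 + j)
        up = escape (inj₁ fl) f (subst (w ≤_) (+-suc j f) le)

        bottom : ∀ {i} → CoreAt G i (1 + j) → ∃ λ t → G (1 + i) (1 + j) ≡ just t
        bottom c with t , p , _ ← any-elim (Core.b₄ c) = t , p

        goE : ∀ g {i t} → i + g ≡ w → ¬ CoreAt G i j → CoreAt G i (1 + j) → G (1 + i) (1 + j) ≡ just t → sx t ≡ pos → Eventually i j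
        at-E : ∀ g {i t} → i + suc g ≡ w → ¬ CoreAt G (1 + i) j → CoreAt G i (1 + j) → G (1 + i) (1 + j) ≡ just t → sx t ≢ neg → Eventually (1 + i) j

        goE zero {i} e c cN p z with () ← trans (sym p) (dead-at T₀ (east (suc i) (1 + j) (s≤s (≤-reflexive (trans (sym e) (+-identityʳ i))))))
        goE (suc g) {i} {t} e c cN p z =
          delay (λ n le → trans (bit-side fl c cN p n le) (side-pos {t} {isCore (A n) (1 + i) j} z)) (at-E g e (λ cE → c (outward-E p z cN cE)) cN p (λ y → neg≢pos (trans (sym y) z)))

        at-E g {i} e cE cN p nz with coreAt? G (1 + i) (1 + j)
        ... | no cNE = delay (bit-N cE cNE) (up cNE)
        ... | yes cNE with v , q , l , _ ← hl-elim (Core.h₄ cN) p = goE g (trans (sym (+-suc i g)) e) cE cNE q (link-after-pos l nz)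

        goW : ∀ i {t} → ¬ CoreAt G i j → CoreAt G i (1 + j) → G (1 + i) (1 + j) ≡ just t → sx t ≡ neg → Eventually i j
        at-W : ∀ i {t} → ¬ CoreAt G i j → CoreAt G (1 + i) (1 + j) → G (2 + i) (1 + j) ≡ just t → sx t ≢ pos → Eventually i j

        goW zero    c cN p z with _ , q , _ ← any-elim (Core.b₁ cN) with () ← trans (sym q) (dead-at T₀ (west _))
        goW (suc i) {t} c cN p z =
          delay (λ n le → trans (bit-side fl c cN p n le) (side-neg {t} {isCore (A n) (2 + i) j} z)) (at-W i (λ cW → c (outward-W p z cN cW)) cN p (λ y → pos≢neg (trans (sym y) z)))

        at-W i cW cN p nz with coreAt? G i (1 + j)
        ... | no cNW = delay (bit-N cW cNW) (up cNW)
        ... | yes cNW with v , q , l , _ ← hl-elim′ (Core.h₁ cN) p = goW i cW cNW q (link-W l nz)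

        in-range : ∀ i {t} → G (1 + i) (1 + j) ≡ just t → i < w
        in-range i p with i <? w
        ... | yes lt = lt
        ... | no ge with () ← trans (sym p) (dead-at T₀ (east (suc i) (1 + j) (s≤s (≮⇒≥ ge))))

        go0 : ∀ i {t} → ¬ CoreAt G i j → CoreAt G i (1 + j) → G (1 + i) (1 + j) ≡ just t → sx t ≡ nul → Eventually i j
        go0 i {t} c cN p z with coreAt? G (1 + i) j
        ... | no cE = delay (λ n le → trans (bit-side fl c cN p n le) (trans (side-nul {t} z)
                (cong (λ x → if x then B n i (1 + j) else B n (2 + i) (1 + j)) (isCore-false (A n) (1 + i) j (λ d → cE (core-frozen le d))))))
              (at-E (w ∸ suc i) (trans (+-suc i (w ∸ suc i)) (m+[n∸m]≡n (in-range i p))) cE cN p (λ y → nul≢neg (trans (sym z) y)))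
        go0 zero {t} c cN p z | yes cE with _ , q , _ ← any-elim (Core.b₁ cN) with () ← trans (sym q) (dead-at T₀ (west _))
        go0 (suc i) {t} c cN p z | yes cE =
          delay (λ n le → trans (bit-side fl c cN p n le) (trans (side-nul {t} z)
                (cong (λ x → if x then B n (suc i) (1 + j) else B n (3 + i) (1 + j)) (isCore-true (A n) (2 + i) j (frozen-core le cE)))))
            (at-W i (λ cW → c (outward-0 cW cE)) cN p (λ y → nul≢pos (trans (sym z) y)))

        dispatch : CoreAt G i (1 + j) → Eventually i j
        dispatch cN with bottom cN
        ... | tile pos _ _ _ , p = goE (w ∸ i) (m+[n∸m]≡n (<⇒≤ (in-range i p))) c cN p refl
        ... | tile neg _ _ _ , p = goW i c cN p refl
        ... | tile nul _ _ _ , p = go0 i c cN p refl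

-- Ideal structures

incr : ℤ → ℤ
incr (+ n)        = + suc n
incr -[1+ zero ]  = + 0
incr -[1+ suc n ] = -[1+ n ]

-- rel a i = i - a
rel : ℕ → ℕ → ℤ
rel zero    i       = + i
rel (suc a) zero    = -[1+ a ]
rel (suc a) (suc i) = rel a i

rel-suc : ∀ a i → rel a (suc i) ≡ incr (rel a i)
rel-suc zero          i       = refl
rel-suc (suc zero)    zero    = refl
rel-suc (suc (suc a)) zero    = refl
rel-suc (suc a)       (suc i) = rel-suc a i

rel-refl : ∀ a → rel a a ≡ + 0
rel-refl zero    = refl
rel-refl (suc a) = rel-refl a

rel-neg : ∀ a i {m} → rel a i ≡ -[1+ m ] → a ≡ suc m + i
rel-neg (suc a) zero    refl = cong suc (sym (+-identityʳ a))
rel-neg (suc a) (suc i) eq   = trans (cong suc (rel-neg a i eq)) (cong suc (sym (+-suc _ i)))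

rel-≥ : ∀ b {j k} → b + k ≤ j → ∃ λ l → rel b j ≡ + (k + l)
rel-≥ zero    {j} {k} le = j ∸ k , cong +_ (sym (m+[n∸m]≡n le))
rel-≥ (suc b) {suc j} (s≤s le) = rel-≥ b le

rel-< : ∀ {b j} → j < b → ∃ λ m → rel b j ≡ -[1+ m ]
rel-< {suc b} {zero}  _        = b , refl
rel-< {suc b} {suc j} (s≤s lt) = rel-< lt

rel-bound : ∀ a i {r} → a ≤ i + r → i ≤ a + r → ∣ rel a i ∣ ≤ r
rel-bound zero    i       _  le = le
rel-bound (suc a) zero    le _  = le
rel-bound (suc a) (suc i) (s≤s le) (s≤s le′) = rel-bound a i le le′

abs-incr : ∀ m → ∣ incr -[1+ m ] ∣ ≡ m
abs-incr zero    = refl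
abs-incr (suc m) = refl

sgn : ℤ → Sg
sgn (+ zero)  = nul
sgn (+ suc n) = pos
sgn -[1+ n ]  = neg

link-incr : ∀ d → Link (sgn d) (sgn (incr d))
link-incr (+ zero)     = nul-pos
link-incr (+ suc n)    = pos-pos
link-incr -[1+ zero ]  = neg-nul
link-incr -[1+ suc n ] = neg-neg

module Ideal (M : Machine) (κ₁ κ₂ : ℕ) where
  open Machine M
  open Tiles M

  stateAt : ℕ → Q
  stateAt k = proj₁ (conf k (q₀ , inputs κ₁ κ₂))

  countAt : ℕ → Fin K → ℕ
  countAt k = proj₂ (conf k (q₀ , inputs κ₁ κ₂))

  stθ : ℤ → Q
  stθ (+ k)    = stateAt k
  -- No computation takes place below the base row; any constant state passes the checks there.
  stθ -[1+ _ ] = q₀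

  bitsθ : ℤ → ℤ → Vec Bool K
  bitsθ (+ zero)  (+ k) = row 0 (countAt k)
  bitsθ -[1+ m ]  (+ k) = row (suc m) (countAt k)
  bitsθ _         _     = replicate K false

  Θ : ℤ → ℤ → Tile
  Θ d e = tile (sgn d) (sgn e) (stθ e) (bitsθ d e)

  hlθ : ∀ d e → HL (Θ d e) (Θ (incr d) e)
  hlθ d e = link-incr d , refl

  vlθ : ∀ d e → VL (Θ d e) (Θ d (incr e))
  vlθ d e = link-incr e , refl

  -- The shape closed under the checks. The critical ones look south-west from the upper left
  -- quadrant, which keeps the sum, and west along an input arm, which stays inside once `R` is at
  -- least the inputs.
  InDiamond : ℕ → ℤ → ℤ → Set
  InDiamond R d e = ∣ d ∣ + ∣ e ∣ ≤ R

  <ᵇ-step : ∀ m c → (m <ᵇ c) ≡ false → (∀ m′ → m ≡ suc m′ → (m′ <ᵇ c) ≡ true) → m ≡ c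
  <ᵇ-step zero    zero    _ _ = refl
  <ᵇ-step (suc m) zero    _ h with () ← h m refl
  <ᵇ-step (suc m) (suc c) f h = cong suc (<ᵇ-step m c f (λ { m′ refl → h (suc m′) refl }))

  <ᵇ-pred : ∀ m c → (suc m <ᵇ c) ≡ true → (m <ᵇ c) ≡ true
  <ᵇ-pred zero    (suc c) _ = refl
  <ᵇ-pred (suc m) (suc c) t = <ᵇ-pred m c t

  <ᵇ-< : ∀ m c → (m <ᵇ c) ≡ true → m < c
  <ᵇ-< zero    (suc c) _ = s≤s z≤n
  <ᵇ-< (suc m) (suc c) t = s≤s (<ᵇ-< m c t)

  input-bit : ∀ m k → lookup (row m (inputs κ₁ κ₂)) k ≡ (m <ᵇ inputs κ₁ κ₂ k)
  input-bit m k = lookup∘tabulate (λ k → m <ᵇ inputs κ₁ κ₂ k) k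

  shrink : ∀ m → ∣ incr -[1+ m ] ∣ ≤ suc m
  shrink m = ≤-trans (≤-reflexive (abs-incr m)) (n≤1+n m)

  module OkΘ (R : ℕ) (κ≤ : ∀ (k : Fin K) → inputs κ₁ κ₂ k ≤ R) (sw s se w ea n : Maybe Tile) (off : Fin K → Maybe Tile) where

    record Nbrs (d e : ℤ) : Set where
      field
        here : InDiamond R (incr d) (incr e)
        hSW  : InDiamond R d e → sw ≡ just (Θ d e)
        hS   : InDiamond R (incr d) e → s ≡ just (Θ (incr d) e)
        hSE  : InDiamond R (incr (incr d)) e → se ≡ just (Θ (incr (incr d)) e)
        hW   : InDiamond R d (incr e) → w ≡ just (Θ d (incr e))
        hE   : InDiamond R (incr (incr d)) (incr e) → ea ≡ just (Θ (incr (incr d)) (incr e))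
        hN   : InDiamond R (incr d) (incr (incr e)) → n ≡ just (Θ (incr d) (incr (incr e)))
        hO   : ∀ k {m} → incr d ≡ ℤ.- (+ m) → m ≡ inputs κ₁ κ₂ k → incr e ≡ + 0 → off k ≡ just (Θ (+ 0) (+ 0))

    module C (d e : ℤ) = Checks (Θ (incr d) (incr e)) sw s se w ea n off

    okX : ∀ d e → Nbrs d e → C.OkX d e (sgn (incr d))
    okX (+ m)          e N = any-intro (Nbrs.hW N (<⇒≤ (Nbrs.here N))) (hlθ (+ m) (incr e) , refl)
    okX -[1+ zero ]    e N = tt
    okX -[1+ suc m ]   e N = any-intro (Nbrs.hE N (≤-trans (+-monoˡ-≤ _ (shrink m)) (Nbrs.here N))) (hlθ -[1+ m ] (incr e) , refl)

    okY : ∀ d e → Nbrs d e → C.OkY d e (sgn (incr e))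
    okY d (+ m)        N = any-intro (Nbrs.hS N (<⇒≤ (subst (_≤ R) (+-suc _ m) (Nbrs.here N)))) (vlθ (incr d) (+ m))
    okY d -[1+ zero ]  N = tt
    okY d -[1+ suc m ] N = any-intro (Nbrs.hN N (≤-trans (+-monoʳ-≤ ∣ incr d ∣ (shrink m)) (Nbrs.here N))) (vlθ (incr d) -[1+ m ])

    okC : ∀ d e → Nbrs d e → C.OkC d e (sgn (incr d))
    okC (+ _)        e            N = tt
    okC -[1+ zero ]  (+ k)        N =
      any-intro (Nbrs.hS N (≤-trans (n≤1+n k) h))
        (any-intro (Nbrs.hSW N h) (hlθ -[1+ 0 ] (+ k) , some (sym (newBits-row (stateAt k) 0 (countAt k)))) , λ _ → refl)
      where h = Nbrs.here N
    okC -[1+ zero ]  -[1+ suc l ] N = tt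
    okC -[1+ zero ]  -[1+ zero ]  N = some row₀ , λ _ → refl
      where
      row₀ : C.Row₀ -[1+ zero ] -[1+ zero ] (replicate K true)
      row₀ k = (λ b → lookup-replicate k true , any-intro (Nbrs.hW N (≤-trans (<ᵇ-< 0 _ (trans (sym (input-bit 0 k)) b)) (κ≤ k))) (hlθ -[1+ 0 ] (+ 0)))
             , (λ b _ → any-intro (Nbrs.hO N k {0} refl (<ᵇ-step 0 _ (trans (sym (input-bit 0 k)) b) (λ _ ())) refl) (refl , refl))
    okC -[1+ suc m ] (+ k)        N =
      any-intro (Nbrs.hS N (≤-trans (+-monoʳ-≤ (suc m) (n≤1+n k)) h))
        (any-intro (Nbrs.hSW N (subst (_≤ R) (+-suc (suc m) k) h)) (hlθ -[1+ suc m ] (+ k) ,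
           any-intro (trans (cong (Maybe.map bits) (Nbrs.hSE N (≤-trans (+-mono-≤ (shrink m) (n≤1+n k)) h))) (cong just (inn m)))
                     (sym (newBits-row (stateAt k) (suc m) (countAt k)))) , λ ())
      where
      h = Nbrs.here N
      inn : ∀ m → bitsθ (incr -[1+ m ]) (+ k) ≡ row m (countAt k)
      inn zero    = refl
      inn (suc m) = refl
    okC -[1+ suc m ] -[1+ suc l ] N = tt
    okC -[1+ suc m ] -[1+ zero ]  N =
      any-intro (trans (cong (Maybe.map bits) (Nbrs.hE N (≤-trans (+-monoˡ-≤ 0 (shrink m)) (Nbrs.here N)))) (cong just (inn m))) row₀ , λ ()
      where
      inn : ∀ m → bitsθ (incr -[1+ m ]) (+ 0) ≡ row m (inputs κ₁ κ₂)
      inn zero    = refl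
      inn (suc m) = refl
      row₀ : C.Row₀ -[1+ suc m ] -[1+ zero ] (row m (inputs κ₁ κ₂))
      row₀ k = (λ b → let t = trans (sym (input-bit (suc m) k)) b in
                      trans (input-bit m k) (<ᵇ-pred m (inputs κ₁ κ₂ k) t) ,
                      any-intro (Nbrs.hW N (subst (_≤ R) (sym (+-identityʳ _)) (≤-trans (<ᵇ-< (suc m) _ t) (κ≤ k)))) (hlθ -[1+ suc m ] (+ 0)))
             , (λ b b′ → any-intro (Nbrs.hO N k {suc m} refl (<ᵇ-step (suc m) _ (trans (sym (input-bit (suc m) k)) b)
                                                                 (λ { m′ refl → trans (sym (input-bit m k)) b′ })) refl) (refl , refl))

    okθ : ∀ d e → Nbrs d e → C.Ok d e
    okθ d e N = okX d e N , okY d e N , okC d e N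

-- Persistence of ideal diamonds

rel-0 : ∀ a → ∣ rel a 0 ∣ ≡ a
rel-0 zero    = refl
rel-0 (suc a) = refl

rel-arm : ∀ a i m → rel a i ≡ ℤ.- (+ m) → rel a (m + i) ≡ + 0
rel-arm a i zero    eq = eq
rel-arm a i (suc m) eq = subst (λ x → rel x (suc m + i) ≡ + 0) (sym (rel-neg a i eq)) (rel-refl (suc m + i))

Win : ℕ → ℕ → ℕ → Set
Win c r i = c ≤ i + r × i ≤ c + r

module Persistence (M : Machine) (β : Sg → Machine.Q M → Bool) (flag : Bool) (κ₁ κ₂ : ℕ) where
  open Machine M
  open Automaton M β flag
  open Ideal M κ₁ κ₂

  module Centred (a b R : ℕ) (R<a : R < a) (R<b : R < b) (κ≤ : ∀ (k : Fin K) → inputs κ₁ κ₂ k ≤ R) where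

    Agree : Grid → Set
    Agree A = ∀ i j → InDiamond R (rel a i) (rel b j) → A i j ≡ just (Θ (rel a i) (rel b j))

    agree-at : ∀ {A} → Agree A → ∀ i j {d e} → rel a i ≡ d → rel b j ≡ e → InDiamond R d e → A i j ≡ just (Θ d e)
    agree-at h i j refl refl = h i j

    -- Each check inside the diamond relies only on cells of the diamond, so its tiles pass at every
    -- step, whatever happens outside.
    persist : (T : Trajectory κ₁ κ₂) → Agree (Trajectory.A T 0) → ∀ n → Agree (Trajectory.A T n)
    persist T h zero = h
    persist T h (suc n) zero j le = contradiction (≤-trans (≤-trans (≤-reflexive (sym (rel-0 a))) (m≤m+n _ _)) le) (<⇒≱ R<a)
    persist T h (suc n) (suc i) zero le = contradiction (≤-trans (≤-trans (≤-reflexive (sym (rel-0 b))) (m≤n+m _ _)) le) (<⇒≱ R<b)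
    persist T h (suc n) (suc i) (suc j) le =
      trans (stepA n i j) (subst₂ (λ d e → nextAt κ₁ κ₂ (A n) i j ≡ just (Θ d e)) (sym r1) (sym s1)
        (nextAt-keeps κ₁ κ₂ {A n} {i} {j} self (okθ (rel a i) (rel b j) nbrs)))
      where
      open Trajectory T
      r1 : rel a (1 + i) ≡ incr (rel a i)
      r1 = rel-suc a i
      s1 : rel b (1 + j) ≡ incr (rel b j)
      s1 = rel-suc b j
      r2 : rel a (2 + i) ≡ incr (incr (rel a i))
      r2 = trans (rel-suc a (suc i)) (cong incr r1)
      s2 : rel b (2 + j) ≡ incr (incr (rel b j))
      s2 = trans (rel-suc b (suc j)) (cong incr s1)
      ih : ∀ i j {d e} → rel a i ≡ d → rel b j ≡ e → InDiamond R d e → A n i j ≡ just (Θ d e)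
      ih = agree-at (persist T h n)
      t : Tile
      t = Θ (incr (rel a i)) (incr (rel b j))
      here : InDiamond R (incr (rel a i)) (incr (rel b j))
      here = subst₂ (InDiamond R) r1 s1 le
      self : A n (1 + i) (1 + j) ≡ just t
      self = ih (1 + i) (1 + j) r1 s1 here
      open OkΘ R κ≤ (A n i j) (A n (1 + i) j) (A n (2 + i) j) (A n i (1 + j)) (A n (2 + i) (1 + j)) (A n (1 + i) (2 + j))
                    (offs (A n (κ₁ + suc i) (1 + j)) (A n (κ₂ + suc i) (1 + j)) (just t))
      nbrs : Nbrs (rel a i) (rel b j)
      nbrs = record
        { here = here
        ; hSW = ih i j refl refl ; hS = ih (1 + i) j r1 refl ; hSE = ih (2 + i) j r2 refl
        ; hW = ih i (1 + j) refl s1 ; hE = ih (2 + i) (1 + j) r2 s1 ; hN = ih (1 + i) (2 + j) r1 s2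
        ; hO = λ { k {m} p refl q → trans (offs-at κ₁ κ₂ (A n) (1 + i) (1 + j) self k)
                     (ih (inputs κ₁ κ₂ k + suc i) (1 + j) (rel-arm a (suc i) m (trans r1 p)) (trans s1 q) z≤n) } }

    Blocked : ℕ → Set
    Blocked j = β (sgn (rel b j)) (stθ (rel b j)) ≡ true

    core-ideal : ∀ {A i j} → Agree A → (∀ x y → x ≤ 2 → y ≤ 2 → InDiamond R (rel a (x + i)) (rel b (y + j))) →
                 (∀ y → y ≤ 2 → Blocked (y + j)) → CoreAt A i j
    core-ideal {A} {i} {j} h D blk = core
      (hl 0 0 (s≤s z≤n) z≤n) (hl 0 1 (s≤s z≤n) (s≤s z≤n)) (hl 0 2 (s≤s z≤n) ≤-refl)
      (hl 1 0 ≤-refl z≤n) (hl 1 1 ≤-refl (s≤s z≤n)) (hl 1 2 ≤-refl ≤-refl)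
      (vl 0 0 z≤n (s≤s z≤n)) (vl 0 1 z≤n ≤-refl) (vl 1 0 (s≤s z≤n) (s≤s z≤n)) (vl 1 1 (s≤s z≤n) ≤-refl) (vl 2 0 ≤-refl (s≤s z≤n)) (vl 2 1 ≤-refl ≤-refl)
      (bl 0 0 z≤n z≤n) (bl 0 1 z≤n (s≤s z≤n)) (bl 0 2 z≤n ≤-refl)
      (bl 1 0 (s≤s z≤n) z≤n) (bl 1 1 (s≤s z≤n) (s≤s z≤n)) (bl 1 2 (s≤s z≤n) ≤-refl)
      (bl 2 0 ≤-refl z≤n) (bl 2 1 ≤-refl (s≤s z≤n)) (bl 2 2 ≤-refl ≤-refl)
      where
      value : ∀ x y → x ≤ 2 → y ≤ 2 → A (x + i) (y + j) ≡ just (Θ (rel a (x + i)) (rel b (y + j)))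
      value x y p q = h (x + i) (y + j) (D x y p q)
      hl : ∀ x y → suc x ≤ 2 → y ≤ 2 → HLm (A (x + i) (y + j)) (A (suc x + i) (y + j))
      hl x y p q = any-intro (value x y (<⇒≤ p) q) (any-intro (value (suc x) y p q)
        (subst (λ d → HL (Θ (rel a (x + i)) (rel b (y + j))) (Θ d (rel b (y + j)))) (sym (rel-suc a (x + i))) (hlθ (rel a (x + i)) (rel b (y + j)))))
      vl : ∀ x y → x ≤ 2 → suc y ≤ 2 → VLm (A (x + i) (y + j)) (A (x + i) (suc y + j))
      vl x y p q = any-intro (value x y p (<⇒≤ q)) (any-intro (value x (suc y) p q)
        (subst (λ e → VL (Θ (rel a (x + i)) (rel b (y + j))) (Θ (rel a (x + i)) e)) (sym (rel-suc b (y + j))) (vlθ (rel a (x + i)) (rel b (y + j)))))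
      bl : ∀ x y → x ≤ 2 → y ≤ 2 → Bm (A (x + i) (y + j))
      bl x y p q = any-intro (value x y p q) (blk y q)

  module _ (T : Trajectory κ₁ κ₂) where
    open Trajectory T

    bit-core : ∀ n i j → CoreAt (A n) i j → B (suc n) (suc i) (suc j) ≡ false
    bit-core n i j c = trans (stepB n i j)
      (cong (λ c → nextBit (A n (1 + i) (1 + j)) c (isCore (A n) i (1 + j)) (isCore (A n) (1 + i) j) (B n (1 + i) (2 + j)) (B n (2 + i) (1 + j)) (B n i (1 + j)))
        (isCore-true (A n) i j c))

    bit-flag : flag ≡ false → ∀ n i j → B (suc n) (suc i) (suc j) ≡
      (if isCore (A n) i j then false else if not (isCore (A n) i (1 + j)) then B n (1 + i) (2 + j) else false)
    bit-flag f n i j = trans (stepB n i j)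
      (cong (λ f → if isCore (A n) i j then false else if not (isCore (A n) i (1 + j)) then B n (1 + i) (2 + j) else
                   (if f then side (A n (1 + i) (1 + j)) (isCore (A n) (1 + i) j) (B n (2 + i) (1 + j)) (B n i (1 + j)) else false)) f)

  module _ (X Y : Trajectory κ₁ κ₂) where
    private
      module X = Trajectory X
      module Y = Trajectory Y

    Same : ℕ → ℕ → ℕ → Set
    Same n i j = ∀ x y → x ≤ 2 → y ≤ 2 → X.A n (x + i) (y + j) ≡ Y.A n (x + i) (y + j)

    isCore-same : ∀ n i j → Same n i j → isCore (X.A n) i j ≡ isCore (Y.A n) i j
    isCore-same n i j s
      rewrite s 0 0 z≤n z≤n | s 0 1 z≤n (s≤s z≤n) | s 0 2 z≤n ≤-refl
            | s 1 0 (s≤s z≤n) z≤n | s 1 1 (s≤s z≤n) (s≤s z≤n) | s 1 2 (s≤s z≤n) ≤-refl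
            | s 2 0 ≤-refl z≤n | s 2 1 ≤-refl (s≤s z≤n) | s 2 2 ≤-refl ≤-refl = refl

    -- `W` has to be closed under the origin of bits: a cell of `W` is a core and gets 0, or lies
    -- under a core and gets 0 for want of detours, or copies a cell of `W`.
    agree-bits : (W : ℕ → ℕ → Set) → (∀ i j → W i j → X.B 0 (suc i) (suc j) ≡ Y.B 0 (suc i) (suc j)) →
      (∀ n i j → W i j → (CoreAt (X.A n) i j × CoreAt (Y.A n) i j) ⊎
         (flag ≡ false × Same n i j × Same n i (1 + j) × (CoreAt (X.A n) i (1 + j) ⊎ W i (1 + j)))) →
      ∀ n i j → W i j → X.B n (suc i) (suc j) ≡ Y.B n (suc i) (suc j)
    agree-bits W h₀ h zero i j m = h₀ i j m
    agree-bits W h₀ h (suc n) i j m with h n i j m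
    ... | inj₁ (cX , cY) = trans (bit-core X n i j cX) (sym (bit-core Y n i j cY))
    ... | inj₂ (f , s , sN , north) = trans (bit-flag X f n i j) (trans (begin
        (if isCore (X.A n) i j then false else if not (isCore (X.A n) i (1 + j)) then X.B n (1 + i) (2 + j) else false)
          ≡⟨ cong (λ z → if isCore (X.A n) i j then false else z) (above north) ⟩
        (if isCore (X.A n) i j then false else if not (isCore (X.A n) i (1 + j)) then Y.B n (1 + i) (2 + j) else false)
          ≡⟨ cong₂ (λ c cN → if c then false else if not cN then Y.B n (1 + i) (2 + j) else false) (isCore-same n i j s) (isCore-same n i (1 + j) sN) ⟩
        (if isCore (Y.A n) i j then false else if not (isCore (Y.A n) i (1 + j)) then Y.B n (1 + i) (2 + j) else false) ∎)
        (sym (bit-flag Y f n i j)))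
      where
      open ≡-Reasoning
      above : CoreAt (X.A n) i (1 + j) ⊎ W i (1 + j) →
        (if not (isCore (X.A n) i (1 + j)) then X.B n (1 + i) (2 + j) else false) ≡
        (if not (isCore (X.A n) i (1 + j)) then Y.B n (1 + i) (2 + j) else false)
      above (inj₁ c) = trans (cong (λ z → if not z then X.B n (1 + i) (2 + j) else false) (isCore-true (X.A n) i (1 + j) c))
                        (cong (λ z → if not z then Y.B n (1 + i) (2 + j) else false) (sym (isCore-true (X.A n) i (1 + j) c)))
      above (inj₂ m) = cong (λ z → if not (isCore (X.A n) i (1 + j)) then z else false) (agree-bits W h₀ h n i (1 + j) m)

-- The automaton and its dynamics

⊕-cellOf : ∀ {d} (u v : ℤ) (rest : Cell d) x y → (u ∷ v ∷ rest) ⊕ cellOf d (x , y) ≡ (u ℤ.+ x) ∷ (v ℤ.+ y) ∷ rest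
⊕-cellOf u v rest x y = cong (λ z → (u ℤ.+ x) ∷ (v ℤ.+ y) ∷ z) (zip rest)
  where
  zip : ∀ {d} (r : Cell d) → r ⊕ replicate d (+ 0) ≡ r
  zip []      = refl
  zip (z ∷ r) = cong₂ _∷_ (ℤₚ.+-identityʳ z) (zip r)

map-offsets : ∀ {A : Set} (g : ℤ × ℤ → A) k l → List.map g (offsets k l) ≡
  g (+ k , + 0) ∷ g (+ l , + 0) ∷
  g (-[1+ 0 ] , -[1+ 0 ]) ∷ g (-[1+ 0 ] , + 0) ∷ g (-[1+ 0 ] , + 1) ∷ g (-[1+ 0 ] , + 2) ∷
  g (+ 0 , -[1+ 0 ]) ∷ g (+ 0 , + 0) ∷ g (+ 0 , + 1) ∷ g (+ 0 , + 2) ∷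
  g (+ 1 , -[1+ 0 ]) ∷ g (+ 1 , + 0) ∷ g (+ 1 , + 1) ∷ g (+ 1 , + 2) ∷
  g (+ 2 , -[1+ 0 ]) ∷ g (+ 2 , + 0) ∷ g (+ 2 , + 1) ∷ g (+ 2 , + 2) ∷ []
map-offsets g k l = refl

translate : ∀ o i k → (o ℤ.+ + i) ℤ.+ + k ≡ o ℤ.+ + (k + i)
translate o i k = trans (ℤₚ.+-assoc o (+ i) (+ k)) (cong (λ z → o ℤ.+ + z) (+-comm i k))

translate⁻ : ∀ o i → (o ℤ.+ + suc i) ℤ.+ -[1+ 0 ] ≡ o ℤ.+ + i
translate⁻ o i = ℤₚ.+-assoc o (+ suc i) -[1+ 0 ]

module Rule (M : Machine) (β : Sg → Machine.Q M → Bool) (flag : Bool) where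
  open Machine M
  open Automaton M β flag

  State : Set
  State = Maybe Tile × Bool

  opaque
    State-enum : Enum State
    State-enum = ×-enum (Maybe-enum Tile-enum) Bool-enum

  open Enum State-enum renaming (size to alphabet) public

  updated : (k l w₀₀ w₀₁ w₀₂ w₀₃ w₁₀ w₁₁ w₁₂ w₁₃ w₂₀ w₂₁ w₂₂ w₂₃ w₃₀ w₃₁ w₃₂ w₃₃ : State) → State
  updated (k , _) (l , _) (w₀₀ , _) (w₀₁ , bW) (w₀₂ , _) (w₀₃ , _) (w₁₀ , _) (w₁₁ , _) (w₁₂ , bN) (w₁₃ , _)
            (w₂₀ , _) (w₂₁ , bE) (w₂₂ , _) (w₂₃ , _) (w₃₀ , _) (w₃₁ , _) (w₃₂ , _) (w₃₃ , _) =
    next w₁₁ w₀₀ w₁₀ w₂₀ w₀₁ w₂₁ w₁₂ k l ,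
    nextBit w₁₁ (isCore₉ w₀₀ w₀₁ w₀₂ w₁₀ w₁₁ w₁₂ w₂₀ w₂₁ w₂₂) (isCore₉ w₀₁ w₀₂ w₀₃ w₁₁ w₁₂ w₁₃ w₂₁ w₂₂ w₂₃)
            (isCore₉ w₁₀ w₁₁ w₁₂ w₂₀ w₂₁ w₂₂ w₃₀ w₃₁ w₃₂) bN bE bW

  opaque
    rule : List State → State
    rule (k ∷ l ∷ w₀₀ ∷ w₀₁ ∷ w₀₂ ∷ w₀₃ ∷ w₁₀ ∷ w₁₁ ∷ w₁₂ ∷ w₁₃ ∷ w₂₀ ∷ w₂₁ ∷ w₂₂ ∷ w₂₃ ∷ w₃₀ ∷ w₃₁ ∷ w₃₂ ∷ w₃₃ ∷ []) =
      updated k l w₀₀ w₀₁ w₀₂ w₀₃ w₁₀ w₁₁ w₁₂ w₁₃ w₂₀ w₂₁ w₂₂ w₂₃ w₃₀ w₃₁ w₃₂ w₃₃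
    rule _ = nothing , false

    rule-next : ∀ k l w₀₀ w₀₁ w₀₂ w₀₃ w₁₀ w₁₁ w₁₂ w₁₃ w₂₀ w₂₁ w₂₂ w₂₃ w₃₀ w₃₁ w₃₂ w₃₃ →
      rule (k ∷ l ∷ w₀₀ ∷ w₀₁ ∷ w₀₂ ∷ w₀₃ ∷ w₁₀ ∷ w₁₁ ∷ w₁₂ ∷ w₁₃ ∷ w₂₀ ∷ w₂₁ ∷ w₂₂ ∷ w₂₃ ∷ w₃₀ ∷ w₃₁ ∷ w₃₂ ∷ w₃₃ ∷ []) ≡
      updated k l w₀₀ w₀₁ w₀₂ w₀₃ w₁₀ w₁₁ w₁₂ w₁₃ w₂₀ w₂₁ w₂₂ w₂₃ w₃₀ w₃₁ w₃₂ w₃₃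
    rule-next k l w₀₀ w₀₁ w₀₂ w₀₃ w₁₀ w₁₁ w₁₂ w₁₃ w₂₀ w₂₁ w₂₂ w₂₃ w₃₀ w₃₁ w₃₂ w₃₃ = refl

  localMap : List (Fin (suc alphabet)) → Fin (suc alphabet)
  localMap w = enc (rule (List.map dec w))

  module _ (d κ₁ κ₂ : ℕ) where

    ca : CADesc (2 + d)
    ca = mkCA alphabet (List.map (cellOf d) (offsets κ₁ κ₂)) (tableOf alphabet localMap 18)

    opaque
      F : Config (2 + d) alphabet → Config (2 + d) alphabet
      F = global ca

      F-global : F ≡ global ca
      F-global = refl

      F-enc : ∀ x m → F x m ≡ enc (rule (List.map (λ o → dec (x (m ⊕ cellOf d o))) (offsets κ₁ κ₂)))
      F-enc x m = trans (global-table alphabet (List.map (cellOf d) (offsets κ₁ κ₂)) localMap x m) (cong (enc ∘ rule)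
        (trans (sym (map-∘ {g = dec} {f = λ u → x (m ⊕ u)} (List.map (cellOf d) (offsets κ₁ κ₂))))
               (sym (map-∘ {g = λ u → dec (x (m ⊕ u))} {f = cellOf d} (offsets κ₁ κ₂)))))

    F-rule : ∀ x m → dec (F x m) ≡ rule (List.map (λ o → dec (x (m ⊕ cellOf d o))) (offsets κ₁ κ₂))
    F-rule x m = trans (cong dec (F-enc x m)) (dec-enc _)

    module _ (x : Config (2 + d) alphabet) (o₁ o₂ : ℤ) (rest : Cell d) where

      cellAt : ℕ → ℕ → Cell (2 + d)
      cellAt i j = (o₁ ℤ.+ + i) ∷ (o₂ ℤ.+ + j) ∷ rest

      stateOf : ℕ → ℕ → ℕ → State
      stateOf n i j = dec (iter F n x (cellAt i j))

      window : (ℕ → ℕ → State) → ℕ → ℕ → List State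
      window S i j = S (κ₁ + suc i) (1 + j) ∷ S (κ₂ + suc i) (1 + j) ∷
        S i j ∷ S i (1 + j) ∷ S i (2 + j) ∷ S i (3 + j) ∷
        S (1 + i) j ∷ S (1 + i) (1 + j) ∷ S (1 + i) (2 + j) ∷ S (1 + i) (3 + j) ∷
        S (2 + i) j ∷ S (2 + i) (1 + j) ∷ S (2 + i) (2 + j) ∷ S (2 + i) (3 + j) ∷
        S (3 + i) j ∷ S (3 + i) (1 + j) ∷ S (3 + i) (2 + j) ∷ S (3 + i) (3 + j) ∷ []

      module _ (n i j : ℕ) where
        private
          g : ℤ × ℤ → State
          g o = dec (iter F n x (cellAt (suc i) (suc j) ⊕ cellOf d o))

          at : ∀ p q i′ j′ → (o₁ ℤ.+ + suc i) ℤ.+ p ≡ o₁ ℤ.+ + i′ → (o₂ ℤ.+ + suc j) ℤ.+ q ≡ o₂ ℤ.+ + j′ → g (p , q) ≡ stateOf n i′ j′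
          at p q i′ j′ e e′ = cong (λ m → dec (iter F n x m))
            (trans (⊕-cellOf (o₁ ℤ.+ + suc i) (o₂ ℤ.+ + suc j) rest p q) (cong₂ (λ u v → u ∷ v ∷ rest) e e′))

          infixr 5 _∷≡_
          _∷≡_ : ∀ {s t : State} {ss ts : List State} → s ≡ t → ss ≡ ts → _≡_ {A = List State} (s ∷ ss) (t ∷ ts)
          p ∷≡ q = cong₂ List._∷_ p q

          column : ∀ p i′ → (o₁ ℤ.+ + suc i) ℤ.+ p ≡ o₁ ℤ.+ + i′ → ∀ {ss ts : List State} → ss ≡ ts →
            _≡_ {A = List State} (g (p , -[1+ 0 ]) ∷ g (p , + 0) ∷ g (p , + 1) ∷ g (p , + 2) ∷ ss)
            (stateOf n i′ j ∷ stateOf n i′ (1 + j) ∷ stateOf n i′ (2 + j) ∷ stateOf n i′ (3 + j) ∷ ts)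
          column p i′ e es = at p -[1+ 0 ] i′ j e (translate⁻ o₂ j) ∷≡ at p (+ 0) i′ (1 + j) e (translate o₂ (suc j) 0) ∷≡
            at p (+ 1) i′ (2 + j) e (translate o₂ (suc j) 1) ∷≡ at p (+ 2) i′ (3 + j) e (translate o₂ (suc j) 2) ∷≡ es

        window-eq : List.map g (offsets κ₁ κ₂) ≡ window (stateOf n) i j
        window-eq = trans (map-offsets g κ₁ κ₂) (
          at (+ κ₁) (+ 0) (κ₁ + suc i) (1 + j) (translate o₁ (suc i) κ₁) (translate o₂ (suc j) 0) ∷≡
          at (+ κ₂) (+ 0) (κ₂ + suc i) (1 + j) (translate o₁ (suc i) κ₂) (translate o₂ (suc j) 0) ∷≡
          column -[1+ 0 ] i (translate⁻ o₁ i) (column (+ 0) (1 + i) (translate o₁ (suc i) 0)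
            (column (+ 1) (2 + i) (translate o₁ (suc i) 1) (column (+ 2) (3 + i) (translate o₁ (suc i) 2) {[]} refl))))

        stateOf-step : let S = stateOf n in stateOf (suc n) (suc i) (suc j) ≡
          updated (S (κ₁ + suc i) (1 + j)) (S (κ₂ + suc i) (1 + j))
            (S i j) (S i (1 + j)) (S i (2 + j)) (S i (3 + j))
            (S (1 + i) j) (S (1 + i) (1 + j)) (S (1 + i) (2 + j)) (S (1 + i) (3 + j))
            (S (2 + i) j) (S (2 + i) (1 + j)) (S (2 + i) (2 + j)) (S (2 + i) (3 + j))
            (S (3 + i) j) (S (3 + i) (1 + j)) (S (3 + i) (2 + j)) (S (3 + i) (3 + j))
        stateOf-step = trans (trans (F-rule (iter F n x) (cellAt (suc i) (suc j))) (cong rule {x = List.map g (offsets κ₁ κ₂)} {y = window (stateOf n) i j} window-eq))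
          (rule-next _ _ _ _ _ _ _ _ _ _ _ _ _ _ _ _ _ _)

      stateOf-dies : ∀ n i j → proj₁ (stateOf n i j) ≡ nothing → proj₁ (stateOf (suc n) i j) ≡ nothing
      stateOf-dies n i j eq = trans (cong proj₁ (trans (F-rule (iter F n x) (cellAt i j)) (rule-next _ _ _ _ _ _ _ _ _ _ _ _ _ _ _ _ _ _)))
        (next-nothing (trans (cong (λ m → proj₁ (dec (iter F n x m)))
          (trans (⊕-cellOf (o₁ ℤ.+ + i) (o₂ ℤ.+ + j) rest (+ 0) (+ 0)) (cong₂ (λ u v → u ∷ v ∷ rest) (ℤₚ.+-identityʳ _) (ℤₚ.+-identityʳ _)))) eq))
        where
        next-nothing : ∀ {c sw s se w e n k l} → c ≡ nothing → next c sw s se w e n k l ≡ nothing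
        next-nothing refl = refl

      trajectory : Trajectory κ₁ κ₂
      trajectory = record
        { A = λ n i j → proj₁ (stateOf n i j)
        ; B = λ n i j → proj₂ (stateOf n i j)
        ; stepA = λ n i j → cong proj₁ (stateOf-step n i j)
        ; stepB = λ n i j → cong proj₂ (stateOf-step n i j)
        ; dies = stateOf-dies }

rel-⊖ : ∀ a i → rel a i ≡ i ℤ.⊖ a
rel-⊖ zero    i       = refl
rel-⊖ (suc a) zero    = refl
rel-⊖ (suc a) (suc i) = trans (rel-⊖ a i) (sym (ℤₚ.[1+m]⊖[1+n]≡m⊖n i a))

rel-ℤ : ∀ a i → rel a i ≡ ℤ.- (+ a) ℤ.+ + i
rel-ℤ a i = trans (rel-⊖ a i) (sym (ℤₚ.-m+n≡n⊖m a i))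

rel-win : ∀ a i {r} → ∣ rel a i ∣ ≤ r → Win a r i
rel-win zero    i       le = z≤n , le
rel-win (suc a) zero    le = le , z≤n
rel-win (suc a) (suc i) le = let p , q = rel-win a i le in s≤s p , s≤s q

win-mono : ∀ {c r s i} → r ≤ s → Win c r i → Win c s i
win-mono {c} {i = i} le (p , q) = ≤-trans p (+-monoʳ-≤ i le) , ≤-trans q (+-monoʳ-≤ c le)

rel-+ : ∀ c n → rel c (c + n) ≡ + n
rel-+ zero    n = refl
rel-+ (suc c) n = rel-+ c n

rel-- : ∀ n k → rel (suc n + k) k ≡ -[1+ n ]
rel-- n zero    = cong -[1+_] (+-identityʳ n)
rel-- n (suc k) = trans (cong (λ z → rel z (suc k)) (+-suc (suc n) k)) (rel-- n k)

place : ∀ u {r c} → ∣ u ∣ ≤ r → r < c → ∃ λ i → u ≡ ℤ.- (+ c) ℤ.+ + suc i × Win c r (suc i)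
place u {r} {c} le lt = go u le
  where
  found : ∀ i {u} → rel c i ≡ u → ∣ u ∣ ≤ r → ∃ λ i → u ≡ ℤ.- (+ c) ℤ.+ + suc i × Win c r (suc i)
  found zero    eq le = contradiction (≤-trans (≤-reflexive (trans (sym (rel-0 c)) (cong ∣_∣ eq))) le) (<⇒≱ lt)
  found (suc i) eq le = i , trans (sym eq) (rel-ℤ c (suc i)) , rel-win c (suc i) (subst (λ z → ∣ z ∣ ≤ r) (sym eq) le)
  go : ∀ u → ∣ u ∣ ≤ r → ∃ λ i → u ≡ ℤ.- (+ c) ℤ.+ + suc i × Win c r (suc i)
  go (+ n)    le = found (c + n) (rel-+ c n) le
  go -[1+ n ] le = found (c ∸ suc n) (subst (λ z → rel z (c ∸ suc n) ≡ -[1+ n ]) (m+[n∸m]≡n (≤-trans le (<⇒≤ lt))) (rel-- n (c ∸ suc n))) le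

win-abs : ∀ c i {r} → Win c r i → ∣ ℤ.- (+ c) ℤ.+ + i ∣ ≤ r
win-abs c i {r} (p , q) = subst (λ z → ∣ z ∣ ≤ r) (rel-ℤ c i) (rel-bound c i p q)

win-nine : ∀ {c r i} x → x ≤ 2 → Win c r (suc i) → Win c (suc r) (x + i)
win-nine {c} {r} {i} x le (p , q) =
  ≤-trans p (≤-trans (≤-reflexive (sym (+-suc i r))) (+-monoˡ-≤ (suc r) (m≤n+m i x))) ,
  ≤-trans (+-monoˡ-≤ i le) (≤-trans (s≤s q) (≤-reflexive (sym (+-suc c r))))

module Dynamics (M : Machine) (β : Sg → Machine.Q M → Bool) (flag : Bool) (d κ₁ κ₂ : ℕ) where
  open Machine M
  open Automaton M β flag
  open Rule M β flag
  open Ideal M κ₁ κ₂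
  open Persistence M β flag κ₁ κ₂

  Conf² : Set
  Conf² = Config (2 + d) alphabet

  step² : Conf² → Conf²
  step² = F d κ₁ κ₂

  origin : ℕ → ℤ
  origin c = ℤ.- (+ c)

  state : Conf² → ℕ → Cell d → ℕ → ℕ → ℕ → State
  state x c rest = stateOf d κ₁ κ₂ x (origin c) (origin c) rest

  traj : Conf² → ℕ → Cell d → Trajectory κ₁ κ₂
  traj x c rest = trajectory d κ₁ κ₂ x (origin c) (origin c) rest

  cell : ℕ → Cell d → ℕ → ℕ → Cell (2 + d)
  cell c rest i j = (origin c ℤ.+ + i) ∷ (origin c ℤ.+ + j) ∷ rest

  norm≤ : ∀ {c s i j} {rest : Cell d} → Win c s i → Win c s j → ‖ rest ‖∞ ≤ s → ‖ cell c rest i j ‖∞ ≤ s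
  norm≤ {c} {s} {i} {j} p q le = ⊔-lub (win-abs c i p) (⊔-lub (win-abs c j q) le)

  close⇒state : ∀ {r c n i j} {rest : Cell d} {x y : Conf²} → Close r (iter step² n x) (iter step² n y) →
    Win c r i → Win c r j → ‖ rest ‖∞ ≤ r → state x c rest n i j ≡ state y c rest n i j
  close⇒state {c = c} {i = i} {j} {rest} h p q le = cong dec (h (cell c rest i j) (norm≤ {c} {i = i} {j} {rest} p q le))

  norm-split : ∀ {r u v} {rest : Cell d} → ‖ u ∷ v ∷ rest ‖∞ ≤ r → ∣ u ∣ ≤ r × ∣ v ∣ ≤ r × ‖ rest ‖∞ ≤ r
  norm-split {r} {u} {v} {rest} le =
    let le′ = m⊔n≤o⇒n≤o (∣ u ∣) _ le in m⊔n≤o⇒m≤o (∣ u ∣) _ le , m⊔n≤o⇒m≤o (∣ v ∣) _ le′ , m⊔n≤o⇒n≤o (∣ v ∣) _ le′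

  Robust : Conf² → ℕ → Set
  Robust x r = ∃ λ s → ∀ y → Close s x y → ∀ n → Close r (iter step² n x) (iter step² n y)

  robust : ∀ x {r c s} → r < c →
    (∀ y → Close s x y → ∀ rest → ‖ rest ‖∞ ≤ r → ∀ n i j → Win c r (suc i) → Win c r (suc j) →
       state x c rest n (suc i) (suc j) ≡ state y c rest n (suc i) (suc j)) → Robust x r
  -- At time 0 there may be symbols outside the image of `enc`, which decoded states do not tell
  -- apart. Closeness up to `r` settles that time; from time 1 on `canonical` applies.
  robust x {r} {c} {s} lt h = s ⊔ r , go
    where
    canonical : ∀ (x : Conf²) m → enc (dec (step² x m)) ≡ step² x m
    canonical x m = trans (cong enc (F-rule d κ₁ κ₂ x m)) (sym (F-enc d κ₁ κ₂ x m))
    go : ∀ y → Close (s ⊔ r) x y → ∀ n → Close r (iter step² n x) (iter step² n y)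
    go y cl zero    m le = cl m (≤-trans le (m≤n⊔m s r))
    go y cl (suc n) m@(u ∷ v ∷ rest) le
      with lu , lv , lr ← norm-split {r} {u} {v} {rest} le
      with i , refl , wi ← place u lu lt
      with j , refl , wj ← place v lv lt =
        trans (sym (canonical (iter step² n x) m)) (trans (cong enc (h y (λ m′ le′ → cl m′ (≤-trans le′ (m≤m⊔n s r))) rest lr (suc n) i j wi wj))
          (canonical (iter step² n y) m))

  -- The same ideal diagram in every plane, with all bits 0 and the centre at `(0 , - v)`, so that
  -- the window about the origin lies at height `v`.
  xθ : ℤ → Conf²
  xθ v (i ∷ j ∷ _) = enc (just (Θ i (j ℤ.+ v)) , false)

  module Protect (v : ℤ) (c b r R : ℕ) (v≡ : v ≡ + c ℤ.- + b) (R<c : R < c) (R<b : R < b) (r<c : r < c)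
                 (κ≤ : ∀ (k : Fin K) → inputs κ₁ κ₂ k ≤ R) where
    open Centred c b R R<c R<b κ≤

    s : ℕ
    -- A crude radius about the origin, which has index `c`: it contains the diamond about the
    -- centre as well as the window.
    s = b + R + c + r

    coordinate : ∀ j → (origin c ℤ.+ + j) ℤ.+ v ≡ rel b j
    coordinate j = begin
      (origin c ℤ.+ + j) ℤ.+ v                    ≡⟨ cong (λ z → (origin c ℤ.+ + j) ℤ.+ z) v≡ ⟩
      (origin c ℤ.+ + j) ℤ.+ (+ c ℤ.- + b)        ≡⟨ cong (λ z → z ℤ.+ (+ c ℤ.- + b)) (ℤₚ.+-comm (origin c) (+ j)) ⟩
      (+ j ℤ.+ origin c) ℤ.+ (+ c ℤ.- + b)        ≡⟨ ℤₚ.+-assoc (+ j) (origin c) _ ⟩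
      + j ℤ.+ (origin c ℤ.+ (+ c ℤ.- + b))        ≡⟨ cong (λ z → + j ℤ.+ z) (ℤₚ.+-assoc (origin c) (+ c) (ℤ.- + b)) ⟨
      + j ℤ.+ ((origin c ℤ.+ + c) ℤ.- + b)        ≡⟨ cong (λ z → + j ℤ.+ (z ℤ.- + b)) (ℤₚ.+-inverseˡ (+ c)) ⟩
      + j ℤ.+ (+ 0 ℤ.- + b)                       ≡⟨ cong (λ z → + j ℤ.+ z) (ℤₚ.+-identityˡ (ℤ.- + b)) ⟩
      + j ℤ.- + b                                 ≡⟨ ℤₚ.+-comm (+ j) (ℤ.- + b) ⟩
      ℤ.- + b ℤ.+ + j                             ≡⟨ rel-ℤ b j ⟨
      rel b j                                     ∎
      where open ≡-Reasoning

    initial : ∀ rest i j → state (xθ v) c rest 0 i j ≡ (just (Θ (rel c i) (rel b j)) , false)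
    initial rest i j = trans (dec-enc _) (cong₂ (λ d e → just (Θ d e) , false) (sym (rel-ℤ c i)) (coordinate j))

    near-x : ∀ i → ∣ rel c i ∣ ≤ R → Win c s i
    near-x i le = win-mono {c} {i = i} (≤-trans (m≤n+m R b) (≤-trans (m≤m+n (b + R) c) (m≤m+n (b + R + c) r))) (rel-win c i le)

    near-y : ∀ j → ∣ rel b j ∣ ≤ R → Win c s j
    near-y j le =
      ≤-trans (≤-trans (m≤n+m c (b + R)) (m≤m+n (b + R + c) r)) (m≤n+m s j) ,
      ≤-trans (proj₂ (rel-win b j le)) (≤-trans (≤-trans (m≤m+n (b + R) c) (m≤m+n (b + R + c) r)) (m≤n+m s c))

    module _ (y : Conf²) (close : Close s (xθ v) y) (rest : Cell d) (small : ‖ rest ‖∞ ≤ r) where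
      X Y : Trajectory κ₁ κ₂
      X = traj (xθ v) c rest
      Y = traj y c rest

      start-same : ∀ i j → Win c s i → Win c s j → state (xθ v) c rest 0 i j ≡ state y c rest 0 i j
      start-same i j wi wj = close⇒state {s} {c} {0} {i} {j} {rest} close wi wj (≤-trans small (m≤n+m r (b + R + c)))

      agreeX : ∀ n → Agree (Trajectory.A X n)
      agreeX = persist X (λ i j _ → cong proj₁ (initial rest i j))

      agreeY : ∀ n → Agree (Trajectory.A Y n)
      agreeY = persist Y (λ i j D → trans (cong proj₁ (sym (start-same i j (near-x i (≤-trans (m≤m+n _ _) D)) (near-y j (≤-trans (m≤n+m _ _) D)))))
                                          (cong proj₁ (initial rest i j)))

      same-tile : ∀ n i j → InDiamond R (rel c i) (rel b j) → Trajectory.A X n i j ≡ Trajectory.A Y n i j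
      same-tile n i j D = trans (agreeX n i j D) (sym (agreeY n i j D))

    r≤s : r ≤ s
    r≤s = m≤n+m r (b + R + c)

    -- If all rows met by the window and its margin block, every window cell is a core in both
    -- configurations: its bit is 0 from time 1 on, and its tile belongs to the persistent diamond.
    robust-cores : ∀ R₂ → suc r + R₂ ≤ R → (∀ j → Win c (suc r) j → ∣ rel b j ∣ ≤ R₂ × Blocked j) → Robust (xθ v) r
    robust-cores R₂ le rows = robust (xθ v) {r} {c} {s} r<c λ y close rest small n i j wi wj →
      cong₂ _,_ (same-tile y close rest small n (suc i) (suc j) (diamond 1 1 (s≤s z≤n) (s≤s z≤n) wi wj))
        (agree-bits (X y close rest small) (Y y close rest small) (λ i j → Win c r (suc i) × Win c r (suc j))
           (λ i j (wi , wj) → cong proj₂ (start-same y close rest small (suc i) (suc j) (win-mono {c} {i = suc i} r≤s wi) (win-mono {c} {i = suc j} r≤s wj)))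
           (λ n i j (wi , wj) → inj₁ (cores (agreeX y close rest small n) wi wj , cores (agreeY y close rest small n) wi wj))
           n i j (wi , wj))
      where
      diamond : ∀ {i j} x y → x ≤ 2 → y ≤ 2 → Win c r (suc i) → Win c r (suc j) → InDiamond R (rel c (x + i)) (rel b (y + j))
      diamond {i} {j} x y px py wi wj = ≤-trans
        (+-mono-≤ (let p , q = win-nine {c} {r} {i} x px wi in rel-bound c (x + i) p q) (proj₁ (rows (y + j) (win-nine {c} {r} {j} y py wj)))) le
      cores : ∀ {A i j} → Agree A → Win c r (suc i) → Win c r (suc j) → CoreAt A i j
      cores {A} {i} {j} h wi wj = core-ideal h (λ x y px py → diamond {i} {j} x y px py wi wj) (λ y py → proj₂ (rows (y + j) (win-nine {c} {r} {j} y py wj)))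

  -- Without the detour rule, the rows above height t shade everything below them.
  module Shade (t r : ℕ) (noflag : flag ≡ false) where
    h R c : ℕ
    h = suc t + r
    -- Half-width `suc r` and height `3 + h` enclose the strip `W` together with all blocks
    -- consulted from it; the last summand makes room for the input arms.
    R = suc r + (3 + h) + (κ₁ + κ₂)
    c = suc R

    κ≤ : ∀ (k : Fin K) → inputs κ₁ κ₂ k ≤ R
    κ≤ fz          = ≤-trans (m≤m+n κ₁ κ₂) (m≤n+m (κ₁ + κ₂) (suc r + (3 + h)))
    κ≤ (fs fz)     = ≤-trans (m≤n+m κ₂ κ₁) (m≤n+m (κ₁ + κ₂) (suc r + (3 + h)))
    κ≤ (fs (fs _)) = z≤n

    r<c : r < c
    r<c = s≤s (≤-trans (n≤1+n r) (≤-trans (m≤m+n (suc r) (3 + h)) (m≤m+n (suc r + (3 + h)) (κ₁ + κ₂))))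

    open Protect (+ 0) c c r R (sym (ℤₚ.+-inverseʳ (+ c))) ≤-refl ≤-refl r<c κ≤
    open Centred c c R ≤-refl ≤-refl κ≤

    W : ℕ → ℕ → Set
    W i j = Win c r (suc i) × c ≤ suc j + r × suc j ≤ c + h

    diamond : ∀ {i j} x y → x ≤ 2 → y ≤ 3 → W i j → InDiamond R (rel c (x + i)) (rel c (y + j))
    diamond {i} {j} x y px py (wi , lo , hi) = ≤-trans (+-mono-≤
      (let p , q = win-nine {c} {r} {i} x px wi in rel-bound c (x + i) p q)
      (rel-bound c (y + j) {3 + h}
        (≤-trans lo (≤-trans (≤-reflexive (sym (+-suc j r))) (+-mono-≤ (m≤n+m j y) (s≤s (≤-trans (m≤n+m r (suc t)) (m≤n+m h 2))))))
        (≤-trans (+-monoˡ-≤ j py) (≤-trans (s≤s (s≤s hi)) (≤-trans (≤-trans (≤-reflexive (sym (trans (+-suc c (suc h)) (cong suc (+-suc c h))))) ≤-refl) (+-monoʳ-≤ c (n≤1+n (2 + h))))))))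
      (m≤m+n _ (κ₁ + κ₂))

    robust-shade : (∀ j → c + suc t ≤ j → Blocked j) → Robust (xθ (+ 0)) r
    robust-shade blocked = robust (xθ (+ 0)) {r} {c} {s} r<c λ y close rest small n i j wi wj →
      cong₂ _,_ (same-tile y close rest small n (suc i) (suc j) (diamond {i} {j} 1 1 (s≤s z≤n) (s≤s z≤n) (inW {i} {j} wi wj)))
        (agree-bits (X y close rest small) (Y y close rest small) W
          (λ i j w → cong proj₂ (start-same y close rest small (suc i) (suc j)
             (near-x (suc i) (≤-trans (m≤m+n _ _) (diamond {i} {j} 1 1 (s≤s z≤n) (s≤s z≤n) w)))
             (near-y (suc j) (≤-trans (m≤n+m _ _) (diamond {i} {j} 1 1 (s≤s z≤n) (s≤s z≤n) w)))))
          (λ n i j w → inj₂ (noflag ,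
             (λ x y′ px py → same-tile y close rest small n (x + i) (y′ + j) (diamond {i} {j} x y′ px (m≤n⇒m≤1+n py) w)) ,
             (λ x y′ px py → same-tile y close rest small n (x + i) (y′ + suc j) (above x y′ px py w)) ,
             north (agreeX y close rest small n) w))
          n i j (inW {i} {j} wi wj))
      where
      inW : ∀ {i j} → Win c r (suc i) → Win c r (suc j) → W i j
      inW wi (lo , hi) = wi , lo , ≤-trans hi (+-monoʳ-≤ c (m≤n+m r (suc t)))
      above : ∀ {i j} x y → x ≤ 2 → y ≤ 2 → W i j → InDiamond R (rel c (x + i)) (rel c (y + suc j))
      above {i} {j} x y px py w = subst (λ z → InDiamond R (rel c (x + i)) (rel c z)) (sym (+-suc y j)) (diamond {i} {j} x (suc y) px (s≤s py) w)
      north : ∀ {A i j} → Agree A → W i j → CoreAt A i (1 + j) ⊎ W i (1 + j)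
      -- Either the northern cell is still in the strip, or its whole block lies in rows from
      -- `c + suc t` upwards, which all block.
      north {A} {i} {j} ag w@(wi , lo , hi) with suc (suc j) ≤? c + suc t
      ... | yes le = inj₂ (wi , m≤n⇒m≤1+n lo , ≤-trans le (+-monoʳ-≤ c (m≤m+n (suc t) r)))
      ... | no gt  = inj₁ (core-ideal ag (λ x y px py → above {i} {j} x y px py w)
                            (λ y _ → blocked (y + suc j) (≤-trans (s≤s⁻¹ (≰⇒> gt)) (m≤n+m (suc j) y))))

-- Cutting a configuration down to finitely many tiles

rel-shift : ∀ e c i → rel (e + c) (e + i) ≡ rel c i
rel-shift zero    c i = refl
rel-shift (suc e) c i = rel-shift e c i

module Perturbation (M : Machine) (β : Sg → Machine.Q M → Bool) (flag : Bool) (d κ₁ κ₂ : ℕ) where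
  open Machine M
  open Automaton M β flag
  open Rule M β flag
  open Dynamics M β flag d κ₁ κ₂ public

  rest₀ : Cell d
  rest₀ = replicate d (+ 0)

  norm-rest₀ : ∀ {r} → ‖ rest₀ ‖∞ ≤ r
  norm-rest₀ {r} = ≤-trans (≤-reflexive (go d)) z≤n
    where
    go : ∀ d → ‖ replicate d (+ 0) ‖∞ ≡ 0
    go zero    = refl
    go (suc d) = go d

  nine-cong : ∀ {A A′ : Grid} {i j} → (∀ x y → x ≤ 2 → y ≤ 2 → A (x + i) (y + j) ≡ A′ (x + i) (y + j)) → CoreAt A i j → CoreAt A′ i j
  nine-cong {A} {A′} {i} {j} s c
    rewrite s 0 0 z≤n z≤n | s 0 1 z≤n (s≤s z≤n) | s 0 2 z≤n ≤-refl
          | s 1 0 (s≤s z≤n) z≤n | s 1 1 (s≤s z≤n) (s≤s z≤n) | s 1 2 (s≤s z≤n) ≤-refl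
          | s 2 0 ≤-refl z≤n | s 2 1 ≤-refl (s≤s z≤n) | s 2 2 ≤-refl ≤-refl = c

  nine-alive : ∀ {A : Grid} {i j} → CoreAt A i j → ∀ x y → x ≤ 2 → y ≤ 2 → ∃ λ t → A (x + i) (y + j) ≡ just t
  nine-alive {A} {i} {j} c = go
    where
    alive : ∀ {m} → Bm m → ∃ λ t → m ≡ just t
    alive b with t , e , _ ← any-elim b = t , e
    go : ∀ x y → x ≤ 2 → y ≤ 2 → ∃ λ t → A (x + i) (y + j) ≡ just t
    go 0 0 _ _ = alive (Core.b₁ c)
    go 0 1 _ _ = alive (Core.b₂ c)
    go 0 2 _ _ = alive (Core.b₃ c)
    go 1 0 _ _ = alive (Core.b₄ c)
    go 1 1 _ _ = alive (Core.b₅ c)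
    go 1 2 _ _ = alive (Core.b₆ c)
    go 2 0 _ _ = alive (Core.b₇ c)
    go 2 1 _ _ = alive (Core.b₈ c)
    go 2 2 _ _ = alive (Core.b₉ c)
    go (suc (suc (suc _))) _ (s≤s (s≤s ())) _
    go 0 (suc (suc (suc _))) _ (s≤s (s≤s ()))
    go 1 (suc (suc (suc _))) _ (s≤s (s≤s ()))
    go 2 (suc (suc (suc _))) _ (s≤s (s≤s ()))

  -- Tiles neither change nor reappear, so a surviving core was present all along. This identifies
  -- the final cores of two cuts, which may be frozen at different chosen times.
  core-past : ∀ {w} (T : Trajectory κ₁ κ₂) (C : Confined T w) {i j} → CoreAt (Finite.G T C) i j → ∀ n → CoreAt (Trajectory.A T n) i j
  core-past T C {i} {j} c n with Finite.T₀ T C ≤? n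
  ... | yes le = Finite.frozen-core T C le c
  ... | no gt  = nine-cong {G} {A n} (λ x y px py → let t , e = nine-alive {G} c x y px py in
                   trans e (sym (back (T₀ ∸ n) (subst (λ m → A m (x + i) (y + j) ≡ just t) (sym (m∸n+n≡m (<⇒≤ (≰⇒> gt)))) e)))) c
    where
    open Trajectory T
    open Finite T C
    back : ∀ k {i j t} → A (k + n) i j ≡ just t → A n i j ≡ just t
    back zero    e = e
    back (suc k) e = back k (older (k + n) e)

  cut : ℕ → Bool → Conf² → Conf²
  cut s b x m with ‖ m ‖∞ ≤? s
  ... | yes _ = x m
  ... | no _  = enc (nothing , b)

  cut-in : ∀ s b x m → ‖ m ‖∞ ≤ s → x m ≡ cut s b x m
  cut-in s b x m le with ‖ m ‖∞ ≤? s
  ... | yes _ = refl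
  ... | no n  = contradiction le n

  cut-out : ∀ s b x m → s < ‖ m ‖∞ → dec (cut s b x m) ≡ (nothing , b)
  cut-out s b x m lt with ‖ m ‖∞ ≤? s
  ... | yes le = contradiction lt (≤⇒≯ le)
  ... | no _   = dec-enc _

  cut-tile : ∀ s b x m {t} → proj₁ (dec (cut s b x m)) ≡ just t → proj₁ (dec (x m)) ≡ just t
  cut-tile s b x m e with ‖ m ‖∞ ≤? s
  ... | yes _ = e
  ... | no _ with () ← trans (sym (cong proj₁ (dec-enc (nothing , b)))) e

  cut-same : ∀ s b b′ x m → proj₁ (dec (cut s b x m)) ≡ proj₁ (dec (cut s b′ x m))
  cut-same s b b′ x m with ‖ m ‖∞ ≤? s
  ... | yes _ = refl
  ... | no _  = trans (cong proj₁ (dec-enc (nothing , b))) (sym (cong proj₁ (dec-enc (nothing , b′))))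

  module Cut (x : Conf²) (s : ℕ) where
    c w : ℕ
    c = suc s
    -- Coordinates from `- s` to `s` become the indices from 1 to `w`, leaving the borders of index
    -- 0 empty.
    w = suc (s + s)

    T : Bool → Trajectory κ₁ κ₂
    T b = traj (cut s b x) c rest₀

    far-i : ∀ {i j} → s < ∣ rel c i ∣ → s < ‖ cell c rest₀ i j ‖∞
    far-i {i} {j} lt = ≤-trans (subst (λ z → s < ∣ z ∣) (rel-ℤ c i) lt) (m≤m⊔n _ _)

    far-j : ∀ {i j} → s < ∣ rel c j ∣ → s < ‖ cell c rest₀ i j ‖∞
    far-j {i} {j} lt = ≤-trans (subst (λ z → s < ∣ z ∣) (rel-ℤ c j) lt) (≤-trans (m≤m⊔n _ _) (m≤n⊔m (∣ origin c ℤ.+ + i ∣) _))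

    beyond : ∀ {i} → w < i → s < ∣ rel c i ∣
    beyond {i} lt with l , e ← rel-≥ c {i} {suc s} (subst (_≤ i) (cong suc (sym (+-suc s s))) lt) =
      subst (λ z → s < ∣ z ∣) (sym e) (m≤m+n (suc s) l)

    edge : s < ∣ rel c 0 ∣
    edge = ≤-refl

    confined : ∀ b → Confined (T b) w
    confined b = record
      { west  = λ j → cong proj₁ (cut-out s b x (cell c rest₀ 0 j) (far-i {0} {j} edge))
      ; south = λ i → cong proj₁ (cut-out s b x (cell c rest₀ i 0) (far-j {i} {0} edge))
      ; east  = λ i j lt → cong proj₁ (cut-out s b x (cell c rest₀ i j) (far-i {i} {j} (beyond lt)))
      ; north = λ i j lt → cong proj₁ (cut-out s b x (cell c rest₀ i j) (far-j {i} {j} (beyond lt))) }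

    module Fi (b : Bool) = Finite (T b) (confined b)

    G : Bool → Grid
    G b = Fi.G b

    around : ∀ b i j → w < j → Trajectory.B (T b) 0 i j ≡ b
    around b i j lt = cong proj₂ (cut-out s b x (cell c rest₀ i j) (far-j {i} {j} (beyond lt)))

    same-tiles : ∀ b b′ n i j → Trajectory.A (T b) n i j ≡ Trajectory.A (T b′) n i j
    same-tiles b b′ zero    i j = cut-same s b b′ x (cell c rest₀ i j)
    same-tiles b b′ (suc n) zero j = trans (Fi.dead-at b (suc n) {0} {j} (Confined.west (confined b) j)) (sym (Fi.dead-at b′ (suc n) {0} {j} (Confined.west (confined b′) j)))
    same-tiles b b′ (suc n) (suc i) zero = trans (Fi.dead-at b (suc n) {suc i} {0} (Confined.south (confined b) (suc i))) (sym (Fi.dead-at b′ (suc n) {suc i} {0} (Confined.south (confined b′) (suc i))))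
    same-tiles b b′ (suc n) (suc i) (suc j) = trans (Trajectory.stepA (T b) n i j)
      (trans (nextAt-cong κ₁ κ₂ (same-tiles b b′ n) i j) (sym (Trajectory.stepA (T b′) n i j)))

    same-core : ∀ {b b′ i j} → CoreAt (G b) i j → CoreAt (G b′) i j
    same-core {b} {b′} k = coreAt-cong (same-tiles b b′ (Fi.T₀ b′)) (core-past (T b) (confined b) k (Fi.T₀ b′))

    separated : flag ≡ true ⊎ (∀ i j → ¬ CoreAt (G false) i j) → ∀ i j → ¬ CoreAt (G false) i j →
      ∃ λ n → Trajectory.B (T false) n (suc i) (suc j) ≡ false × Trajectory.B (T true) n (suc i) (suc j) ≡ true
    separated mode i j nc =
      let m , e  = Fi.Escape.escape false false (around false) mode w (m≤n+m w j) nc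
          m′ , e′ = Fi.Escape.escape true true (around true) (mode-true mode) w (m≤n+m w j) (nc ∘ same-core {true} {false})
      in m ⊔ m′ , e _ (m≤m⊔n m m′) , e′ _ (m≤n⊔m m m′)
      where
      mode-true : flag ≡ true ⊎ (∀ i j → ¬ CoreAt (G false) i j) → flag ≡ true ⊎ (∀ i j → ¬ CoreAt (G true) i j)
      mode-true (inj₁ f) = inj₁ f
      mode-true (inj₂ h) = inj₂ (λ i j k → h i j (same-core {true} {false} k))

    stable : Stable κ₁ κ₂ (G false) w
    stable = Fi.stable false

  -- Some cell near the origin lies outside the cores and eventually shows the bit of the
  -- surroundings. The cuts of `x` with surroundings 0 and 1 then disagree there, so one of them
  -- disagrees with `x`; comparing symbols decides which.
  sensitive : (flag ≡ true ⊎ (∀ {G w} → Stable κ₁ κ₂ G w → ∀ i j → ¬ CoreAt G i j)) →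
    (t : ℕ) → (∀ {G w} → Stable κ₁ κ₂ G w → ∀ i j → ∃ λ k → k ≤ t × ¬ CoreAt G i (k + j)) → Sensitive step²
  -- `Far` asks for a norm strictly below the radius, and the cell found has height at most `t`.
  sensitive mode t porous = suc t , go
    where
    mode′ : ∀ x s → flag ≡ true ⊎ (∀ i j → ¬ CoreAt (Cut.G x s false) i j)
    mode′ x s = map₂ (λ h → h (Cut.stable x s)) mode

    Goal : ℕ → Conf² → Set
    Goal s x = ∃ λ y → ∃ λ n → Close s x y × Far (suc t) (iter step² n x) (iter step² n y)

    module At (s : ℕ) (x : Conf²) (k : ℕ) (k≤t : k ≤ t) where
      m : Cell (2 + d)
      m = cell (suc s) rest₀ (suc s) (suc (k + s))

      norm-i : ∣ origin (suc s) ℤ.+ + suc s ∣ ≤ t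
      norm-i = ≤-trans (≤-reflexive (cong ∣_∣ (trans (sym (rel-ℤ (suc s) (suc s))) (rel-refl s)))) z≤n

      norm-j : ∣ origin (suc s) ℤ.+ + suc (k + s) ∣ ≤ t
      norm-j = ≤-trans (≤-reflexive (cong ∣_∣ (trans (sym (rel-ℤ (suc s) (suc (k + s)))) (trans (cong (rel s) (+-comm k s)) (rel-+ s k))))) k≤t

      small : ‖ m ‖∞ < suc t
      small = s≤s (⊔-lub norm-i (⊔-lub norm-j norm-rest₀))

      conclude : ∀ n → proj₂ (dec (iter step² n (cut s false x) m)) ≡ false → proj₂ (dec (iter step² n (cut s true x) m)) ≡ true →
                 Dec (iter step² n x m ≡ iter step² n (cut s false x) m) → Goal s x
      conclude n f g (no ne)  = cut s false x , n , (λ i le → cut-in s false x i le) , m , small , ne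
      conclude n f g (yes eq) = cut s true x , n , (λ i le → cut-in s true x i le) , m , small ,
        λ eq′ → true≢false (trans (sym g) (trans (cong (λ z → proj₂ (dec z)) (trans (sym eq′) eq)) f))

      split : (∃ λ n → Trajectory.B (Cut.T x s false) n (suc s) (suc (k + s)) ≡ false × Trajectory.B (Cut.T x s true) n (suc s) (suc (k + s)) ≡ true) → Goal s x
      split (n , f , g) = conclude n f g (iter step² n x m Fin.≟ iter step² n (cut s false x) m)

    go : ∀ s x → Goal s x
    go s x = let k , k≤t , nc = porous (Cut.stable x s) s s in At.split s x k k≤t (Cut.separated x s (mode′ x s) s (k + s) nc)

  -- At an equicontinuous point every window must be filled with cores. A core in a small window
  -- belongs to a structure with a centre somewhere; a second window is taken large enough to
  -- contain that centre and the `t` cells above it. The centre is the same tile in both cuts, since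
  -- tiles are only ever erased.
  not-equicontinuous : flag ≡ true → (t : ℕ) →
    (∀ {G w} (S : Stable κ₁ κ₂ G w) i j → Structure.CentreAt S (suc i) (suc j) → (∀ k → k ≤ t → CoreAt G i (k + j)) → ⊥) → ¬ HasEquPoint step²
  not-equicontinuous fl t bad (x , equ) = contra
    where
    -- Otherwise the bits of the surroundings would reach the window.
    module Window (r s : ℕ) (le : proj₁ (equ r) ≤ s) (i j : ℕ) (wi : Win (suc s) r (suc i)) (wj : Win (suc s) r (suc j)) where
      bit : ∀ b n → proj₂ (state x (suc s) rest₀ n (suc i) (suc j)) ≡ Trajectory.B (Cut.T x s b) n (suc i) (suc j)
      bit b n = cong proj₂ (close⇒state {r} {suc s} {n} {suc i} {suc j} {rest₀} {x} {cut s b x}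
        (proj₂ (equ r) (cut s b x) (λ m le′ → cut-in s b x m (≤-trans le′ le)) n) wi wj norm-rest₀)

      clash : (∃ λ n → Trajectory.B (Cut.T x s false) n (suc i) (suc j) ≡ false × Trajectory.B (Cut.T x s true) n (suc i) (suc j) ≡ true) → ⊥
      clash (n , f , g) = true≢false (trans (sym g) (trans (sym (bit true n)) (trans (bit false n) f)))

      inhabited : Dec (CoreAt (Cut.G x s false) i j) → CoreAt (Cut.G x s false) i j
      inhabited (yes k) = k
      inhabited (no nc) = ⊥-elim (clash (Cut.separated x s (inj₁ fl) i j nc))

      window-core : CoreAt (Cut.G x s false) i j
      window-core = inhabited (coreAt? (Cut.G x s false) i j)

    s₁ : ℕ
    s₁ = proj₁ (equ 1)

    module C₁ = Cut x s₁

    near : Win (suc s₁) 1 (suc s₁)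
    near = m≤m+n (suc s₁) 1 , m≤m+n (suc s₁) 1

    core₁ : CoreAt (C₁.G false) s₁ s₁
    core₁ = Window.window-core 1 s₁ ≤-refl s₁ s₁ near near

    tile-x : ∀ s {i j u} → Cut.G x s false i j ≡ just u → proj₁ (state x (suc s) rest₀ 0 i j) ≡ just u
    tile-x s {i} {j} e = cut-tile s false x (cell (suc s) rest₀ i j) (Cut.Fi.original x s false (Cut.Fi.T₀ x s false) {i} {j} e)

    module Second (i j : ℕ) (u : Tile) (eu : C₁.G false (suc i) (suc j) ≡ just u) (cu : Centre u) where
      r s e : ℕ
      -- Enough to reach the centre found, of index `(suc i , suc j)`, and the `t` cells above it;
      -- `suc s₁` is the shift between indices and coordinates.
      r = suc s₁ + (i + j + t + 2)
      s = proj₁ (equ r) ⊔ s₁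
      e = s ∸ s₁
      module C₂ = Cut x s
      s≡ : s ≡ e + s₁
      s≡ = sym (m∸n+n≡m (m≤n⊔m (proj₁ (equ r)) s₁))
      lower : ∀ k l → suc s ≤ k + (e + l) + r
      lower k l = subst (λ z → suc z ≤ k + (e + l) + r) (sym s≡) (begin
        suc (e + s₁)           ≡⟨ +-suc e s₁ ⟨
        e + suc s₁             ≤⟨ +-mono-≤ (m≤m+n e l) (m≤m+n (suc s₁) (i + j + t + 2)) ⟩
        (e + l) + r            ≤⟨ +-monoˡ-≤ r (m≤n+m (e + l) k) ⟩
        k + (e + l) + r        ∎)
        where open ≤-Reasoning
      upper : ∀ k l → k + l ≤ i + j + t + 2 → k + (e + l) ≤ suc s + r
      upper k l le = subst (λ z → k + (e + l) ≤ suc z + r) (sym s≡) (begin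
        k + (e + l)            ≡⟨ +-assoc k e l ⟨
        k + e + l              ≡⟨ cong (_+ l) (+-comm k e) ⟩
        e + k + l              ≡⟨ +-assoc e k l ⟩
        e + (k + l)            ≤⟨ +-mono-≤ (≤-trans (m≤m+n e s₁) (n≤1+n _)) (≤-trans le (m≤n+m _ (suc s₁))) ⟩
        suc (e + s₁) + r       ∎)
        where open ≤-Reasoning
      win-i : Win (suc s) r (suc (e + i))
      win-i = lower 1 i , upper 1 i (≤-trans (≤-reflexive (+-comm 1 i)) (+-mono-≤ (≤-trans (m≤m+n i j) (m≤m+n (i + j) t)) (s≤s z≤n)))
      win-j : ∀ l → l ≤ t → Win (suc s) r (suc (l + (e + j)))
      win-j l lt = lower (suc l) j , upper (suc l) j (begin
        suc l + j     ≤⟨ +-monoˡ-≤ j (s≤s lt) ⟩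
        1 + t + j     ≡⟨ +-comm (1 + t) j ⟩
        j + (1 + t)   ≡⟨ cong (λ z → j + z) (+-comm 1 t) ⟩
        j + (t + 1)   ≡⟨ +-assoc j t 1 ⟨
        j + t + 1     ≤⟨ +-mono-≤ (+-monoˡ-≤ t (m≤n+m j i)) (s≤s z≤n) ⟩
        i + j + t + 2 ∎)
        where open ≤-Reasoning
      cores : ∀ k → k ≤ t → CoreAt (C₂.G false) (e + i) (k + (e + j))
      cores k le = Window.window-core r s (m≤m⊔n (proj₁ (equ r)) s₁) (e + i) (k + (e + j)) win-i (win-j k le)
      v : Tile
      v = proj₁ (nine-alive {C₂.G false} (cores 0 z≤n) 1 1 (s≤s z≤n) (s≤s z≤n))
      ev : C₂.G false (suc (e + i)) (suc (e + j)) ≡ just v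
      ev = proj₂ (nine-alive {C₂.G false} (cores 0 z≤n) 1 1 (s≤s z≤n) (s≤s z≤n))
      coord : ∀ l → origin (suc s) ℤ.+ + suc (e + l) ≡ origin (suc s₁) ℤ.+ + suc l
      coord l = begin
        origin (suc s) ℤ.+ + suc (e + l)   ≡⟨ rel-ℤ (suc s) (suc (e + l)) ⟨
        rel s (e + l)                      ≡⟨ cong (λ z → rel z (e + l)) s≡ ⟩
        rel (e + s₁) (e + l)               ≡⟨ rel-shift e s₁ l ⟩
        rel s₁ l                           ≡⟨ rel-ℤ (suc s₁) (suc l) ⟩
        origin (suc s₁) ℤ.+ + suc l        ∎
        where open ≡-Reasoning
      v≡u : v ≡ u
      v≡u = same (tile-x s {suc (e + i)} {suc (e + j)} ev) (trans (cong₂ (λ p q → proj₁ (dec (x (p ∷ q ∷ rest₀)))) (coord i) (coord j)) (tile-x s₁ {suc i} {suc j} eu))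

      contra : ⊥
      contra = bad C₂.stable (e + i) (e + j) (v , ev , subst Centre (sym v≡u) cu) cores

    centred : (∃ λ a → ∃ λ b → Structure.CentreAt C₁.stable a b) → ⊥
    centred (a , b , u , eu , cu) = go (Structure.alive-pos C₁.stable {a} {b} eu) eu
      where
      go : ∀ {a b} → (∃ λ i → ∃ λ j → a ≡ suc i × b ≡ suc j) → C₁.G false a b ≡ just u → ⊥
      go (i , j , refl , refl) eu = Second.contra i j u eu cu

    contra : ⊥
    contra = centred (Structure.centre C₁.stable {suc s₁} {suc s₁} (proj₂ (nine-alive {C₁.G false} core₁ 1 1 (s≤s z≤n) (s≤s z≤n))))

-- The reductions

-- The point may vary with `r`: protected windows of every size refute sensitivity without yielding
-- an equicontinuous point.
robust⇒¬sensitive : ∀ {d a} {F : Config d a → Config d a} →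
  (∀ r → ∃ λ x → ∃ λ s → ∀ y → Close s x y → ∀ n → Close r (iter F n x) (iter F n y)) → ¬ Sensitive F
robust⇒¬sensitive h (r , sens) =
  let x , s , p = h r ; y , n , cl , i , lt , ne = sens s x in ne (p y cl n i (<⇒≤ lt))

equ-sens-disjoint : ∀ {d n} → Equ d n → Sens d n → ⊥
equ-sens-disjoint (x , equ) = robust⇒¬sensitive (λ r → x , equ r)

module Halting (M : Machine) (κ₁ κ₂ : ℕ) where
  open Machine M

  HaltsHere : Set
  HaltsHere = Halts (inputs κ₁ κ₂)

  open Ideal M κ₁ κ₂ public

  halted-from : ∀ {t k} → halted (stateAt t) ≡ true → t ≤ k → halted (stateAt k) ≡ true
  halted-from h le = halted-later le h

  running : ¬ HaltsHere → ∀ k → not (halted (stateAt k)) ≡ true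
  running loop k with halted (stateAt k) in eq
  ... | true  = contradiction (k , eq) loop
  ... | false = refl

-- Three families of automata

-- Blocking rows of an ideal structure. First: all high rows if `M` halts, none otherwise. Second: a
-- strip above the base row if `M` halts, the open upper half otherwise, in no case the base row.
-- Third: everything below the halting time, or the whole plane.
blocking₁ blocking₂ blocking₃ : (M : Machine) → Sg → Machine.Q M → Bool
blocking₁ M pos q = Machine.halted M q
blocking₁ M _   q = false
blocking₂ M pos q = not (Machine.halted M q)
blocking₂ M _   q = false
blocking₃ M pos q = not (Machine.halted M q)
blocking₃ M _   q = true

module Family₁ (M : Machine) (d κ₁ κ₂ : ℕ) where
  open Machine M

  β : Sg → Q → Bool
  β = blocking₁ M

  open Halting M κ₁ κ₂
  open Automaton M β false
  open Perturbation M β false d κ₁ κ₂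

  equ : HaltsHere → HasEquPoint step²
  equ (t , h) = xθ (+ 0) , λ r → Shade.robust-shade t r refl (blocked t r)
    where
    blocked : ∀ t′ r j → (let c = Shade.c t′ r refl) → c + suc t ≤ j → β (sgn (rel c j)) (stθ (rel c j)) ≡ true
    blocked t′ r j le with l , e ← rel-≥ (Shade.c t′ r refl) {j} {suc t} le rewrite e = halted-from h (≤-trans (n≤1+n t) (m≤m+n (suc t) l))

  β-true : ∀ t → Blocking t → sy t ≡ pos × halted (st t) ≡ true
  β-true (tile _ pos _ _) b = refl , b

  -- A blocking tile in a stable grid would exhibit a halted state of the true computation. So there
  -- are no cores and the bits finally fall straight down.
  sens : ¬ HaltsHere → Sensitive step²
  sens loop = sensitive (inj₂ none) 0 (λ S i j → 0 , z≤n , none S i j)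
    where
    none : ∀ {G w} → Stable κ₁ κ₂ G w → ∀ i j → ¬ CoreAt G i j
    none {G} S i j c
      with t , e , b ← any-elim (Core.b₅ c)
      with y , h ← β-true t b
      with k , C ← Structure.column S (suc j) e (λ y′ → pos≢neg (trans (sym y) y′))
      = loop (k , trans (cong halted (sym (Structure.tile-state S k e C))) h)

module Family₂ (M : Machine) (d κ₁ κ₂ : ℕ) where
  open Machine M

  β : Sg → Q → Bool
  β = blocking₂ M

  open Halting M κ₁ κ₂
  open Automaton M β true
  open Perturbation M β true d κ₁ κ₂

  β-true : ∀ t → Blocking t → sy t ≡ pos × not (halted (st t)) ≡ true
  β-true (tile _ pos _ _) b = refl , b

  sens : HaltsHere → Sensitive step²
  sens (t , h) = sensitive (inj₁ refl) t porous
    where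
    module _ {G w} (S : Stable κ₁ κ₂ G w) (i j : ℕ) where
      open Structure S hiding (stateAt)

      search : ∀ k → (∃ λ l → l ≤ k × ¬ CoreAt G i (l + j)) ⊎ (∀ l → l ≤ k → CoreAt G i (l + j))
      search zero with coreAt? G i j
      ... | yes c = inj₂ (λ { zero _ → c })
      ... | no n  = inj₁ (0 , z≤n , n)
      search (suc k) with search k
      ... | inj₁ (l , le , n) = inj₁ (l , m≤n⇒m≤1+n le , n)
      ... | inj₂ all with coreAt? G i (suc k + j)
      ...   | no n  = inj₁ (suc k , ≤-refl , n)
      ...   | yes c = inj₂ λ l le → step-l l le
        where
        step-l : ∀ l → l ≤ suc k → CoreAt G i (l + j)
        step-l l le with m≤n⇒m<n∨m≡n le
        ... | inj₁ (s≤s lt) = all l lt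
        ... | inj₂ refl     = c

      -- With `k = t`, stacked cores push the uppermost blocking tile at least `t` rows above the
      -- base row, where the machine has halted and nothing can block.
      tower : ∀ k → (∀ l → l ≤ k → CoreAt G i (l + j)) → ∃ λ m → Col (k + m) (suc i) (suc (k + j))
      tower zero all
        with t , e , b ← any-elim (Core.b₅ (all 0 z≤n)) = column (suc j) e (λ y → pos≢neg (trans (sym (proj₁ (β-true t b))) y))
      tower (suc k) all
        with m , C ← tower k (λ l le → all l (m≤n⇒m≤1+n le))
        with t , e , b ← any-elim (Core.b₅ (all (suc k) ≤-refl)) = m , (t , e , proj₁ (β-true t b)) , C

      porous : ∃ λ k → k ≤ t × ¬ CoreAt G i (k + j)
      porous with search t
      ... | inj₁ r = r
      ... | inj₂ all
        with m , C ← tower t all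
        with u , e , b ← any-elim (Core.b₅ (all t ≤-refl))
        = ⊥-elim (true≢false (trans (sym (proj₂ (β-true u b))) (cong not (trans (cong halted (tile-state (t + m) e C)) (halted-from h (m≤m+n t m))))))

  -- The centre sits in the base row, which does not block, so no core can be centred there.
  ¬equ : ¬ HaltsHere → ¬ HasEquPoint step²
  ¬equ loop = not-equicontinuous refl 0 λ S i j (t , e , _ , y) cores → bad t y (any-elim (Core.b₅ (cores 0 z≤n))) e
    where
    bad : ∀ {m} t → sy t ≡ nul → (∃ λ u → m ≡ just u × Blocking u) → m ≡ just t → ⊥
    bad (tile _ nul _ _) refl (u , e , b) e′ with refl ← same e e′ with () ← b

  ¬sens : ¬ HaltsHere → ¬ Sensitive step²
  ¬sens loop = robust⇒¬sensitive λ r → xθ (v r) , rob r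
    where
    module _ (r : ℕ) where
      gap R₂ R b c : ℕ
      -- The window lies `gap` rows above the centre. Its margin reaches `r + 1` rows down, hence to
      -- height 2, so only rows strictly above the base are met.
      gap = r + 3
      R₂ = suc r + gap
      R = suc r + R₂ + (κ₁ + κ₂)
      b = suc R
      c = b + gap
      v : ℤ
      v = + c ℤ.- + b
      κ≤ : ∀ (k : Fin K) → inputs κ₁ κ₂ k ≤ R
      κ≤ fz          = ≤-trans (m≤m+n κ₁ κ₂) (m≤n+m (κ₁ + κ₂) (suc r + R₂))
      κ≤ (fs fz)     = ≤-trans (m≤n+m κ₂ κ₁) (m≤n+m (κ₁ + κ₂) (suc r + R₂))
      κ≤ (fs (fs _)) = z≤n
      r<c : r < c
      r<c = ≤-trans (≤-trans (≤-reflexive (sym (+-comm r 1))) (+-monoʳ-≤ r (s≤s z≤n))) (m≤n+m gap b)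
      rows : ∀ j → Win c (suc r) j → ∣ rel b j ∣ ≤ R₂ × β (sgn (rel b j)) (stθ (rel b j)) ≡ true
      rows j (lo , hi) =
        rel-bound b j (≤-trans (m≤m+n b gap) (≤-trans lo (+-monoʳ-≤ j (m≤m+n (suc r) gap))))
                      (≤-trans hi (≤-trans (≤-reflexive (+-assoc b gap (suc r))) (+-monoʳ-≤ b (≤-reflexive (+-comm gap (suc r)))))) , blk
        where
        high : b + 2 ≤ j
        high = +-cancelʳ-≤ (suc r) (b + 2) j (≤-trans (≤-reflexive (trans (+-assoc b 2 (suc r)) (cong (λ z → b + z) (+-comm 3 r)))) lo)
        blk : β (sgn (rel b j)) (stθ (rel b j)) ≡ true
        blk with l , e ← rel-≥ b {j} {2} high rewrite e = running loop (2 + l)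
      rob : Robust (xθ v) r
      rob = Protect.robust-cores v c b r R refl (≤-trans ≤-refl (m≤m+n b gap)) ≤-refl r<c κ≤ R₂ (m≤m+n (suc r + R₂) (κ₁ + κ₂)) rows

module Family₃ (M : Machine) (d κ₁ κ₂ : ℕ) where
  open Machine M

  β : Sg → Q → Bool
  β = blocking₃ M

  open Halting M κ₁ κ₂
  open Automaton M β true
  open Perturbation M β true d κ₁ κ₂

  module Bounds (r gap : ℕ) where
    R₂ R : ℕ
    R₂ = suc r + gap
    R = suc r + R₂ + (κ₁ + κ₂)
    κ≤ : ∀ (k : Fin K) → inputs κ₁ κ₂ k ≤ R
    κ≤ fz          = ≤-trans (m≤m+n κ₁ κ₂) (m≤n+m (κ₁ + κ₂) (suc r + R₂))
    κ≤ (fs fz)     = ≤-trans (m≤n+m κ₂ κ₁) (m≤n+m (κ₁ + κ₂) (suc r + R₂))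
    κ≤ (fs (fs _)) = z≤n
    r<c : r < suc R
    r<c = s≤s (≤-trans (n≤1+n r) (≤-trans (m≤m+n (suc r) R₂) (m≤m+n (suc r + R₂) (κ₁ + κ₂))))

  equ : ¬ HaltsHere → HasEquPoint step²
  equ loop = xθ (+ 0) , rob
    where
    blk : ∀ e → β (sgn e) (stθ e) ≡ true
    blk (+ zero)  = refl
    blk (+ suc k) = running loop (suc k)
    blk -[1+ k ]  = refl
    rob : ∀ r → Robust (xθ (+ 0)) r
    rob r = Protect.robust-cores (+ 0) c c r R (sym (ℤₚ.+-inverseʳ (+ c))) ≤-refl ≤-refl r<c κ≤ R₂ (m≤m+n (suc r + R₂) (κ₁ + κ₂))
      (λ j (lo , hi) → ≤-trans (rel-bound c j lo hi) (m≤m+n (suc r) 0) , blk (rel c j))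
      where
      open Bounds r 0
      c : ℕ
      c = suc R

  ¬sens : HaltsHere → ¬ Sensitive step²
  ¬sens _ = robust⇒¬sensitive λ r → xθ (+ (suc (Bounds.R r (r + 3))) ℤ.- + (suc (Bounds.R r (r + 3)) + (r + 3))) , rob r
    where
    rob : ∀ r → (let c = suc (Bounds.R r (r + 3))) → Robust (xθ (+ c ℤ.- + (c + (r + 3)))) r
    rob r = Protect.robust-cores (+ c ℤ.- + b) c b r R refl ≤-refl (m≤m+n c gap) r<c κ≤ R₂ (m≤m+n (suc r + R₂) (κ₁ + κ₂)) rows
      where
      gap b c : ℕ
      -- Now the window lies `gap` rows below the centre; its margin reaches `r + 1` rows up and
      -- stays under the base row, where everything blocks.
      gap = r + 3
      open Bounds r gap
      c = suc R
      b = c + gap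
      rows : ∀ j → Win c (suc r) j → ∣ rel b j ∣ ≤ R₂ × β (sgn (rel b j)) (stθ (rel b j)) ≡ true
      rows j (lo , hi) =
        rel-bound b j (≤-trans (+-monoˡ-≤ gap lo) (≤-reflexive (+-assoc j (suc r) gap)))
                      (≤-trans hi (+-mono-≤ (m≤m+n c gap) (m≤m+n (suc r) gap))) , blk
        where
        low : j < b
        low = ≤-trans (s≤s hi) (≤-trans (≤-reflexive (sym (+-suc c (suc r)))) (+-monoʳ-≤ c (≤-trans (≤-reflexive (+-comm 2 r)) (+-monoʳ-≤ r (n≤1+n 2)))))
        blk : β (sgn (rel b j)) (stθ (rel b j)) ≡ true
        blk with m , e ← rel-< low rewrite e = refl

  ¬equ : HaltsHere → ¬ HasEquPoint step²
  -- `suc t` instead of `t`: even for `t = 0` the halted row must lie strictly above the base row,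
  -- which blocks whatever its state.
  ¬equ (t , h) = not-equicontinuous refl (suc t) bad
    where
    β-pos : ∀ u → sy u ≡ pos → Blocking u → not (halted (st u)) ≡ true
    β-pos (tile _ pos _ _) refl b = b

    module _ {G w} (S : Stable κ₁ κ₂ G w) (i j : ℕ) (cen : Structure.CentreAt S (suc i) (suc j)) (cores : ∀ k → k ≤ suc t → CoreAt G i (k + j)) where
      open Structure S hiding (stateAt)

      link-up : ∀ {a b} → Link a b → a ≢ neg → b ≡ pos
      link-up neg-neg n = contradiction refl n
      link-up neg-nul n = contradiction refl n
      link-up nul-pos _ = refl
      link-up pos-pos _ = refl

      climb : ∀ k → k ≤ suc t → ∃ λ u → G (suc i) (suc (k + j)) ≡ just u × sy u ≢ neg × Col k (suc i) (suc (k + j)) × (1 ≤ k → sy u ≡ pos)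
      climb zero _ = let u , e , _ , y = cen in u , e , (λ y′ → nul≢neg (trans (sym y) y′)) , (u , e , y) , λ ()
      climb (suc k) le
        with u , e , n , C , _ ← climb k (<⇒≤ le)
        with u′ , e₁ , vl ← any-elim (Core.v₄ (cores k (<⇒≤ le)))
        with v , e₂ , l , _ ← any-elim vl
        with refl ← same e e₁
        with y ← link-up l n
        = v , e₂ , (λ y′ → pos≢neg (trans (sym y) y′)) , ((v , e₂ , y) , C) , λ _ → y

      bad : ⊥
      bad
        with u , e , _ , C , y ← climb (suc t) ≤-refl
        with u′ , e′ , b ← any-elim (Core.b₅ (cores (suc t) ≤-refl))
        with refl ← same e e′
        = true≢false (trans (sym (β-pos u (y (s≤s z≤n)) b)) (cong not (trans (cong halted (tile-state (suc t) e C)) (halted-from h (n≤1+n t)))))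

-- By self-reference: whatever g is, some automaton reacts to the termination of g on its own code n.
Controls : (ℕ → Set) → (ℕ → Set) → Set
Controls A B = ∀ (g : PR 1) → ∃ λ n → ((∃ λ v → g ⟨ n ∷ [] ⟩⇓ v) → A n) × (¬ (∃ λ v → g ⟨ n ∷ [] ⟩⇓ v) → B n)

module Diagonal (β : (M : Machine) → Sg → Machine.Q M → Bool) (flag : Bool) (d : ℕ) (g : PR 1) where
  M : Machine
  M = machineOf (g $₁ codeP)

  open Rule M (β M) flag

  κ₁ κ₂ n : ℕ
  -- There is no circle: `M`, and with it alphabet and table, is fixed before the offsets are
  -- chosen.
  κ₁ = alphabet
  κ₂ = tableCode alphabet localMap
  n = caCode alphabet localMap (offsets κ₁ κ₂)

  decoded : decodeCA (2 + d) n ≡ ca d κ₁ κ₂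
  decoded = decode-caCode alphabet localMap d (offsets κ₁ κ₂)

  halts⇒ : Machine.Halts M (inputs κ₁ κ₂) → ∃ λ v → g ⟨ n ∷ [] ⟩⇓ v
  halts⇒ h with v , ev-comp (ev-∷ c ev-[]) e ← halts⇒eval (g $₁ codeP) κ₁ κ₂ h =
    v , subst (λ z → g ⟨ z ∷ [] ⟩⇓ v) (⇓-det c (code-ev alphabet localMap)) e

  ⇒halts : (∃ λ v → g ⟨ n ∷ [] ⟩⇓ v) → Machine.Halts M (inputs κ₁ κ₂)
  ⇒halts (v , e) = eval⇒halts (g $₁ codeP) κ₁ κ₂ (ev₁ (code-ev alphabet localMap) e)

  to-Equ : HasEquPoint (F d κ₁ κ₂) → Equ (2 + d) n
  to-Equ = subst (λ c → HasEquPoint (global c)) (sym decoded) ∘ subst HasEquPoint (F-global d κ₁ κ₂)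

  from-Equ : Equ (2 + d) n → HasEquPoint (F d κ₁ κ₂)
  from-Equ = subst HasEquPoint (sym (F-global d κ₁ κ₂)) ∘ subst (λ c → HasEquPoint (global c)) decoded

  to-Sens : Sensitive (F d κ₁ κ₂) → Sens (2 + d) n
  to-Sens = subst (λ c → Sensitive (global c)) (sym decoded) ∘ subst Sensitive (F-global d κ₁ κ₂)

  from-Sens : Sens (2 + d) n → Sensitive (F d κ₁ κ₂)
  from-Sens = subst Sensitive (sym (F-global d κ₁ κ₂)) ∘ subst (λ c → Sensitive (global c)) decoded

  to-Neither : ¬ HasEquPoint (F d κ₁ κ₂) → ¬ Sensitive (F d κ₁ κ₂) → NeitherEquSens (2 + d) n
  to-Neither ne ns = ne ∘ from-Equ , ns ∘ from-Sens

equ-or-sens : ∀ d → Controls (Equ (2 + d)) (Sens (2 + d))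
equ-or-sens d g = n , to-Equ ∘ equ ∘ ⇒halts , λ no → to-Sens (sens (no ∘ halts⇒))
  where
  open Diagonal blocking₁ false d g
  open Family₁ M d κ₁ κ₂

sens-or-neither : ∀ d → Controls (Sens (2 + d)) (NeitherEquSens (2 + d))
sens-or-neither d g = n , to-Sens ∘ sens ∘ ⇒halts , λ no → to-Neither (¬equ (no ∘ halts⇒)) (¬sens (no ∘ halts⇒))
  where
  open Diagonal blocking₂ true d g
  open Family₂ M d κ₁ κ₂

neither-or-equ : ∀ d → Controls (NeitherEquSens (2 + d)) (Equ (2 + d))
neither-or-equ d g = n , (λ y → let h = ⇒halts y in to-Neither (¬equ h) (¬sens h)) , λ no → to-Equ (equ (no ∘ halts⇒))
  where
  open Diagonal blocking₃ true d g
  open Family₃ M d κ₁ κ₂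

-- From control to non-enumerability and inseparability

module _ {A B : ℕ → Set} (ctrl : Controls A B) where

  -- Take the automaton that watches the alleged enumerator on its own code: halting would put the
  -- code into both `A` and `B`; looping puts it into `B`, where `e` must halt.
  ¬RecEnum-right : (∀ n → A n → B n → ⊥) → ¬ RecEnum B
  ¬RecEnum-right disj (e , spec) with n , halt , loop ← ctrl e =
    let out : ∃ (λ v → e ⟨ n ∷ [] ⟩⇓ v) → ⊥
        out y = disj n (halt y) (Equivalence.from (spec n) y)
    in out (Equivalence.to (spec n) (loop out))

  -- Halting puts the code into `A`, outside the set enumerated; looping puts it into `B`, hence
  -- outside `A`, where `e` must halt.
  ¬CoRecEnum-left : (∀ n → A n → B n → ⊥) → ¬ CoRecEnum A
  ¬CoRecEnum-left disj (e , spec) with n , halt , loop ← ctrl e =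
    let out : ∃ (λ v → e ⟨ n ∷ [] ⟩⇓ v) → ⊥
        out y = Equivalence.from (spec n) y (halt y)
    in out (Equivalence.to (spec n) (λ a → disj n a (loop out)))

  -- Halts exactly when `e` returns 0: the minimised function does not depend on its search
  -- variable.
  zero-test : PR 1 → PR 1
  zero-test e = muF (projF (fs fz)) $₁ e

  zero-test-halts : ∀ {e x} → e ⟨ x ∷ [] ⟩⇓ 0 → ∃ λ v → zero-test e ⟨ x ∷ [] ⟩⇓ v
  zero-test-halts d = 0 , ev₁ d (ev-mu ev-proj (λ _ ()))

  zero-test-loops : ∀ {e x k} → e ⟨ x ∷ [] ⟩⇓ suc k → ¬ (∃ λ v → zero-test e ⟨ x ∷ [] ⟩⇓ v)
  zero-test-loops {k = k} d (v , ev-comp (ev-∷ d′ ev-[]) (ev-mu p _)) with refl ← ⇓-det d d′ with () ← ⇓-det p (ev-proj {i = fs fz} {xs = v ∷ suc k ∷ []})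

  flip : PR 1
  flip = precF (constP 1) zeroF

  flip₀ : flip ⟨ 0 ∷ [] ⟩⇓ 1
  flip₀ = ev-prec0 (const-ev 1)

  flip₁ : flip ⟨ 1 ∷ [] ⟩⇓ 0
  flip₁ = ev-precS flip₀ ev-zero

  -- The verdict of `e` on the code is defied: verdict 1 makes the machine loop and puts the code
  -- into `B`, verdict 0 makes it halt and puts the code into `A`.
  inseparable : RecInseparable A B
  inseparable (C , (e , dec) , A⊆C , C∩B) with n , halt , loop ← ctrl (zero-test e) | dec n
  ... | inj₁ (c , d) = C∩B n c (loop (zero-test-loops {e} d))
  ... | inj₂ (c , d) = c (A⊆C n (halt (zero-test-halts {e} d)))

  inseparable′ : RecInseparable B A
  inseparable′ (C , (e , dec) , B⊆C , C∩A) with n , halt , loop ← ctrl (zero-test (flip $₁ e)) | dec n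
  ... | inj₁ (c , d) = C∩A n c (halt (zero-test-halts {flip $₁ e} (ev₁ d flip₁)))
  ... | inj₂ (c , d) = c (B⊆C n (loop (zero-test-loops {flip $₁ e} (ev₁ d flip₀))))

theorem1 : (d : ℕ) → 2 ≤ d →
    NotRENotCoRE (Equ d) × NotRENotCoRE (Sens d) × NotRENotCoRE (NeitherEquSens d)
    × RecInseparable (Equ d) (Sens d)
    × RecInseparable (Equ d) (NeitherEquSens d)
    × RecInseparable (Sens d) (NeitherEquSens d)
theorem1 (suc (suc d)) _ =
  (¬RecEnum-right (neither-or-equ d) (λ n n′ e → proj₁ n′ e) , ¬CoRecEnum-left (equ-or-sens d) (λ n → equ-sens-disjoint {2 + d} {n})) ,
  (¬RecEnum-right (equ-or-sens d) (λ n → equ-sens-disjoint {2 + d} {n}) , ¬CoRecEnum-left (sens-or-neither d) (λ n s n′ → proj₂ n′ s)) ,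
  (¬RecEnum-right (sens-or-neither d) (λ n s n′ → proj₂ n′ s) , ¬CoRecEnum-left (neither-or-equ d) (λ n n′ e → proj₁ n′ e)) ,
  inseparable (equ-or-sens d) , inseparable′ (neither-or-equ d) , inseparable (sens-or-neither d)
theorem1 (suc zero) (s≤s ())
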